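{- Let $q>3$ be a prime power and let $t>1$ be an integer. Let $s,s'$ be positive integers with $\gcd(s,t)=1=\gcd(s',t)$, and consider the polynomials $f(x)=x^{q^s}$ and $f'(x)=x^{q^{s'}}$ in $\mathbb F_{q^t}[x]$. Then the translation planes $\mathcal A_f$ and $\mathcal A_{f'}$ are isomorphic if and only if $s\equiv\pm s'\pmod t$.
   Context: An $\mathbb F_q$-linearized polynomial in $\mathbb F_{q^t}[x]$ is one of the form $f(x)=\sum_{i=0}^k a_ix^{q^i}$. It is called scattered if for all $y,z\in\mathbb F_{q^t}$ the condition $zf(y)-yf(z)=0$ implies that $y$ and $z$ are linearly dependent over $\mathbb F_q$. The polynomials $x^{q^s}$ with $\gcd(s,t)=1$ are scattered. For a scattered $\mathbb F_q$-linearized polynomial $f(x)$ put $U_f=\{(x,f(x)) : x\in\mathbb F_{q^t}\}$, an $\mathbb F_q$-subspace of $\mathbb F_{q^t}^2$, and $L_f=\{f(x)/x : x\in\mathbb F_{q^t}^*\}\subseteq\mathbb F_{q^t}$. A planar spread of a vector space $\mathbb V$ is a collection $\mathcal B$ of at least three subspaces such that $\mathbb V=V\oplus V'$ for all distinct $V,V'\in\mathcal B$ and every vector of $\mathbb V$ lies in some member of $\mathcal B$. The translation plane $\mathcal A(\mathcal B)$ is the affine plane whose points are the vectors of $\mathbb V$ and whose lines are the cosets $V+w$ ($V\in\mathcal B$, $w\in\mathbb V$). Let $\mathcal B_f$ be the collection consisting of the following subspaces of $\mathbb F_{q^t}^2$: $\langle(1,m)\rangle_{\mathbb F_{q^t}}$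 for $m\in\mathbb F_{q^t}\setminus L_f$; $hU_f=\{hv:v\in U_f\}$ for $h\in\mathbb F_{q^t}^*$; and $\{0\}\times\mathbb F_{q^t}$. This is a planar spread of $\mathbb F_{q^t}^2$ (as an $\mathbb F_q$-vector space), and the translation plane associated with $f$ is $\mathcal A_f=\mathcal A(\mathcal B_f)$. Two planes are isomorphic if there is a bijection between their point sets that maps lines onto lines (in both directions). -}

module Defs where

open import Algebra.Bundles using (AbelianGroup; CommutativeRing)
open import Algebra.Definitions using (Invertible)
open import Algebra.Module.Bundles using (Module)
import Algebra.Module.Construct.DirectProduct as DirectProduct
import Algebra.Module.Construct.TensorUnit as TensorUnit
import Algebra.Properties.Semiring.Exp as Exp
open import Data.Fin.Base using (Fin)
open import Data.Integer.Base using (ℤ; +_; _-_)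
import Data.Integer.Divisibility as ℤ
open import Data.Nat.Base using (ℕ; _<_; _^_)
open import Data.Nat.Primality using (Prime)
open import Data.Product.Base using (Σ-syntax; ∃; ∃-syntax; ∃₂; _×_; _,_; proj₁)
open import Function.Bundles using (Inverse; _⇔_)
open import Level using (Level; _⊔_; suc)
open import Relation.Binary.Bundles using (Setoid)
open import Relation.Binary.Definitions using (_Respects_)
open import Relation.Binary.PropositionalEquality.Core using (_≡_)
import Relation.Binary.PropositionalEquality.Properties as ≡
open import Relation.Nullary.Negation.Core using (¬_)
open import Relation.Unary using (Pred; _∈_; _∉_)

IsPrimePower : ℕ → Set
IsPrimePower q = ∃₂ λ p k → Prime p × 0 < k × q ≡ p ^ k

infix 4 _≡_[mod_]

_≡_[mod_] : ℤ → ℤ → ℕ → Set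
a ≡ b [mod n ] = + n ℤ.∣ a - b

-- The library's HeytingField phrases invertibility through an apartness
-- relation; a finite field has decidable equality, so the usual x ≉ 0 is used.

record FiniteField (c ℓ : Level) (n : ℕ) : Set (suc (c ⊔ ℓ)) where
  field
    commutativeRing : CommutativeRing c ℓ

  open CommutativeRing commutativeRing public

  field
    1≉0        : ¬ (1# ≈ 0#)
    invertible : ∀ x → ¬ (x ≈ 0#) → Invertible _≈_ 1# _*_ x
    finite     : Inverse setoid (≡.setoid (Fin n))

  inverse : ∀ x → ¬ (x ≈ 0#) → Carrier
  inverse x x≉0 = proj₁ (invertible x x≉0)

-- Distinct elements of Line may carry the same points: a line is the set of
-- points incident with it, and no statement below compares elements of Line.

record IncidenceStructure (a b l i : Level) : Set (suc (a ⊔ b ⊔ l ⊔ i)) where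
  field
    points : Setoid a b
    Line   : Set l

  open Setoid points public using () renaming (Carrier to Point)

  field
    _On_    : Point → Line → Set i
    On-resp : ∀ {K} → (_On K) Respects Setoid._≈_ points

module _ {a b l i a′ b′ l′ i′ : Level}
         (P : IncidenceStructure a b l i) (Q : IncidenceStructure a′ b′ l′ i′) where
  private
    module P = IncidenceStructure P
    module Q = IncidenceStructure Q

  -- For a bijection g, the condition on L′ says that L′ = g(L) as point sets.
  MapsLinesToLines : (P.Point → Q.Point) → Set (a ⊔ l ⊔ i ⊔ l′ ⊔ i′)
  MapsLinesToLines g = ∀ L → ∃[ L′ ] (∀ p → (p P.On L) ⇔ (g p Q.On L′))

module _ {a b l i a′ b′ l′ i′ : Level} where

  Isomorphic : IncidenceStructure a b l i → IncidenceStructure a′ b′ l′ i′ →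
               Set (a ⊔ b ⊔ l ⊔ i ⊔ a′ ⊔ b′ ⊔ l′ ⊔ i′)
  Isomorphic P Q =
    Σ[ φ ∈ Inverse (IncidenceStructure.points P) (IncidenceStructure.points Q) ]
      MapsLinesToLines P Q (Inverse.to φ) × MapsLinesToLines Q P (Inverse.from φ)

-- The plane 𝒜(ℬ) of a collection ℬ = { B j }: the pair (j , w) is the line
-- B j + w. Only the additive group of the vector space enters.

translationPlane : ∀ {a b j r} (V : AbelianGroup a b) {J : Set j} →
                   (J → Pred (AbelianGroup.Carrier V) r) →
                   IncidenceStructure a b (a ⊔ j) (a ⊔ b ⊔ r)
translationPlane V {J} B = record
  { points  = V.setoid
  ; Line    = J × V.Carrier
  ; _On_    = λ p (j , w) → ∃[ v ] (v ∈ B j × p V.≈ (v V.∙ w))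
  ; On-resp = λ { p≈p′ (v , v∈B , p≈v+w) → v , v∈B , V.trans (V.sym p≈p′) p≈v+w }
  }
  where module V = AbelianGroup V

module _ {c ℓ : Level} {n : ℕ} (F : FiniteField c ℓ n) where
  open FiniteField F

  private
    F² : Module commutativeRing c ℓ
    F² = DirectProduct.⟨module⟩ TensorUnit.⟨module⟩ TensorUnit.⟨module⟩

    open Module F² using (Carrierᴹ; _≈ᴹ_; _*ₗ_; +ᴹ-abelianGroup)

  -- x ↦ x^(q^s), the function of the polynomial x^(q^s).
  frobeniusPower : (q s : ℕ) → Carrier → Carrier
  frobeniusPower q s x = Exp._^_ semiring x (q ^ s)

  -- A polynomial f enters the constructions below only through the function
  -- F → F that it defines.
  module _ (f : Carrier → Carrier) where

    U : Pred Carrierᴹ (c ⊔ ℓ)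
    U v = ∃[ x ] v ≈ᴹ (x , f x)

    L : Pred Carrier (c ⊔ ℓ)
    L m = ∃[ x ] Σ[ x≉0 ∈ ¬ (x ≈ 0#) ] (m ≈ f x * inverse x x≉0)

    data SpreadIndex : Set (c ⊔ ℓ) where
      slope    : (m : Carrier) → m ∉ L → SpreadIndex
      multiple : (h : Carrier) → ¬ (h ≈ 0#) → SpreadIndex
      vertical : SpreadIndex

    spread : SpreadIndex → Pred Carrierᴹ (c ⊔ ℓ)
    spread (slope m _)    v = ∃[ k ] v ≈ᴹ (k *ₗ (1# , m))
    spread (multiple h _) v = ∃[ u ] (u ∈ U × v ≈ᴹ (h *ₗ u))
    spread vertical       v = ∃[ y ] v ≈ᴹ (0# , y)

    𝒜 : IncidenceStructure c ℓ (c ⊔ ℓ) (c ⊔ ℓ)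
    𝒜 = translationPlane +ᴹ-abelianGroup spread

-- An isomorphism maps parallel lines to parallel lines, so up to a translation
-- it is an additive bijection ψ carrying one spread to the other. Call a slope m
-- straight if ψ maps the ray of (1 , m) onto a ray. The slopes in L and those sent
-- to multiples of U number at most 2θ, θ = (q^t - 1)/(q - 1), since L consists of
-- θ-th roots of unity; hence for q > 3 the r straight slopes other than a fixed
-- one satisfy r² > q^t. In a frame of three straight slopes ψ acts on each ray
-- through one additive map σ, and every further straight slope yields an element
-- x with σ (k x) = σ k σ x for all k. Such x form a subfield whose order exceeds
-- the square root of q^t, so σ is an automorphism and ψ is semilinear. Then ψ maps
-- U to a multiple of U′, which is an identity between linearized polynomials with
-- exponents 0, s, s′ and s + s′. Unless s ≡ ± s′ these are distinct modulo t, and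
-- the vanishing of the coefficients contradicts the surjectivity of ψ. Conversely,
-- the identity (s ≡ s′) and the exchange of coordinates (s ≡ - s′) are isomorphisms.

module Submission where

open import Defs
open import Algebra.Bundles using (CommutativeMonoid; CommutativeRing)
import Algebra.Construct.DirectProduct as ProductRing
open import Algebra.Module.Bundles using (Module)
import Algebra.Module.Construct.DirectProduct as DirectProduct
import Algebra.Module.Construct.TensorUnit as TensorUnit
open import Algebra.Morphism.Structures using (IsRingHomomorphism)
import Algebra.Properties.AbelianGroup as AbelianGroupProperties
import Algebra.Properties.CommutativeMonoid.Sum as MonoidSum
import Algebra.Properties.CommutativeSemiring.Binomial as Binomial
import Algebra.Properties.CommutativeSemiring.Exp as CommutativeExp
import Algebra.Properties.Group as GroupProperties
import Algebra.Properties.Ring as RingProperties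
import Algebra.Properties.Semiring.Mult as Mult
import Algebra.Properties.Semiring.Mult.TCOptimised as Mult′
import Algebra.Solver.Ring as RingSolver
open import Algebra.Solver.Ring.AlmostCommutativeRing
  using (fromCommutativeRing; _-Raw-AlmostCommutative⟶_)
open import Data.Empty using (⊥; ⊥-elim)
open import Data.Fin.Base as Fin using (Fin; zero; suc)
import Data.Fin.Permutation as Perm
import Data.Fin.Properties as Fin
import Data.Integer.Base as ℤ
import Data.Integer.Properties as ℤ
open import Data.List.Base as List using (List; []; _∷_; length)
open import Data.List.Membership.Propositional.Properties using (∈-lookup)
import Data.List.Properties as List
open import Data.List.Relation.Binary.Sublist.Propositional using (_⊆_; []; _∷_; _∷ʳ_)
open import Data.List.Relation.Binary.Sublist.Propositional.Properties using (All-resp-⊆)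
open import Data.List.Relation.Unary.All as All using (All; []; _∷_)
open import Data.List.Relation.Unary.AllPairs using (AllPairs; []; _∷_)
open import Data.List.Relation.Unary.Unique.Setoid using (Unique)
import Data.List.Relation.Unary.Unique.Setoid.Properties as Unique
open import Data.Maybe.Base as Maybe using (Maybe)
open import Data.Nat.Base as ℕ using (ℕ; zero; suc; _≤_; _<_)
open import Data.Nat.Combinatorics using (_C_; nCk+nC[k+1]≡[n+1]C[k+1]; nCn≡1; nC1≡n; k>n⇒nCk≡0)
import Data.Nat.Divisibility as ℕ
open import Data.Nat.DivMod using (_/_; _%_; [m+kn]%n≡m%n; m≡m%n+[m/n]*n; m%n<n)
open import Data.Nat.GCD as ℕ using (gcd)
open import Data.Nat.Primality using (Prime; euclidsLemma)
import Data.Nat.Properties as ℕ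
open import Data.Nat.Tactic.RingSolver using (solve-∀)
open import Data.Product.Base using (∃; ∃₂; _×_; _,_; proj₁; proj₂; swap)
open import Data.Product.Function.NonDependent.Setoid using (_×-inverse_)
open import Data.Product.Relation.Binary.Pointwise.NonDependent using (_×ₛ_)
open import Data.Sum.Base using (_⊎_; inj₁; inj₂)
open import Data.Vec.Functional using (Vector)
open import Function.Base using (_∘_)
open import Function.Bundles using (Equivalence; Inverse; _⇔_; mk⇔)
import Function.Construct.Composition as Composition
import Function.Construct.Identity as Identity
open import Level using (Level; _⊔_)
open import Relation.Binary.Bundles using (Setoid)
import Relation.Binary.Construct.On as On
open import Relation.Binary.Core using (Rel)
open import Relation.Binary.Definitions using (Decidable; tri<; tri≈; tri>)
open import Relation.Binary.PropositionalEquality as ≡ using (_≡_)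
import Relation.Binary.Reasoning.Setoid as SetoidReasoning
open import Relation.Nullary using (Dec; ¬_; yes; no; contradiction)
open import Relation.Nullary.Decidable as Dec using (dec⇒maybe; map′)
open import Relation.Unary using (Pred; _∈_; _∉_)

-- The obstacle is that scalars of the large field are not visible in the plane: multiplication by k
-- carries h U to itself only when f fixes k, so an additive ψ that respects the spreads has no
-- evident reason to respect these scalars. Only the components that are rays know about them,
-- whence the search for rays whose images are rays again. Three straight slopes play the roles of
-- infinity, 0 and 1 on the projective line, and the element x attached to a further straight slope
-- is its cross ratio with them. The numbers fit as follows. Put n = q^t. From q ≥ 4 comes 3θ < n,
-- so more than n / 3 slopes are straight. One of them is spent as the point at infinity, and the
-- square of the remaining number still exceeds n as soon as n ≥ 16 = 4 ^ 2, the least value allowed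
-- by q ≥ 4 and t ≥ 2. Membership in L is never decided: the decidable set of θ-th roots of unity
-- contains L and obeys the same bound θ.

-- Binomial coefficients and geometric sums.

[1+k]*[1+n]C[1+k]≡[1+n]*nCk : ∀ n k → suc k ℕ.* (suc n C suc k) ≡ suc n ℕ.* (n C k)
[1+k]*[1+n]C[1+k]≡[1+n]*nCk zero zero = ≡.refl
[1+k]*[1+n]C[1+k]≡[1+n]*nCk zero (suc k) = begin
  suc (suc k) ℕ.* (1 C suc (suc k))
    ≡⟨ ≡.cong (suc (suc k) ℕ.*_) (k>n⇒nCk≡0 {1} {suc (suc k)} (ℕ.s≤s (ℕ.s≤s ℕ.z≤n))) ⟩
  suc (suc k) ℕ.* 0                  ≡⟨ ℕ.*-zeroʳ (suc (suc k)) ⟩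
  0                                  ≡⟨ ≡.cong (1 ℕ.*_) (k>n⇒nCk≡0 {0} {suc k} (ℕ.s≤s ℕ.z≤n)) ⟨
  1 ℕ.* (0 C suc k)                  ∎
  where open ≡.≡-Reasoning
[1+k]*[1+n]C[1+k]≡[1+n]*nCk (suc n) zero = begin
  1 ℕ.* (suc (suc n) C 1)            ≡⟨ ≡.cong (1 ℕ.*_) (nC1≡n (suc (suc n))) ⟩
  1 ℕ.* suc (suc n)                  ≡⟨ ℕ.*-comm 1 (suc (suc n)) ⟩
  suc (suc n) ℕ.* (suc n C 0)        ∎
  where open ≡.≡-Reasoning
[1+k]*[1+n]C[1+k]≡[1+n]*nCk (suc n) (suc k) = begin
  suc k′ ℕ.* (suc n′ C suc k′)
    ≡⟨ ≡.cong (suc k′ ℕ.*_) (nCk+nC[k+1]≡[n+1]C[k+1] n′ k′) ⟨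
  suc k′ ℕ.* ((n′ C k′) ℕ.+ (n′ C suc k′))          ≡⟨ expand k′ (n′ C k′) (n′ C suc k′) ⟩
  (n′ C k′) ℕ.+ k′ ℕ.* (n′ C k′) ℕ.+ suc k′ ℕ.* (n′ C suc k′)
    ≡⟨ ≡.cong₂ (λ a b → (n′ C k′) ℕ.+ a ℕ.+ b)
         ([1+k]*[1+n]C[1+k]≡[1+n]*nCk n k) ([1+k]*[1+n]C[1+k]≡[1+n]*nCk n k′) ⟩
  (n′ C k′) ℕ.+ n′ ℕ.* (n C k) ℕ.+ n′ ℕ.* (n C k′)  ≡⟨ collect (n′ C k′) n′ (n C k) (n C k′) ⟩
  (n′ C k′) ℕ.+ n′ ℕ.* ((n C k) ℕ.+ (n C k′))
    ≡⟨ ≡.cong (λ a → (n′ C k′) ℕ.+ n′ ℕ.* a) (nCk+nC[k+1]≡[n+1]C[k+1] n k) ⟩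
  suc n′ ℕ.* (n′ C k′)                              ∎
  where
  open ≡.≡-Reasoning
  n′ = suc n
  k′ = suc k
  expand : ∀ k a b → suc k ℕ.* (a ℕ.+ b) ≡ a ℕ.+ k ℕ.* a ℕ.+ suc k ℕ.* b
  expand = solve-∀
  collect : ∀ a n b c → a ℕ.+ n ℕ.* b ℕ.+ n ℕ.* c ≡ a ℕ.+ n ℕ.* (b ℕ.+ c)
  collect = solve-∀

-- By the absorption identity the prime divides the product of `suc k` and the coefficient, and it
-- is too large to divide `suc k`.
prime∣pC[1+k] : ∀ {p k} → Prime p → suc k < p → p ℕ.∣ p C suc k
prime∣pC[1+k] {suc p} {k} p-prime 1+k<p
  with euclidsLemma (suc k) (suc p C suc k) p-prime
         (≡.subst (suc p ℕ.∣_) (≡.sym ([1+k]*[1+n]C[1+k]≡[1+n]*nCk p k)) (ℕ.m∣m*n (p C k)))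
... | inj₁ p∣1+k = contradiction (ℕ.∣⇒≤ p∣1+k) (ℕ.<⇒≱ 1+k<p)
... | inj₂ p∣C   = p∣C

-- The sum 1 + q + ... + q^(t - 1) in Horner form, which is (q^t - 1) / (q - 1) for q > 1.
geometricSum : ℕ → ℕ → ℕ
geometricSum q zero    = 0
geometricSum q (suc t) = suc (q ℕ.* geometricSum q t)

-- The equation (q - 1) θ = q^t - 1, arranged so that no natural number is subtracted.
geometricSum-identity : ∀ q t → q ℕ.* geometricSum q t ℕ.+ 1 ≡ geometricSum q t ℕ.+ q ℕ.^ t
geometricSum-identity q zero    = ≡.cong (ℕ._+ 1) (ℕ.*-zeroʳ q)
geometricSum-identity q (suc t) = begin
  q ℕ.* suc (q ℕ.* g) ℕ.+ 1           ≡⟨ ≡.cong (λ a → q ℕ.* a ℕ.+ 1) (ℕ.+-comm 1 (q ℕ.* g)) ⟩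
  q ℕ.* (q ℕ.* g ℕ.+ 1) ℕ.+ 1         ≡⟨ ≡.cong (λ a → q ℕ.* a ℕ.+ 1) (geometricSum-identity q t) ⟩
  q ℕ.* (g ℕ.+ q ℕ.^ t) ℕ.+ 1         ≡⟨ distribute q g (q ℕ.^ t) ⟩
  suc (q ℕ.* g) ℕ.+ q ℕ.* q ℕ.^ t     ∎
  where
  open ≡.≡-Reasoning
  g = geometricSum q t
  distribute : ∀ q g r → q ℕ.* (g ℕ.+ r) ℕ.+ 1 ≡ suc (q ℕ.* g) ℕ.+ q ℕ.* r
  distribute = solve-∀

-- Splitting and counting lists without repetition.

private
  variable
    ℓᵃ ℓᵇ ℓᵖ ℓʳ ℓ ℓ′ : Level
    A : Set ℓᵃ

splitAll : {P : Pred A ℓᵖ} {Q : Pred A ℓʳ} {xs : List A} → All (λ x → P x ⊎ Q x) xs →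
           ∃₂ λ ys zs → ys ⊆ xs × zs ⊆ xs × All P ys × All Q zs × length xs ≡ length ys ℕ.+ length zs
splitAll [] = [] , [] , [] , [] , [] , [] , ≡.refl
splitAll (px⊎qx ∷ pqs) with ys , zs , ys⊆ , zs⊆ , pys , qzs , eq ← splitAll pqs | px⊎qx
... | inj₁ px = _ ∷ ys , zs , ≡.refl ∷ ys⊆ , _ ∷ʳ zs⊆ , px ∷ pys , qzs , ≡.cong suc eq
... | inj₂ qx = ys , _ ∷ zs , _ ∷ʳ ys⊆ , ≡.refl ∷ zs⊆ , pys , qx ∷ qzs ,
                ≡.trans (≡.cong suc eq) (≡.sym (ℕ.+-suc (length ys) (length zs)))

AllPairs-resp-⊆ : {R : Rel A ℓʳ} {xs ys : List A} → ys ⊆ xs → AllPairs R xs → AllPairs R ys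
AllPairs-resp-⊆ []           []         = []
AllPairs-resp-⊆ (x ∷ʳ τ)     (_ ∷ rs)   = AllPairs-resp-⊆ τ rs
AllPairs-resp-⊆ (≡.refl ∷ τ) (r ∷ rs)   = All-resp-⊆ τ r ∷ AllPairs-resp-⊆ τ rs

module _ (S : Setoid ℓᵃ ℓ) (T : Setoid ℓᵇ ℓ′) {P : Pred (Setoid.Carrier S) ℓᵖ} where
  private
    module S = Setoid S
    module T = Setoid T

  reduce-unique : (g : ∀ {x} → P x → T.Carrier) →
                  (∀ {x y} (px : P x) (py : P y) → g px T.≈ g py → x S.≈ y) →
                  ∀ {xs} → Unique S xs → (ps : All P xs) → Unique T (All.reduce g ps)
  reduce-unique g g-inj []         []        = []
  reduce-unique g g-inj (x≉ ∷ xs!) (px ∷ ps) = distinct x≉ ps ∷ reduce-unique g g-inj xs! ps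
    where
    distinct : ∀ {ys} → All (λ y → ¬ _ S.≈ y) ys → (qs : All P ys) →
               All (λ z → ¬ g px T.≈ z) (All.reduce g qs)
    distinct []        []        = []
    distinct (x≉y ∷ r) (q ∷ qs) = x≉y ∘ g-inj px q ∷ distinct r qs

length-reduce : {B : Set ℓᵇ} {P : Pred A ℓᵖ} (g : ∀ {x} → P x → B) →
                ∀ {xs} (ps : All P xs) → length (All.reduce g ps) ≡ length xs
length-reduce g []       = ≡.refl
length-reduce g (_ ∷ ps) = ≡.cong suc (length-reduce g ps)

All-reduce : {B : Set ℓᵇ} {P : Pred A ℓᵖ} {Q : Pred B ℓʳ} (g : ∀ {x} → P x → B) → (∀ {x} (px : P x) → Q (g px)) →
             ∀ {xs} (ps : All P xs) → All Q (All.reduce g ps)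
All-reduce g q []       = []
All-reduce g q (p ∷ ps) = q p ∷ All-reduce g q ps

length-cartesianProductWith : {B : Set ℓᵇ} {C : Set ℓᵖ} (f : A → B → C) (xs : List A) (ys : List B) →
                              length (List.cartesianProductWith f xs ys) ≡ length xs ℕ.* length ys
length-cartesianProductWith f []       ys = ≡.refl
length-cartesianProductWith f (x ∷ xs) ys =
  ≡.trans (List.length-++ (List.map (f x) ys))
          (≡.cong₂ ℕ._+_ (List.length-map (f x) ys) (length-cartesianProductWith f xs ys))

-- Counting in finite setoids.

module FiniteSetoid (S : Setoid ℓᵃ ℓ) {n : ℕ} (enumeration : Inverse S (≡.setoid (Fin n))) where
  open Setoid S
  open Inverse enumeration

  from-injective : ∀ {i j} → from i ≈ from j → i ≡ j
  from-injective eq = ≡.trans (≡.sym (strictlyInverseˡ _)) (≡.trans (to-cong eq) (strictlyInverseˡ _))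

  to-injective : ∀ {x y} → to x ≡ to y → x ≈ y
  to-injective eq = trans (sym (strictlyInverseʳ _)) (trans (from-cong eq) (strictlyInverseʳ _))

  infix 4 _≟_
  _≟_ : Decidable _≈_
  x ≟ y = map′ to-injective to-cong (to x Fin.≟ to y)

  elements : List Carrier
  elements = List.tabulate from

  elements-unique : Unique S elements
  elements-unique = Unique.tabulate⁺ S from-injective

  lookup-injective : ∀ {xs} → Unique S xs → ∀ i j → List.lookup xs i ≈ List.lookup xs j → i ≡ j
  lookup-injective (x≉ ∷ xs!) zero    zero    eq = ≡.refl
  lookup-injective (x≉ ∷ xs!) zero    (suc j) eq = contradiction eq (All.lookup x≉ (∈-lookup j))
  lookup-injective (x≉ ∷ xs!) (suc i) zero    eq = contradiction (sym eq) (All.lookup x≉ (∈-lookup i))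
  lookup-injective (x≉ ∷ xs!) (suc i) (suc j) eq = ≡.cong suc (lookup-injective xs! i j eq)

  unique⇒length≤ : ∀ {xs} → Unique S xs → length xs ≤ n
  unique⇒length≤ {xs} xs! =
    Fin.injective⇒≤ {f = to ∘ List.lookup xs} (lookup-injective xs! _ _ ∘ to-injective)

  abstract
    -- A missed value put in front of the list of all images would give n + 1 distinct elements.
    injective⇒surjective : (g : Carrier → Carrier) → (∀ {x y} → g x ≈ g y → x ≈ y) →
                           ∀ y → ∃ λ x → g x ≈ y
    injective⇒surjective g g-inj y with Fin.any? (λ i → g (from i) ≟ y)
    ... | yes (i , eq) = from i , eq
    ... | no ∄i = contradiction
      (≡.subst (ℕ._≤ n)
        (≡.cong suc (≡.trans (List.length-map g elements) (List.length-tabulate from)))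
        (unique⇒length≤ {y ∷ List.map g elements}
          (missed n from (λ i eq → ∄i (i , eq)) ∷ Unique.map⁺ S S g-inj elements-unique)))
      ℕ.1+n≰n
      where
      missed : ∀ m (h : Fin m → Carrier) → (∀ i → ¬ g (h i) ≈ y) →
               All (λ z → ¬ y ≈ z) (List.map g (List.tabulate h))
      missed zero    h ∄ = []
      missed (suc m) h ∄ = ∄ zero ∘ sym ∷ missed m (h ∘ suc) (∄ ∘ suc)

-- A ring solver with integer coefficients for an arbitrary commutative ring.

module IntegerCoefficients {c ℓ} (R : CommutativeRing c ℓ) where
  open CommutativeRing R
  open GroupProperties +-group using () renaming (⁻¹-involutive to -‿involutive; ε⁻¹≈ε to -0≈0)
  open AbelianGroupProperties +-abelianGroup using () renaming (⁻¹-∙-comm to -‿+-comm)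
  open RingProperties ring using (-‿distribˡ-*; -‿distribʳ-*)
  open Mult′ semiring renaming (_×_ to _×′_)
  open SetoidReasoning setoid

  -- This variant of the multiple makes the images of 0 and 1 reduce to the ring constants, so that
  -- solved equations match goals in which these constants occur literally.
  ⟦_⟧ : ℤ.ℤ → Carrier
  ⟦ ℤ.+ n ⟧      = n ×′ 1#
  ⟦ ℤ.-[1+ n ] ⟧ = - (suc n ×′ 1#)

  ⊖-homo : ∀ m n → ⟦ m ℤ.⊖ n ⟧ ≈ m ×′ 1# - n ×′ 1#
  ⊖-homo m zero = sym (trans (+-congˡ -0≈0) (+-identityʳ _))
  ⊖-homo zero (suc n) = sym (+-identityˡ _)
  ⊖-homo (suc m) (suc n) = begin
    ⟦ suc m ℤ.⊖ suc n ⟧                  ≡⟨ ≡.cong ⟦_⟧ (ℤ.[1+m]⊖[1+n]≡m⊖n m n) ⟩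
    ⟦ m ℤ.⊖ n ⟧                          ≈⟨ ⊖-homo m n ⟩
    m1 - n1                              ≈⟨ +-congˡ (+-identityˡ _) ⟨
    m1 + (0# - n1)                       ≈⟨ +-congˡ (+-congʳ (-‿inverseʳ 1#)) ⟨
    m1 + (1# - 1# - n1)                  ≈⟨ +-congˡ (+-assoc _ _ _) ⟩
    m1 + (1# + (- 1# - n1))              ≈⟨ +-assoc _ _ _ ⟨
    m1 + 1# + (- 1# - n1)                ≈⟨ +-cong (+-comm _ _) (-‿+-comm 1# n1) ⟩
    1# + m1 - (1# + n1)                  ≈⟨ +-cong (1+× m 1#) (-‿cong (1+× n 1#)) ⟨
    suc m ×′ 1# - suc n ×′ 1#            ∎
    where
    m1 = m ×′ 1#
    n1 = n ×′ 1#

  -‿homo : ∀ i → ⟦ ℤ.- i ⟧ ≈ - ⟦ i ⟧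
  -‿homo (ℤ.+ zero)   = sym -0≈0
  -‿homo (ℤ.+ suc n)  = refl
  -‿homo ℤ.-[1+ n ]   = sym (-‿involutive _)

  +-homo : ∀ i j → ⟦ i ℤ.+ j ⟧ ≈ ⟦ i ⟧ + ⟦ j ⟧
  +-homo (ℤ.+ m)    (ℤ.+ n)    = ×-homo-+ 1# m n
  +-homo (ℤ.+ m)    ℤ.-[1+ n ] = ⊖-homo m (suc n)
  +-homo ℤ.-[1+ m ] (ℤ.+ n)    = trans (⊖-homo n (suc m)) (+-comm _ _)
  +-homo ℤ.-[1+ m ] ℤ.-[1+ n ] = begin
    ⟦ ℤ.-[1+ m ] ℤ.+ ℤ.-[1+ n ] ⟧       ≡⟨ ≡.cong ⟦_⟧ (ℤ.neg-distrib-+ ℤ.+[1+ m ] ℤ.+[1+ n ]) ⟨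
    ⟦ ℤ.- (ℤ.+[1+ m ] ℤ.+ ℤ.+[1+ n ]) ⟧ ≈⟨ -‿homo (ℤ.+[1+ m ] ℤ.+ ℤ.+[1+ n ]) ⟩
    - ⟦ ℤ.+[1+ m ] ℤ.+ ℤ.+[1+ n ] ⟧     ≈⟨ -‿cong (×-homo-+ 1# (suc m) (suc n)) ⟩
    - (suc m ×′ 1# + suc n ×′ 1#)       ≈⟨ -‿+-comm _ _ ⟨
    - (suc m ×′ 1#) - suc n ×′ 1#       ∎

  *-homo⁺ : ∀ i n → ⟦ i ℤ.* ℤ.+ n ⟧ ≈ ⟦ i ⟧ * ⟦ ℤ.+ n ⟧
  *-homo⁺ (ℤ.+ m) n = trans (reflexive (≡.cong ⟦_⟧ (≡.sym (ℤ.pos-* m n)))) (×1-homo-* m n)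
  *-homo⁺ ℤ.-[1+ m ] n = begin
    ⟦ ℤ.-[1+ m ] ℤ.* ℤ.+ n ⟧            ≡⟨ ≡.cong ⟦_⟧ (ℤ.neg-distribˡ-* ℤ.+[1+ m ] (ℤ.+ n)) ⟨
    ⟦ ℤ.- (ℤ.+[1+ m ] ℤ.* ℤ.+ n) ⟧      ≈⟨ -‿homo (ℤ.+[1+ m ] ℤ.* ℤ.+ n) ⟩
    - ⟦ ℤ.+[1+ m ] ℤ.* ℤ.+ n ⟧          ≈⟨ -‿cong (*-homo⁺ ℤ.+[1+ m ] n) ⟩
    - (suc m ×′ 1# * n ×′ 1#)           ≈⟨ -‿distribˡ-* _ _ ⟩
    - (suc m ×′ 1#) * n ×′ 1#           ∎

  *-homo : ∀ i j → ⟦ i ℤ.* j ⟧ ≈ ⟦ i ⟧ * ⟦ j ⟧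
  *-homo i (ℤ.+ n)    = *-homo⁺ i n
  *-homo i ℤ.-[1+ n ] = begin
    ⟦ i ℤ.* ℤ.-[1+ n ] ⟧        ≡⟨ ≡.cong ⟦_⟧ (ℤ.neg-distribʳ-* i ℤ.+[1+ n ]) ⟨
    ⟦ ℤ.- (i ℤ.* ℤ.+[1+ n ]) ⟧  ≈⟨ -‿homo (i ℤ.* ℤ.+[1+ n ]) ⟩
    - ⟦ i ℤ.* ℤ.+[1+ n ] ⟧      ≈⟨ -‿cong (*-homo⁺ i (suc n)) ⟩
    - (⟦ i ⟧ * suc n ×′ 1#)     ≈⟨ -‿distribʳ-* _ _ ⟩
    ⟦ i ⟧ * - (suc n ×′ 1#)     ∎

  morphism : ℤ.+-*-rawRing -Raw-AlmostCommutative⟶ fromCommutativeRing R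
  morphism = record
    { ⟦_⟧    = ⟦_⟧
    ; +-homo = +-homo
    ; *-homo = *-homo
    ; -‿homo = -‿homo
    ; 0-homo = refl
    ; 1-homo = refl
    }

  -- Distinct integers give no answer rather than a refutation, since they may agree in positive
  -- characteristic.
  coeff-equality : ∀ i j → Maybe (⟦ i ⟧ ≈ ⟦ j ⟧)
  coeff-equality i j = Maybe.map (λ { ≡.refl → refl }) (dec⇒maybe (i ℤ.≟ j))

  open RingSolver ℤ.+-*-rawRing (fromCommutativeRing R) morphism
    coeff-equality public
    using (solve; _:=_; con; _:+_; _:*_; :-_; _:-_)

-- Sums over a finite setoid.

module _ (M : CommutativeMonoid ℓᵃ ℓ) where
  open CommutativeMonoid M
  open MonoidSum M using (sum; sum-cong-≋; sum-replicate-zero; sum-permute)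

  sum-supported : ∀ {n} (t : Vector Carrier n) e → (∀ i → ¬ i ≡ e → t i ≈ ε) → sum t ≈ t e
  sum-supported {suc n} t zero    t≈ε =
    trans (∙-congˡ (trans (sum-cong-≋ (λ i → t≈ε (suc i) λ ())) (sum-replicate-zero n)))
          (identityʳ _)
  sum-supported {suc n} t (suc e) t≈ε =
    trans (∙-cong (t≈ε zero λ ())
                  (sum-supported (t ∘ suc) e (λ i i≢e → t≈ε (suc i) (i≢e ∘ Fin.suc-injective))))
          (identityˡ _)

  module _ (S : Setoid ℓᵇ ℓ′) {n : ℕ} (enumeration : Inverse S (≡.setoid (Fin n))) where
    private module S = Setoid S
    open Inverse enumeration

    -- Conjugating π by the enumeration yields a permutation of the indices.
    sum-bijection : (π : Inverse S S) (h : S.Carrier → Carrier) → (∀ {x y} → x S.≈ y → h x ≈ h y) →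
                    sum (h ∘ Inverse.to π ∘ from) ≈ sum (h ∘ from)
    sum-bijection π h h-cong = sym (trans
      (sum-permute (h ∘ from) (Perm.permutation (to ∘ π.to ∘ from) (to ∘ π.from ∘ from) right left))
      (sum-cong-≋ {y = h ∘ π.to ∘ from} (λ i → h-cong (strictlyInverseʳ _))))
      where
      module π = Inverse π
      right : ∀ i → to (π.to (from (to (π.from (from i))))) ≡ i
      right i = ≡.trans (to-cong (S.trans (π.to-cong (strictlyInverseʳ _)) (π.strictlyInverseˡ _)))
                        (strictlyInverseˡ _)
      left : ∀ i → to (π.from (from (to (π.to (from i))))) ≡ i
      left i = ≡.trans (to-cong (S.trans (π.from-cong (strictlyInverseʳ _)) (π.strictlyInverseʳ _)))
                       (strictlyInverseˡ _)

-- Field arithmetic, polynomials and their roots.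

module FieldProperties {c ℓ n} (F : FiniteField c ℓ n) where
  open FiniteField F hiding (zero)
  open IntegerCoefficients commutativeRing
  open FiniteSetoid setoid finite public
  open CommutativeExp commutativeSemiring using (_^_)
  open SetoidReasoning setoid

  inverseˡ : ∀ {x} (x≉0 : ¬ x ≈ 0#) → inverse x x≉0 * x ≈ 1#
  inverseˡ x≉0 = proj₁ (proj₂ (invertible _ x≉0))

  inverseʳ : ∀ {x} (x≉0 : ¬ x ≈ 0#) → x * inverse x x≉0 ≈ 1#
  inverseʳ x≉0 = proj₂ (proj₂ (invertible _ x≉0))

  *-cancelˡ-≉0 : ∀ {x y z} → ¬ x ≈ 0# → x * y ≈ x * z → y ≈ z
  *-cancelˡ-≉0 {x} {y} {z} x≉0 xy≈xz = begin
    y                        ≈⟨ *-identityˡ y ⟨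
    1# * y                   ≈⟨ *-congʳ (inverseˡ x≉0) ⟨
    inverse x x≉0 * x * y    ≈⟨ *-assoc _ _ _ ⟩
    inverse x x≉0 * (x * y)  ≈⟨ *-congˡ xy≈xz ⟩
    inverse x x≉0 * (x * z)  ≈⟨ *-assoc _ _ _ ⟨
    inverse x x≉0 * x * z    ≈⟨ *-congʳ (inverseˡ x≉0) ⟩
    1# * z                   ≈⟨ *-identityˡ z ⟩
    z                        ∎

  *-cancelʳ-≉0 : ∀ {x y z} → ¬ x ≈ 0# → y * x ≈ z * x → y ≈ z
  *-cancelʳ-≉0 x≉0 yx≈zx = *-cancelˡ-≉0 x≉0 (trans (*-comm _ _) (trans yx≈zx (*-comm _ _)))

  xy≈0⇒y≈0 : ∀ {x y} → ¬ x ≈ 0# → x * y ≈ 0# → y ≈ 0#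
  xy≈0⇒y≈0 x≉0 xy≈0 = *-cancelˡ-≉0 x≉0 (trans xy≈0 (sym (zeroʳ _)))

  xy≉0 : ∀ {x y} → ¬ x ≈ 0# → ¬ y ≈ 0# → ¬ x * y ≈ 0#
  xy≉0 x≉0 y≉0 = y≉0 ∘ xy≈0⇒y≈0 x≉0

  inverse≉0 : ∀ {x} (x≉0 : ¬ x ≈ 0#) → ¬ inverse x x≉0 ≈ 0#
  inverse≉0 x≉0 x⁻¹≈0 = 1≉0 (trans (sym (inverseʳ x≉0)) (trans (*-congˡ x⁻¹≈0) (zeroʳ _)))

  x-y≈0⇒x≈y : ∀ {x y} → x - y ≈ 0# → x ≈ y
  x-y≈0⇒x≈y {x} {y} x-y≈0 = begin
    x          ≈⟨ solve 2 (λ x y → x := (x :- y) :+ y) refl x y ⟩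
    x - y + y  ≈⟨ +-congʳ x-y≈0 ⟩
    0# + y     ≈⟨ +-identityˡ y ⟩
    y          ∎

  x-y≉0 : ∀ {x y} → ¬ x ≈ y → ¬ x - y ≈ 0#
  x-y≉0 x≉y = x≉y ∘ x-y≈0⇒x≈y

  x≈z/y : ∀ {x y z} (y≉0 : ¬ y ≈ 0#) → x * y ≈ z → x ≈ z * inverse y y≉0
  x≈z/y {x} {y} {z} y≉0 xy≈z = begin
    x                       ≈⟨ *-identityʳ x ⟨
    x * 1#                  ≈⟨ *-congˡ (inverseʳ y≉0) ⟨
    x * (y * inverse y y≉0) ≈⟨ *-assoc _ _ _ ⟨
    x * y * inverse y y≉0   ≈⟨ *-congʳ xy≈z ⟩
    z * inverse y y≉0       ∎

  x/y*y≈x : ∀ {x y} (y≉0 : ¬ y ≈ 0#) → x * inverse y y≉0 * y ≈ x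
  x/y*y≈x y≉0 = trans (*-assoc _ _ _) (trans (*-congˡ (inverseˡ y≉0)) (*-identityʳ _))

  x^k≈0⇒x≈0 : ∀ {x} k → x ^ k ≈ 0# → x ≈ 0#
  x^k≈0⇒x≈0 zero    1≈0 = contradiction 1≈0 1≉0
  x^k≈0⇒x≈0 {x} (suc k) eq with x ≟ 0#
  ... | yes x≈0 = x≈0
  ... | no  x≉0 = x^k≈0⇒x≈0 k (xy≈0⇒y≈0 x≉0 eq)

  -- eval n c x is the value at x of the polynomial of degree less than n with
  -- coefficients c 0, …, c (n - 1).
  eval : ℕ → (ℕ → Carrier) → Carrier → Carrier
  eval zero    c x = 0#
  eval (suc n) c x = c 0 + x * eval n (c ∘ suc) x

  -- Synthetic division by x - r: each coefficient of the quotient is the value at r of a tail of c.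
  quotient : ℕ → (ℕ → Carrier) → Carrier → ℕ → Carrier
  quotient zero    c r i       = 0#
  quotient (suc n) c r zero    = eval (suc n) (c ∘ suc) r
  quotient (suc n) c r (suc i) = quotient n (c ∘ suc) r i

  eval-quotient : ∀ n c r x →
    eval (suc n) c x ≈ eval (suc n) c r + (x - r) * eval n (quotient n c r) x
  eval-quotient zero c r x =
    solve 3 (λ c₀ x r → c₀ :+ x :* con (ℤ.+ 0) := (c₀ :+ r :* con (ℤ.+ 0)) :+ (x :- r) :* con (ℤ.+ 0))
      refl (c 0) x r
  eval-quotient (suc n) c r x = begin
    c 0 + x * eval (suc n) (c ∘ suc) x     ≈⟨ +-congˡ (*-congˡ (eval-quotient n (c ∘ suc) r x)) ⟩
    c 0 + x * (P + (x - r) * Q)            ≈⟨ solve 5 (λ c₀ x r P Q →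
                                                c₀ :+ x :* (P :+ (x :- r) :* Q)
                                                := (c₀ :+ r :* P) :+ (x :- r) :* (P :+ x :* Q))
                                                refl (c 0) x r P Q ⟩
    c 0 + r * P + (x - r) * (P + x * Q)    ∎
    where
    P = eval (suc n) (c ∘ suc) r
    Q = eval n (quotient n (c ∘ suc) r) x

  eval≈0 : ∀ n c x → (∀ {i} → i < n → c i ≈ 0#) → eval n c x ≈ 0#
  eval≈0 zero    c x c≈0 = refl
  eval≈0 (suc n) c x c≈0 = begin
    c 0 + x * eval n (c ∘ suc) x  ≈⟨ +-cong (c≈0 ℕ.z<s) (*-congˡ (eval≈0 n (c ∘ suc) x (c≈0 ∘ ℕ.s<s))) ⟩
    0# + x * 0#                   ≈⟨ +-identityˡ _ ⟩
    x * 0#                        ≈⟨ zeroʳ x ⟩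
    0#                            ∎

  head≈0 : ∀ n c r → eval (suc n) c r ≈ 0# → (∀ {i} → i < n → c (suc i) ≈ 0#) → c 0 ≈ 0#
  head≈0 n c r root c≈0 = begin
    c 0                           ≈⟨ +-identityʳ _ ⟨
    c 0 + 0#                      ≈⟨ +-congˡ (zeroʳ r) ⟨
    c 0 + r * 0#                  ≈⟨ +-congˡ (*-congˡ (eval≈0 n (c ∘ suc) r c≈0)) ⟨
    c 0 + r * eval n (c ∘ suc) r  ≈⟨ root ⟩
    0#                            ∎

  -- The first coefficient of the quotient is the value of the tail at r, so its vanishing makes r a
  -- root of the tail and the argument recurs there.
  quotient≈0 : ∀ n c r → eval (suc n) c r ≈ 0# → (∀ {i} → i < n → quotient n c r i ≈ 0#) →
               ∀ {i} → i < suc n → c i ≈ 0#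
  quotient≈0 n c r root q≈0 {zero} _ = head≈0 n c r root (tail≈0 n c r q≈0)
    where
    tail≈0 : ∀ n c r → (∀ {i} → i < n → quotient n c r i ≈ 0#) → ∀ {i} → i < n → c (suc i) ≈ 0#
    tail≈0 (suc n) c r q≈0 = quotient≈0 n (c ∘ suc) r (q≈0 ℕ.z<s) (q≈0 ∘ ℕ.s<s)
  quotient≈0 (suc n) c r root q≈0 {suc i} (ℕ.s≤s i<n) =
    quotient≈0 n (c ∘ suc) r (q≈0 ℕ.z<s) (q≈0 ∘ ℕ.s<s) i<n

  -- Division by x - r uses up one root and one coefficient; the other roots differ from r and hence
  -- remain roots of the quotient.
  enough-roots⇒coefficients≈0 : ∀ n c {rs} → Unique setoid rs → All (λ r → eval n c r ≈ 0#) rs →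
                                n ≤ length rs → ∀ {i} → i < n → c i ≈ 0#
  enough-roots⇒coefficients≈0 zero    c _ _ _ ()
  enough-roots⇒coefficients≈0 (suc n) c {r ∷ rs} (r≉ ∷ rs!) (root ∷ roots) (ℕ.s≤s n≤) =
    quotient≈0 n c r root
      (enough-roots⇒coefficients≈0 n (quotient n c r) rs! (quotient-roots r≉ roots) n≤)
    where
    quotient-roots : ∀ {xs} → All (λ x → ¬ r ≈ x) xs → All (λ x → eval (suc n) c x ≈ 0#) xs →
                     All (λ x → eval n (quotient n c r) x ≈ 0#) xs
    quotient-roots []         []             = []
    quotient-roots {x ∷ _} (r≉x ∷ r≉) (rootₓ ∷ roots) =
      xy≈0⇒y≈0 (x-y≉0 (r≉x ∘ sym)) (begin
        (x - r) * Q                      ≈⟨ +-identityˡ _ ⟨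
        0# + (x - r) * Q                 ≈⟨ +-congʳ root ⟨
        eval (suc n) c r + (x - r) * Q   ≈⟨ eval-quotient n c r x ⟨
        eval (suc n) c x                 ≈⟨ rootₓ ⟩
        0#                               ∎) ∷ quotient-roots r≉ roots
      where Q = eval n (quotient n c r) x

  eval-+ : ∀ n c d x → eval n (λ i → c i + d i) x ≈ eval n c x + eval n d x
  eval-+ zero    c d x = sym (+-identityʳ 0#)
  eval-+ (suc n) c d x = trans (+-congˡ (*-congˡ (eval-+ n (c ∘ suc) (d ∘ suc) x)))
    (solve 5 (λ c d x C D → c :+ d :+ x :* (C :+ D) := c :+ x :* C :+ (d :+ x :* D)) refl
      (c 0) (d 0) x (eval n (c ∘ suc) x) (eval n (d ∘ suc) x))

  monomial : ℕ → Carrier → ℕ → Carrier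
  monomial zero    a zero    = a
  monomial zero    a (suc i) = 0#
  monomial (suc e) a zero    = 0#
  monomial (suc e) a (suc i) = monomial e a i

  eval-monomial : ∀ {n e} a x → e < n → eval n (monomial e a) x ≈ a * x ^ e
  eval-monomial {suc n} {zero} a x _ = begin
    a + x * eval n (λ _ → 0#) x  ≈⟨ +-congˡ (*-congˡ (eval≈0 n (λ _ → 0#) x (λ _ → refl))) ⟩
    a + x * 0#
      ≈⟨ solve 2 (λ a x → a :+ x :* con (ℤ.+ 0) := a :* con (ℤ.+ 1)) refl a x ⟩
    a * 1#                       ∎
  eval-monomial {suc n} {suc e} a x (ℕ.s≤s e<n) = begin
    0# + x * eval n (monomial e a) x  ≈⟨ +-congˡ (*-congˡ (eval-monomial a x e<n)) ⟩
    0# + x * (a * x ^ e)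
      ≈⟨ solve 3 (λ a x y → con (ℤ.+ 0) :+ x :* (a :* y) := a :* (x :* y))
                                           refl a x (x ^ e) ⟩
    a * x ^ suc e                     ∎

  monomial-diagonal : ∀ e a → monomial e a e ≡ a
  monomial-diagonal zero    a = ≡.refl
  monomial-diagonal (suc e) a = monomial-diagonal e a

  monomial-off-diagonal : ∀ {e i} a → ¬ e ≡ i → monomial e a i ≡ 0#
  monomial-off-diagonal {zero}  {zero}  a e≢i = contradiction ≡.refl e≢i
  monomial-off-diagonal {zero}  {suc i} a e≢i = ≡.refl
  monomial-off-diagonal {suc e} {zero}  a e≢i = ≡.refl
  monomial-off-diagonal {suc e} {suc i} a e≢i = monomial-off-diagonal a (e≢i ∘ ≡.cong suc)

  RootOfUnity : ℕ → Carrier → Set ℓ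
  RootOfUnity k x = x ^ k ≈ 1#

  rootOfUnity? : ∀ k x → Dec (RootOfUnity k x)
  rootOfUnity? k x = x ^ k ≟ 1#

  -- With more than k roots, the polynomial x^k - 1 would have leading coefficient 1 = 0. As 0 < k,
  -- its constant term does not interfere with that coefficient.
  roots-of-unity-bound : ∀ {k rs} → 0 < k → Unique setoid rs → All (RootOfUnity k) rs → length rs ≤ k
  roots-of-unity-bound {k} {rs} 0<k rs! roots = ℕ.≮⇒≥ λ k<rs → 1≉0 (begin
    1#        ≡⟨ monomial-diagonal k 1# ⟨
    m k       ≈⟨ +-identityʳ _ ⟨
    m k + 0#  ≡⟨ ≡.cong (m k +_) (monomial-off-diagonal (- 1#) (ℕ.<⇒≢ 0<k)) ⟨
    p k       ≈⟨ enough-roots⇒coefficients≈0 (suc k) p rs! (All.map root roots) k<rs (ℕ.n<1+n k) ⟩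
    0#        ∎)
    where
    m p : ℕ → Carrier
    m = monomial k 1#
    p i = m i + monomial 0 (- 1#) i
    root : ∀ {r} → r ^ k ≈ 1# → eval (suc k) p r ≈ 0#
    root {r} r^k≈1 = begin
      eval (suc k) p r
        ≈⟨ eval-+ (suc k) m (monomial 0 (- 1#)) r ⟩
      eval (suc k) m r + eval (suc k) (monomial 0 (- 1#)) r
        ≈⟨ +-cong (eval-monomial 1# r (ℕ.n<1+n k))
                                                                           (eval-monomial {suc k} (- 1#) r ℕ.z<s) ⟩
      1# * r ^ k + - 1# * 1#                                     ≈⟨ +-congʳ (*-congˡ r^k≈1) ⟩
      1# * 1# + - 1# * 1#
        ≈⟨ solve 0 (con (ℤ.+ 1) :* con (ℤ.+ 1) :+ (:- con (ℤ.+ 1)) :* con (ℤ.+ 1) := con (ℤ.+ 0)) refl ⟩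
      0#                                                         ∎

-- Fermat's theorem, the characteristic and additive powers.

module Frobenius {c ℓ n} (F : FiniteField c ℓ n) where
  open FiniteField F hiding (zero)
  open FieldProperties F
  open IntegerCoefficients commutativeRing
  open CommutativeExp commutativeSemiring using (_^_; ^-congˡ; ^-congʳ; ^-assocʳ)
  open GroupProperties +-group using (identityʳ-unique)
  open Inverse finite using (to; from; to-cong; strictlyInverseˡ; strictlyInverseʳ)
  open Mult semiring using (×1-homo-*; ×-assoc-*; ×-comm-*; ×-congʳ; ×-congˡ; ×-assocˡ; ×-homo-1) renaming (_×_ to _×ⁿ_)
  open SetoidReasoning setoid
  private
    module Sum = MonoidSum +-commutativeMonoid
    module Product = MonoidSum *-commutativeMonoid

  scaling : ∀ {x} → ¬ x ≈ 0# → Inverse setoid setoid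
  scaling {x} x≉0 = record
    { to        = x *_
    ; from      = inverse x x≉0 *_
    ; to-cong   = *-congˡ
    ; from-cong = *-congˡ
    ; inverse   = (λ {y} eq → trans (*-congˡ eq) (trans (sym (*-assoc _ _ _)) (
                    trans (*-congʳ (inverseʳ x≉0)) (*-identityˡ _))))
                , (λ {y} eq → trans (*-congˡ eq) (trans (sym (*-assoc _ _ _)) (
                    trans (*-congʳ (inverseˡ x≉0)) (*-identityˡ _))))
    }

  translation : Carrier → Inverse setoid setoid
  translation x = record
    { to        = _+ x
    ; from      = _- x
    ; to-cong   = +-congʳ
    ; from-cong = +-congʳ
    ; inverse   = (λ {y} eq → trans (+-congʳ eq) (solve 2 (λ x y → y :- x :+ x := y) refl x y))
                , (λ {y} eq → trans (+-congʳ eq) (solve 2 (λ x y → y :+ x :- x := y) refl x y))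
    }

  -- y ↦ y with 0 replaced by 1, so that the product over the field does not vanish.
  unit : Carrier → Carrier
  unit y with y ≟ 0#
  ... | yes _ = 1#
  ... | no  _ = y

  unit≉0 : ∀ y → ¬ unit y ≈ 0#
  unit≉0 y with y ≟ 0#
  ... | yes _   = 1≉0
  ... | no  y≉0 = y≉0

  unit-cong : ∀ {y z} → y ≈ z → unit y ≈ unit z
  unit-cong {y} {z} y≈z with y ≟ 0# | z ≟ 0#
  ... | yes _   | yes _   = refl
  ... | yes y≈0 | no  z≉0 = contradiction (trans (sym y≈z) y≈0) z≉0
  ... | no  y≉0 | yes z≈0 = contradiction (trans y≈z z≈0) y≉0
  ... | no  _   | no  _   = y≈z

  product≉0 : ∀ {m} (t : Vector Carrier m) → (∀ i → ¬ t i ≈ 0#) → ¬ Product.sum t ≈ 0#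
  product≉0 {zero}  t t≉0 = 1≉0
  product≉0 {suc m} t t≉0 = xy≉0 (t≉0 zero) (product≉0 (t ∘ suc) (t≉0 ∘ suc))

  n≢0 : ¬ n ≡ 0
  n≢0 ≡.refl with () ← to 0#

  module _ {x} (x≉0 : ¬ x ≈ 0#) where
    -- At y = 0 the value of `unit` is 1 both before and after multiplication by x, so one factor x
    -- has to be supplied there.
    correction : Carrier → Carrier
    correction y with y ≟ 0#
    ... | yes _ = x
    ... | no  _ = 1#

    x*unit : ∀ y → x * unit y ≈ unit (x * y) * correction y
    x*unit y with y ≟ 0# | x * y ≟ 0#
    ... | yes _   | yes _    = *-comm _ _
    ... | yes y≈0 | no  xy≉0 = contradiction (trans (*-congˡ y≈0) (zeroʳ x)) xy≉0
    ... | no  y≉0 | yes xy≈0 = contradiction xy≈0 (xy≉0 x≉0 y≉0)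
    ... | no  _   | no  _    = sym (*-identityʳ _)

    correction-at-0 : correction (from (to 0#)) ≈ x
    correction-at-0 with from (to 0#) ≟ 0#
    ... | yes _ = refl
    ... | no ≉0 = contradiction (strictlyInverseʳ 0#) ≉0

    correction-off-0 : ∀ i → ¬ i ≡ to 0# → correction (from i) ≈ 1#
    correction-off-0 i i≢ with from i ≟ 0#
    ... | yes ≈0 = contradiction (≡.trans (≡.sym (strictlyInverseˡ i)) (to-cong ≈0)) i≢
    ... | no  _  = refl

    -- Multiplication by x permutes the field. The product of x * `unit` y over all y is therefore
    -- x^n P on one side and P x on the other, the single x coming from y = 0, and the nonzero P
    -- cancels.
    x^n≈x′ : x ^ n ≈ x
    x^n≈x′ = *-cancelʳ-≉0 P≉0 (begin
      x ^ n * P                                          ≈⟨ *-congʳ (Product.sum-replicate n) ⟨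
      Product.sum {n} (λ _ → x) * P
        ≈⟨ Product.∑-distrib-+ {n} (λ _ → x) (unit ∘ from) ⟨
      Product.sum (λ i → x * unit (from i))              ≈⟨ Product.sum-cong-≋ (λ i → x*unit (from i)) ⟩
      Product.sum (λ i → unit (x * from i) * correction (from i))
        ≈⟨ Product.∑-distrib-+ (λ i → unit (x * from i)) (correction ∘ from) ⟩
      Product.sum (λ i → unit (x * from i)) * Product.sum (correction ∘ from)
        ≈⟨ *-cong (sum-bijection *-commutativeMonoid setoid finite (scaling x≉0) unit unit-cong)
                  (trans (sum-supported *-commutativeMonoid (correction ∘ from) (to 0#) correction-off-0) correction-at-0) ⟩
      P * x                                              ≈⟨ *-comm P x ⟩
      x * P                                              ∎)
      where
      P : Carrier
      P = Product.sum (unit ∘ from)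
      P≉0 : ¬ P ≈ 0#
      P≉0 = product≉0 (unit ∘ from) (unit≉0 ∘ from)

  x^n≈x : ∀ x → x ^ n ≈ x
  x^n≈x x with x ≟ 0#
  ... | no  x≉0 = x^n≈x′ x≉0
  ... | yes x≈0 = begin
    x ^ n                          ≈⟨ ^-congˡ n x≈0 ⟩
    0# ^ n                         ≈⟨ ^-congʳ 0# (≡.sym (ℕ.suc-pred n {{ℕ.≢-nonZero n≢0}})) ⟩
    0# * 0# ^ (ℕ.pred n)           ≈⟨ zeroˡ _ ⟩
    0#                             ≈⟨ x≈0 ⟨
    x                              ∎

  x^n^k≈x : ∀ k x → x ^ (n ℕ.^ k) ≈ x
  x^n^k≈x zero    x = *-identityʳ x
  x^n^k≈x (suc k) x = begin
    x ^ (n ℕ.* n ℕ.^ k)    ≈⟨ ^-assocʳ x n (n ℕ.^ k) ⟨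
    (x ^ n) ^ (n ℕ.^ k)    ≈⟨ x^n^k≈x k (x ^ n) ⟩
    x ^ n                  ≈⟨ x^n≈x x ⟩
    x                      ∎

  -- Translation by 1 permutes the field, so adding 1 to every summand leaves the sum of all
  -- elements unchanged.
  n×1≈0 : n ×ⁿ 1# ≈ 0#
  n×1≈0 = identityʳ-unique S (n ×ⁿ 1#) (begin
    S + n ×ⁿ 1#                        ≈⟨ +-congˡ (Sum.sum-replicate n) ⟨
    S + Sum.sum {n} (λ _ → 1#)         ≈⟨ Sum.∑-distrib-+ from (λ _ → 1#) ⟨
    Sum.sum (λ i → from i + 1#)
      ≈⟨ sum-bijection +-commutativeMonoid setoid finite (translation 1#) (λ x → x) (λ eq → eq) ⟩
    S                                  ∎)
    where
    S : Carrier
    S = Sum.sum from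

  ×1-homo-^ : ∀ p k → (p ℕ.^ k) ×ⁿ 1# ≈ (p ×ⁿ 1#) ^ k
  ×1-homo-^ p zero    = ×-homo-1 1#
  ×1-homo-^ p (suc k) = trans (×1-homo-* p (p ℕ.^ k)) (*-congˡ (×1-homo-^ p k))

  -- The k-th power of p times 1 is n times 1, which vanishes, and a field has no nonzero nilpotent
  -- elements.
  characteristic : ∀ p k → n ≡ p ℕ.^ k → p ×ⁿ 1# ≈ 0#
  characteristic p k n≡p^k = x^k≈0⇒x≈0 k
    (trans (sym (×1-homo-^ p k)) (trans (×-congˡ (≡.sym n≡p^k)) n×1≈0))

  AdditivePower : ℕ → Set _
  AdditivePower k = ∀ x y → (x + y) ^ k ≈ x ^ k + y ^ k

  additivePower-* : ∀ {j k} → AdditivePower j → AdditivePower k → AdditivePower (j ℕ.* k)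
  additivePower-* {j} {k} add-j add-k x y = begin
    (x + y) ^ (j ℕ.* k)              ≈⟨ ^-assocʳ (x + y) j k ⟨
    ((x + y) ^ j) ^ k                ≈⟨ ^-congˡ k (add-j x y) ⟩
    (x ^ j + y ^ j) ^ k              ≈⟨ add-k (x ^ j) (y ^ j) ⟩
    (x ^ j) ^ k + (y ^ j) ^ k        ≈⟨ +-cong (^-assocʳ x j k) (^-assocʳ y j k) ⟩
    x ^ (j ℕ.* k) + y ^ (j ℕ.* k)    ∎

  additivePower-^ : ∀ {j} → AdditivePower j → ∀ k → AdditivePower (j ℕ.^ k)
  additivePower-^ add-j zero    x y = trans (*-identityʳ _) (sym (+-cong (*-identityʳ x) (*-identityʳ y)))
  additivePower-^ {j} add-j (suc k) = additivePower-* {j} {j ℕ.^ k} add-j (additivePower-^ add-j k)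

  -- Every inner term of the binomial expansion carries a coefficient divisible by the prime and
  -- vanishes; only the two pure powers survive.
  additivePower-prime : ∀ {p} → Prime p → p ×ⁿ 1# ≈ 0# → AdditivePower p
  additivePower-prime {suc p} p-prime p×1≈0 x y = begin
    (x + y) ^ suc p                                          ≈⟨ theorem (suc p) x y ⟩
    term zero + Sum.sum (term ∘ suc)
      ≈⟨ +-cong first (trans (sum-supported +-commutativeMonoid (term ∘ suc) (Fin.fromℕ p) middle) last) ⟩
    y ^ suc p + x ^ suc p                                    ≈⟨ +-comm _ _ ⟩
    x ^ suc p + y ^ suc p                                    ∎
    where
    open Binomial commutativeSemiring
    term : Fin (suc (suc p)) → Carrier
    term = binomialTerm x y (suc p)

    first : term zero ≈ y ^ suc p
    first = trans (×-homo-1 _) (*-identityˡ _)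

    last : term (suc (Fin.fromℕ p)) ≈ x ^ suc p
    last rewrite Fin.toℕ-fromℕ p | nCn≡1 (suc p) | ℕ.n∸n≡0 p = trans (×-homo-1 _) (*-identityʳ _)

    middle : ∀ i → ¬ i ≡ Fin.fromℕ p → term (suc i) ≈ 0#
    middle i i≢p with prime∣pC[1+k] p-prime (ℕ.s≤s i<p)
      where
      i<p : Fin.toℕ i < p
      i<p = ℕ.≤∧≢⇒< (ℕ.≤-pred (Fin.toℕ<n i))
              (λ i≡p → i≢p (Fin.toℕ-injective (≡.trans i≡p (≡.sym (Fin.toℕ-fromℕ p)))))
    ... | ℕ.divides m eq = begin
      (suc p C suc (Fin.toℕ i)) ×ⁿ b     ≈⟨ ×-congˡ eq ⟩
      (m ℕ.* suc p) ×ⁿ b                 ≈⟨ ×-assocˡ b m (suc p) ⟨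
      m ×ⁿ (suc p ×ⁿ b)                  ≈⟨ ×-congʳ m (×-congʳ (suc p) (*-identityˡ b)) ⟨
      m ×ⁿ (suc p ×ⁿ (1# * b))           ≈⟨ ×-congʳ m (×-assoc-* (suc p) 1# b) ⟨
      m ×ⁿ ((suc p ×ⁿ 1#) * b)           ≈⟨ ×-comm-* m _ b ⟨
      (suc p ×ⁿ 1#) * (m ×ⁿ b)           ≈⟨ *-congʳ p×1≈0 ⟩
      0# * (m ×ⁿ b)                      ≈⟨ zeroˡ _ ⟩
      0#                                 ∎
      where b = binomial x y (suc p) (suc i)

-- The vector space of pairs.

module Plane {c ℓ n} (F : FiniteField c ℓ n) where
  open FiniteField F

  F² : Module commutativeRing c ℓ
  F² = DirectProduct.⟨module⟩ TensorUnit.⟨module⟩ TensorUnit.⟨module⟩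

  open Module F² public
    using (Carrierᴹ; _≈ᴹ_; _+ᴹ_; -ᴹ_; 0ᴹ; _*ₗ_; ≈ᴹ-refl; ≈ᴹ-sym; ≈ᴹ-trans; ≈ᴹ-setoid;
           +ᴹ-cong; +ᴹ-congˡ; +ᴹ-congʳ; -ᴹ‿cong; *ₗ-cong; *ₗ-congˡ; *ₗ-congʳ;
           *ₗ-assoc; *ₗ-distribˡ; *ₗ-distribʳ; *ₗ-identityˡ; *ₗ-zeroˡ; +ᴹ-identityˡ)

  module Scalar = IntegerCoefficients commutativeRing

  infixl 6 _-ᴹ_
  _-ᴹ_ : Carrierᴹ → Carrierᴹ → Carrierᴹ
  u -ᴹ v = u +ᴹ (-ᴹ v)

  -- The additive group of F² is that of the ring F × F, whose solver therefore
  -- proves the additive identities between vectors.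
  module Vector = IntegerCoefficients (ProductRing.commutativeRing commutativeRing commutativeRing)

  finite² : Inverse ≈ᴹ-setoid (≡.setoid (Fin (n ℕ.* n)))
  finite² = Composition.inverse (finite ×-inverse finite) pairing
    where
    pairing : Inverse (≡.setoid (Fin n) ×ₛ ≡.setoid (Fin n)) (≡.setoid (Fin (n ℕ.* n)))
    pairing = record
      { to        = λ (i , j) → Fin.combine i j
      ; from      = Fin.remQuot n
      ; to-cong   = λ { (≡.refl , ≡.refl) → ≡.refl }
      ; from-cong = λ { ≡.refl → ≡.refl , ≡.refl }
      ; inverse   = (λ { {x} {i , j} (≡.refl , ≡.refl) → Fin.combine-remQuot {n} n x })
                  , (λ { {i , j} ≡.refl →
                        ≡.cong proj₁ (Fin.remQuot-combine i j) , ≡.cong proj₂ (Fin.remQuot-combine i j) })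
      }

-- The components of the spread and their intersections.

module Spread {c ℓ n} (F : FiniteField c ℓ n) (f : FiniteField.Carrier F → FiniteField.Carrier F)
              (f-homo : IsRingHomomorphism (FiniteField.rawRing F) (FiniteField.rawRing F) f) where
  open FiniteField F
  open FieldProperties F
  open Plane F
  open Scalar using (solve; _:=_; con; _:*_; _:-_)
  open Vector using () renaming (solve to solveᵥ; _:=_ to _⊜_; con to κ; _:+_ to _⊕_; _:-_ to _⊖_)
  open IsRingHomomorphism f-homo
    using () renaming (⟦⟧-cong to f-cong; +-homo to f-+; *-homo to f-*; 0#-homo to f-0; -‿homo to f--; 1#-homo to f-1)

  f≉0 : ∀ {x} → ¬ x ≈ 0# → ¬ f x ≈ 0#
  f≉0 {x} x≉0 fx≈0 = 1≉0 (begin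
    1#                        ≈⟨ f-1 ⟨
    f 1#                      ≈⟨ f-cong (inverseʳ x≉0) ⟨
    f (x * inverse x x≉0)     ≈⟨ f-* _ _ ⟩
    f x * f (inverse x x≉0)   ≈⟨ *-congʳ fx≈0 ⟩
    0# * f (inverse x x≉0)    ≈⟨ zeroˡ _ ⟩
    0#                        ∎)
    where open SetoidReasoning setoid

  -- This makes the horizontal axis a component: one of the three on which additivity of a
  -- collineation rests, and the partner of `vertical` under the exchange of coordinates.
  0∉L : 0# ∉ L F f
  0∉L (x , x≉0 , 0≈fx/x) = xy≉0 (f≉0 x≉0) (inverse≉0 x≉0) (sym 0≈fx/x)

  Component : SpreadIndex F f → Carrierᴹ → Set _
  Component = spread F f

  -- A uniform parametrization of every component by the field, which lets complements be found by
  -- counting.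
  param : SpreadIndex F f → Carrier → Carrierᴹ
  param (slope m _)    k = k *ₗ (1# , m)
  param (multiple h _) k = h *ₗ (k , f k)
  param vertical       k = 0# , k

  param∈ : ∀ j k → Component j (param j k)
  param∈ (slope m _)    k = k , ≈ᴹ-refl
  param∈ (multiple h _) k = (k , f k) , (k , ≈ᴹ-refl) , ≈ᴹ-refl
  param∈ vertical       k = k , ≈ᴹ-refl

  ∈⇒param : ∀ j {v} → Component j v → ∃ λ k → v ≈ᴹ param j k
  ∈⇒param (slope m _)    (k , eq)              = k , eq
  ∈⇒param (multiple h _) (u , (x , u≈) , v≈hu) = x , ≈ᴹ-trans v≈hu (*ₗ-congˡ u≈)
  ∈⇒param vertical       (k , eq)              = k , eq

  component-resp : ∀ j {u v} → u ≈ᴹ v → Component j u → Component j v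
  component-resp (slope m _)    u≈v (k , eq)      = k , ≈ᴹ-trans (≈ᴹ-sym u≈v) eq
  component-resp (multiple h _) u≈v (w , w∈ , eq) = w , w∈ , ≈ᴹ-trans (≈ᴹ-sym u≈v) eq
  component-resp vertical       u≈v (k , eq)      = k , ≈ᴹ-trans (≈ᴹ-sym u≈v) eq

  param-- : ∀ j k l → param j (k - l) ≈ᴹ param j k -ᴹ param j l
  param-- (slope m _) k l =
      solve 2 (λ k l → (k :- l) :* con (ℤ.+ 1) := k :* con (ℤ.+ 1) :- l :* con (ℤ.+ 1)) refl k l
    , solve 3 (λ m k l → (k :- l) :* m := k :* m :- l :* m) refl m k l
  param-- (multiple h _) k l =
      solve 3 (λ h k l → h :* (k :- l) := h :* k :- h :* l) refl h k l
    , trans (*-congˡ (trans (f-+ k (- l)) (+-congˡ (f-- l))))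
            (solve 3 (λ h k l → h :* (k :- l) := h :* k :- h :* l) refl h (f k) (f l))
  param-- vertical k l = solve 0 (con (ℤ.+ 0) := con (ℤ.+ 0) :- con (ℤ.+ 0)) refl , refl

  component-- : ∀ j {u v} → Component j u → Component j v → Component j (u -ᴹ v)
  component-- j u∈ v∈ =
    let k , u≈ = ∈⇒param j u∈
        l , v≈ = ∈⇒param j v∈
    in component-resp j (≈ᴹ-trans (param-- j k l) (≈ᴹ-sym (+ᴹ-cong u≈ (-ᴹ‿cong v≈)))) (param∈ j (k - l))

  component-0 : ∀ j → Component j 0ᴹ
  component-0 j = component-resp j (solveᵥ 1 (λ v → v ⊖ v ⊜ κ (ℤ.+ 0)) ≈ᴹ-refl (param j 0#))
    (component-- j (param∈ j 0#) (param∈ j 0#))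

  component-+ : ∀ j {u v} → Component j u → Component j v → Component j (u +ᴹ v)
  component-+ j {u} {v} u∈ v∈ = component-resp j
    (solveᵥ 2 (λ u v → u ⊖ (κ (ℤ.+ 0) ⊖ v) ⊜ u ⊕ v) ≈ᴹ-refl u v)
    (component-- j u∈ (component-- j (component-0 j) v∈))

  param-injective : ∀ j {k} → param j k ≈ᴹ 0ᴹ → k ≈ 0#
  param-injective (slope m _)      (eq , _) = trans (sym (*-identityʳ _)) eq
  param-injective (multiple h h≉0) (eq , _) = xy≈0⇒y≈0 h≉0 eq
  param-injective vertical         (_ , eq) = eq

  Same : SpreadIndex F f → SpreadIndex F f → Set _
  Same i j = ∀ {v} → Component i v → Component j v

  Disjoint : SpreadIndex F f → SpreadIndex F f → Set _
  Disjoint i j = ∀ {v} → Component i v → Component j v → v ≈ᴹ 0ᴹ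

  param-0 : ∀ j {k} → k ≈ 0# → param j k ≈ᴹ 0ᴹ
  param-0 (slope m _)    k≈0 = trans (*-congʳ k≈0) (zeroˡ _) , trans (*-congʳ k≈0) (zeroˡ _)
  param-0 (multiple h _) k≈0 = trans (*-congˡ k≈0) (zeroʳ _) , trans (*-congˡ (trans (f-cong k≈0) f-0)) (zeroʳ _)
  param-0 vertical       k≈0 = refl , k≈0

  disjoint : ∀ i j → (∀ k l → param i k ≈ᴹ param j l → k ≈ 0#) → Disjoint i j
  disjoint i j h {v} v∈i v∈j =
    let k , v≈i = ∈⇒param i v∈i
        l , v≈j = ∈⇒param j v∈j
    in ≈ᴹ-trans v≈i (param-0 i (h k l (≈ᴹ-trans (≈ᴹ-sym v≈i) v≈j)))

  disjoint-sym : ∀ {i j} → Disjoint i j → Disjoint j i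
  disjoint-sym i#j v∈j v∈i = i#j v∈i v∈j

  slope#slope : ∀ {m m′} (m∉ : m ∉ L F f) (m′∉ : m′ ∉ L F f) → ¬ m ≈ m′ → Disjoint (slope m m∉) (slope m′ m′∉)
  slope#slope {m} {m′} m∉ m′∉ m≉m′ = disjoint (slope m m∉) (slope m′ m′∉) λ k l (k≈l , km≈lm′) →
    xy≈0⇒y≈0 (x-y≉0 m≉m′) (begin
      (m - m′) * k
        ≈⟨ solve 3 (λ m m′ k → (m :- m′) :* k := k :* m :- k :* con (ℤ.+ 1) :* m′) refl m m′ k ⟩
      k * m - k * 1# * m′  ≈⟨ +-cong km≈lm′ (-‿cong (*-congʳ k≈l)) ⟩
      l * m′ - l * 1# * m′
        ≈⟨ solve 2 (λ m′ l → l :* m′ :- l :* con (ℤ.+ 1) :* m′ := con (ℤ.+ 0)) refl m′ l ⟩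
      0#                   ∎)
    where open SetoidReasoning setoid

  slope#vertical : ∀ {m} (m∉ : m ∉ L F f) → Disjoint (slope m m∉) vertical
  slope#vertical m∉ = disjoint (slope _ m∉) vertical λ k l (k≈0 , _) → trans (sym (*-identityʳ k)) k≈0

  multiple#vertical : ∀ {h} (h≉0 : ¬ h ≈ 0#) → Disjoint (multiple h h≉0) vertical
  multiple#vertical h≉0 = disjoint (multiple _ h≉0) vertical λ k l (hk≈0 , _) → xy≈0⇒y≈0 h≉0 hk≈0

  -- A common nonzero vector h (l , f l) would exhibit m as f l / l, an element of `L`.
  slope#multiple : ∀ {m h} (m∉ : m ∉ L F f) (h≉0 : ¬ h ≈ 0#) → Disjoint (slope m m∉) (multiple h h≉0)
  slope#multiple {m} {h} m∉ h≉0 = disjoint (slope m m∉) (multiple h h≉0) λ k l (k≈hl , km≈hfl) → k≈0 k l k≈hl km≈hfl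
    where
    open SetoidReasoning setoid
    k≈0 : ∀ k l → k * 1# ≈ h * l → k * m ≈ h * f l → k ≈ 0#
    k≈0 k l k≈hl km≈hfl with l ≟ 0#
    ... | yes l≈0 = trans (sym (*-identityʳ k)) (trans k≈hl (trans (*-congˡ l≈0) (zeroʳ h)))
    ... | no  l≉0 = contradiction (l , l≉0 , x≈z/y l≉0 (*-cancelˡ-≉0 h≉0 (begin
      h * (m * l)    ≈⟨ solve 3 (λ h m l → h :* (m :* l) := h :* l :* m) refl h m l ⟩
      h * l * m      ≈⟨ *-congʳ k≈hl ⟨
      k * 1# * m     ≈⟨ *-congʳ (*-identityʳ k) ⟩
      k * m          ≈⟨ km≈hfl ⟩
      h * f l        ∎))) m∉

  -- hU = h′U exactly when f fixes h / h′, which is division-free in this form.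
  multiple-same : ∀ {h h′} (h≉0 : ¬ h ≈ 0#) (h′≉0 : ¬ h′ ≈ 0#) → f h * h′ ≈ f h′ * h →
                  Same (multiple h h≉0) (multiple h′ h′≉0)
  multiple-same {h} {h′} h≉0 h′≉0 eq v∈ =
    let k , v≈ = ∈⇒param (multiple h h≉0) v∈
    in component-resp (multiple h′ h′≉0) (≈ᴹ-sym (≈ᴹ-trans v≈ (shift k))) (param∈ (multiple h′ h′≉0) (r * k))
    where
    open SetoidReasoning setoid
    r = h * inverse h′ h′≉0
    h≈h′r : h ≈ h′ * r
    h≈h′r = trans (sym (x/y*y≈x h′≉0)) (*-comm _ _)
    r≈fr : r ≈ f r
    r≈fr = *-cancelˡ-≉0 (xy≉0 (f≉0 h′≉0) h′≉0) (begin
      f h′ * h′ * r       ≈⟨ *-assoc _ _ _ ⟩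
      f h′ * (h′ * r)     ≈⟨ *-congˡ h≈h′r ⟨
      f h′ * h            ≈⟨ eq ⟨
      f h * h′            ≈⟨ *-congʳ (trans (f-cong h≈h′r) (f-* h′ r)) ⟩
      f h′ * f r * h′     ≈⟨ solve 3 (λ a b c → a :* b :* c := a :* c :* b) refl (f h′) (f r) h′ ⟩
      f h′ * h′ * f r     ∎)
    shift : ∀ k → param (multiple h h≉0) k ≈ᴹ param (multiple h′ h′≉0) (r * k)
    shift k = trans (*-congʳ h≈h′r) (*-assoc _ _ _)
            , (begin
      h * f k             ≈⟨ *-congʳ h≈h′r ⟩
      h′ * r * f k        ≈⟨ *-congʳ (*-congˡ r≈fr) ⟩
      h′ * f r * f k      ≈⟨ *-assoc _ _ _ ⟩
      h′ * (f r * f k)    ≈⟨ *-congˡ (f-* r k) ⟨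
      h′ * f (r * k)      ∎)

  -- Applying f to the equation of first coordinates and comparing with the second coordinates
  -- yields the excluded equation multiplied by f k, which can be cancelled when k is nonzero.
  multiple#multiple : ∀ {h h′} (h≉0 : ¬ h ≈ 0#) (h′≉0 : ¬ h′ ≈ 0#) → ¬ f h * h′ ≈ f h′ * h →
                      Disjoint (multiple h h≉0) (multiple h′ h′≉0)
  multiple#multiple {h} {h′} h≉0 h′≉0 neq =
    disjoint (multiple h h≉0) (multiple h′ h′≉0) λ k l (hk≈h′l , hfk≈h′fl) → k≈0 k l hk≈h′l hfk≈h′fl
    where
    open SetoidReasoning setoid
    k≈0 : ∀ k l → h * k ≈ h′ * l → h * f k ≈ h′ * f l → k ≈ 0#
    k≈0 k l eq₁ eq₂ with k ≟ 0#
    ... | yes k≈0 = k≈0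
    ... | no  k≉0 = contradiction (*-cancelˡ-≉0 (f≉0 k≉0) (begin
      f k * (f h * h′)     ≈⟨ solve 3 (λ a b c → a :* (b :* c) := b :* a :* c) refl (f k) (f h) h′ ⟩
      f h * f k * h′       ≈⟨ *-congʳ (f-* h k) ⟨
      f (h * k) * h′       ≈⟨ *-congʳ (f-cong eq₁) ⟩
      f (h′ * l) * h′      ≈⟨ *-congʳ (f-* h′ l) ⟩
      f h′ * f l * h′      ≈⟨ solve 3 (λ a b c → a :* b :* c := a :* (c :* b)) refl (f h′) (f l) h′ ⟩
      f h′ * (h′ * f l)    ≈⟨ *-congˡ eq₂ ⟨
      f h′ * (h * f k)     ≈⟨ solve 3 (λ a b c → a :* (b :* c) := c :* (a :* b)) refl (f h′) h (f k) ⟩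
      f k * (f h′ * h)     ∎)) neq

  -- The dichotomy is stated for subspaces because different indices may name the same component, as
  -- with proportional multiples.
  same-or-disjoint : ∀ i j → (Same i j × Same j i) ⊎ Disjoint i j
  same-or-disjoint (slope m m∉) (slope m′ m′∉) with m ≟ m′
  ... | yes m≈m′ = inj₁ ((λ (k , eq) → k , ≈ᴹ-trans eq (refl , *-congˡ m≈m′)) ,
                         (λ (k , eq) → k , ≈ᴹ-trans eq (refl , *-congˡ (sym m≈m′))))
  ... | no  m≉m′ = inj₂ (slope#slope m∉ m′∉ m≉m′)
  same-or-disjoint (slope m m∉) (multiple h h≉0) = inj₂ (slope#multiple m∉ h≉0)
  same-or-disjoint (slope m m∉) vertical = inj₂ (slope#vertical m∉)
  same-or-disjoint (multiple h h≉0) (slope m m∉) =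
    inj₂ (disjoint-sym {slope m m∉} {multiple h h≉0} (slope#multiple m∉ h≉0))
  same-or-disjoint (multiple h h≉0) (multiple h′ h′≉0) with f h * h′ ≟ f h′ * h
  ... | yes eq = inj₁ (multiple-same h≉0 h′≉0 eq , multiple-same h′≉0 h≉0 (sym eq))
  ... | no neq = inj₂ (multiple#multiple h≉0 h′≉0 neq)
  same-or-disjoint (multiple h h≉0) vertical = inj₂ (multiple#vertical h≉0)
  same-or-disjoint vertical (slope m m∉) = inj₂ (disjoint-sym {slope m m∉} {vertical} (slope#vertical m∉))
  same-or-disjoint vertical (multiple h h≉0) =
    inj₂ (disjoint-sym {multiple h h≉0} {vertical} (multiple#vertical h≉0))
  same-or-disjoint vertical vertical = inj₁ ((λ v∈ → v∈) , (λ v∈ → v∈))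

  abstract
    -- Both components have as many vectors as the field has elements, so subtracting their
    -- parametrizations is a self-map of the finite plane; trivial intersection makes it injective,
    -- hence surjective.
    disjoint⇒complementary : ∀ i j → Disjoint i j → ∀ w → ∃ λ v → Component i v × Component j (v -ᴹ w)
    disjoint⇒complementary i j i#j w =
      let (k , l) , eq = injective⇒surjective² difference difference-injective w
      in param i k , param∈ i k , component-resp j
           (≈ᴹ-trans (solveᵥ 2 (λ u v → v ⊜ u ⊖ (u ⊖ v)) ≈ᴹ-refl (param i k) (param j l))
                     (+ᴹ-congˡ (-ᴹ‿cong eq)))
           (param∈ j l)
      where
      open FiniteSetoid ≈ᴹ-setoid finite² using () renaming (injective⇒surjective to injective⇒surjective²)
      difference : Carrierᴹ → Carrierᴹ
      difference (k , l) = param i k -ᴹ param j l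
      difference-injective : ∀ {x y} → difference x ≈ᴹ difference y → x ≈ᴹ y
      difference-injective {k , l} {k′ , l′} eq =
          x-y≈0⇒x≈y (param-injective i common≈0)
        , x-y≈0⇒x≈y (param-injective j (≈ᴹ-trans (≈ᴹ-sym common) common≈0))
        where
        open SetoidReasoning ≈ᴹ-setoid
        common : param i (k - k′) ≈ᴹ param j (l - l′)
        common = begin
          param i (k - k′)                                ≈⟨ param-- i k k′ ⟩
          param i k -ᴹ param i k′
            ≈⟨ solveᵥ 3 (λ a b c → a ⊖ b ⊜ (a ⊖ c) ⊕ (c ⊖ b))
                 ≈ᴹ-refl (param i k) (param i k′) (param j l) ⟩
          difference (k , l) +ᴹ (param j l -ᴹ param i k′)   ≈⟨ +ᴹ-congʳ eq ⟩
          difference (k′ , l′) +ᴹ (param j l -ᴹ param i k′)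
            ≈⟨ solveᵥ 3 (λ a b c → (a ⊖ b) ⊕ (c ⊖ a) ⊜ c ⊖ b)
                 ≈ᴹ-refl (param i k′) (param j l′) (param j l) ⟩
          param j l -ᴹ param j l′                         ≈⟨ param-- j l l′ ⟨
          param j (l - l′)                                ∎
        common≈0 : param i (k - k′) ≈ᴹ 0ᴹ
        common≈0 = i#j (param∈ i (k - k′)) (component-resp j (≈ᴹ-sym common) (param∈ j (l - l′)))

-- Isomorphisms of the planes are additive up to a translation.

record AdditiveCollineation {c ℓ n} (F : FiniteField c ℓ n)
                            (f g : FiniteField.Carrier F → FiniteField.Carrier F) : Set (c ⊔ ℓ) where
  open Plane F
  field
    ψ            : Carrierᴹ → Carrierᴹ
    ψ-cong       : ∀ {u v} → u ≈ᴹ v → ψ u ≈ᴹ ψ v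
    ψ-+          : ∀ u v → ψ (u +ᴹ v) ≈ᴹ ψ u +ᴹ ψ v
    ψ-0          : ψ 0ᴹ ≈ᴹ 0ᴹ
    ψ-injective  : ∀ {u v} → ψ u ≈ᴹ ψ v → u ≈ᴹ v
    ψ-surjective : ∀ w → ∃ λ v → ψ v ≈ᴹ w
    image        : SpreadIndex F f → SpreadIndex F g
    image-⇔      : ∀ j v → spread F f j v ⇔ spread F g (image j) (ψ v)

module Collineation {c ℓ n} (F : FiniteField c ℓ n)
  (f g : FiniteField.Carrier F → FiniteField.Carrier F)
  (f-homo : IsRingHomomorphism (FiniteField.rawRing F) (FiniteField.rawRing F) f)
  (g-homo : IsRingHomomorphism (FiniteField.rawRing F) (FiniteField.rawRing F) g)
  (φ : Inverse (Module.≈ᴹ-setoid (Plane.F² F)) (Module.≈ᴹ-setoid (Plane.F² F)))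
  (φ-lines : MapsLinesToLines (𝒜 F f) (𝒜 F g) (Inverse.to φ))
  where
  open FiniteField F
  open FieldProperties F
  open Plane F
  open Inverse φ using (to; from; to-cong; from-cong; strictlyInverseˡ; strictlyInverseʳ)
  open Vector using (solve; _:=_; con; _:+_; _:-_; :-_)
  private
    module S = Spread F f f-homo
    module T = Spread F g g-homo

  ψ : Carrierᴹ → Carrierᴹ
  ψ v = to v -ᴹ to 0ᴹ

  ψ-cong : ∀ {u v} → u ≈ᴹ v → ψ u ≈ᴹ ψ v
  ψ-cong u≈v = +ᴹ-congʳ (to-cong u≈v)

  ψ-0 : ψ 0ᴹ ≈ᴹ 0ᴹ
  ψ-0 = solve 1 (λ v → v :- v := con (ℤ.+ 0)) ≈ᴹ-refl (to 0ᴹ)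

  ψ-injective : ∀ {u v} → ψ u ≈ᴹ ψ v → u ≈ᴹ v
  ψ-injective {u} {v} eq = ≈ᴹ-trans (≈ᴹ-sym (strictlyInverseʳ u)) (≈ᴹ-trans (from-cong (begin
    to u             ≈⟨ solve 2 (λ a b → a := (a :- b) :+ b) ≈ᴹ-refl (to u) (to 0ᴹ) ⟩
    ψ u +ᴹ to 0ᴹ     ≈⟨ +ᴹ-congʳ eq ⟩
    ψ v +ᴹ to 0ᴹ     ≈⟨ solve 2 (λ a b → (a :- b) :+ b := a) ≈ᴹ-refl (to v) (to 0ᴹ) ⟩
    to v             ∎)) (strictlyInverseʳ v))
    where open SetoidReasoning ≈ᴹ-setoid

  ψ-surjective : ∀ w → ∃ λ v → ψ v ≈ᴹ w
  ψ-surjective w = from (w +ᴹ to 0ᴹ) ,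
    ≈ᴹ-trans (+ᴹ-congʳ (strictlyInverseˡ (w +ᴹ to 0ᴹ)))
      (solve 2 (λ a b → (a :+ b) :- b := a) ≈ᴹ-refl w (to 0ᴹ))

  on⇒∈ : ∀ {h} (h-homo : IsRingHomomorphism rawRing rawRing h) {j w p} →
         IncidenceStructure._On_ (𝒜 F h) p (j , w) → spread F h j (p -ᴹ w)
  on⇒∈ h-homo {j} {w} {p} (v , v∈ , p≈v+w) = H.component-resp j
    (≈ᴹ-trans (solve 2 (λ v w → v := (v :+ w) :- w) ≈ᴹ-refl v w) (+ᴹ-congʳ (≈ᴹ-sym p≈v+w))) v∈
    where module H = Spread F _ h-homo

  ∈⇒on : ∀ {h} {j : SpreadIndex F h} {w p} → spread F h j (p -ᴹ w) →
         IncidenceStructure._On_ (𝒜 F h) p (j , w)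
  ∈⇒on {w = w} {p} p-w∈ = p -ᴹ w , p-w∈ , solve 2 (λ p w → p := (p :- w) :+ w) ≈ᴹ-refl p w

  -- The direction of the line onto which the line j + w is mapped. A priori it depends on w;
  -- `parallel` removes this dependence.
  image : SpreadIndex F f → Carrierᴹ → SpreadIndex F g
  image j w = proj₁ (proj₁ (φ-lines (j , w)))

  -- The image of w lies on the image line and can serve as its base point, so the unknown base
  -- point w′ and the translation by the image of the origin both drop out.
  image-⇔ : ∀ j w p → S.Component j (p -ᴹ w) ⇔ T.Component (image j w) (ψ p -ᴹ ψ w)
  image-⇔ j w p = mk⇔ forward backward
    where
    open module Line p = Equivalence (proj₂ (φ-lines (j , w)) p) using () renaming (to to line⁺; from to line⁻)
    j′ = image j w
    w′ = proj₂ (proj₁ (φ-lines (j , w)))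
    base : T.Component j′ (to w -ᴹ w′)
    base = on⇒∈ g-homo {j′} {w′} (line⁺ w (∈⇒on {f} {j} (S.component-resp j
      (solve 1 (λ w → con (ℤ.+ 0) := w :- w) ≈ᴹ-refl w) (S.component-0 j))))
    forward : S.Component j (p -ᴹ w) → T.Component j′ (ψ p -ᴹ ψ w)
    forward p-w∈ = T.component-resp j′
      (solve 4 (λ a b c d → (a :- b) :- (c :- b) := (a :- d) :- (c :- d))
           ≈ᴹ-refl (to p) w′ (to w) (to 0ᴹ))
      (T.component-- j′ (on⇒∈ g-homo {j′} {w′} (line⁺ p (∈⇒on {f} {j} p-w∈))) base)
    backward : T.Component j′ (ψ p -ᴹ ψ w) → S.Component j (p -ᴹ w)
    backward ψ∈ = on⇒∈ f-homo {j} {w} (line⁻ p (∈⇒on {g} {j′} (T.component-resp j′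
      (solve 4 (λ a b c d → ((a :- d) :- (c :- d)) :+ (c :- b) := a :- b)
           ≈ᴹ-refl (to p) w′ (to w) (to 0ᴹ))
      (T.component-+ j′ ψ∈ base))))

  image₀ : SpreadIndex F f → SpreadIndex F g
  image₀ j = image j 0ᴹ

  v-0 : ∀ v → v -ᴹ 0ᴹ ≈ᴹ v
  v-0 = solve 1 (λ v → v :- con (ℤ.+ 0) := v) ≈ᴹ-refl

  ψv-ψ0 : ∀ v → ψ v -ᴹ ψ 0ᴹ ≈ᴹ ψ v
  ψv-ψ0 v = ≈ᴹ-trans (+ᴹ-congˡ (-ᴹ‿cong ψ-0)) (v-0 (ψ v))

  image₀-⇔ : ∀ j v → S.Component j v ⇔ T.Component (image₀ j) (ψ v)
  image₀-⇔ j v = mk⇔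
    (T.component-resp (image₀ j) (ψv-ψ0 v) ∘ Equivalence.to (image-⇔ j 0ᴹ v) ∘ S.component-resp j (≈ᴹ-sym (v-0 v)))
    (S.component-resp j (v-0 v) ∘ Equivalence.from (image-⇔ j 0ᴹ v) ∘ T.component-resp (image₀ j) (≈ᴹ-sym (ψv-ψ0 v)))

  -- Parallel lines have parallel images: otherwise the images would meet, and
  -- then so would the lines.
  parallel : ∀ j w p → S.Component j (p -ᴹ w) → T.Component (image₀ j) (ψ p -ᴹ ψ w)
  parallel j w p p-w∈ with T.same-or-disjoint (image j w) (image₀ j)
  ... | inj₁ (same , _) = same (Equivalence.to (image-⇔ j w p) p-w∈)
  ... | inj₂ #j = T.component-- (image₀ j)
      (Equivalence.to (image₀-⇔ j p) (S.component-resp j (solve 2 (λ p w → (p :- w) :+ w := p)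
           ≈ᴹ-refl p w)
        (S.component-+ j p-w∈ w∈)))
      (Equivalence.to (image₀-⇔ j w) w∈)
    where
    w∈ : S.Component j w
    w∈ with v , v∈₀ , v-ψw∈ ← T.disjoint⇒complementary (image₀ j) (image j w)
                              (T.disjoint-sym {image j w} {image₀ j} #j) (ψ w)
      with z , ψz≈v ← ψ-surjective v =
      S.component-resp j (solve 2 (λ z w → z :- (z :- w) := w) ≈ᴹ-refl z w) (S.component-- j
        (Equivalence.from (image₀-⇔ j z) (T.component-resp (image₀ j) (≈ᴹ-sym ψz≈v) v∈₀))
        (Equivalence.from (image-⇔ j w z) (T.component-resp (image j w) (+ᴹ-congʳ (≈ᴹ-sym ψz≈v)) v-ψw∈)))

  -- A parallelogram argument. The line from v to u + v is parallel to i and the line from u to u +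
  -- v is parallel to j, so the defect of additivity lies in the images of both components; its
  -- preimage lies in i and j and is therefore zero.
  ψ-+-disjoint : ∀ i j → S.Disjoint i j → ∀ {u v} → S.Component i u → S.Component j v →
                 ψ (u +ᴹ v) ≈ᴹ ψ u +ᴹ ψ v
  ψ-+-disjoint i j i#j {u} {v} u∈i v∈j = begin
    ψ (u +ᴹ v)
      ≈⟨ solve 3 (λ a b c → a := ((a :- b) :- c) :+ (b :+ c)) ≈ᴹ-refl (ψ (u +ᴹ v)) (ψ u) (ψ v) ⟩
    defect +ᴹ (ψ u +ᴹ ψ v)    ≈⟨ +ᴹ-congʳ defect≈0 ⟩
    0ᴹ +ᴹ (ψ u +ᴹ ψ v)        ≈⟨ +ᴹ-identityˡ _ ⟩
    ψ u +ᴹ ψ v                ∎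
    where
    open SetoidReasoning ≈ᴹ-setoid
    defect = ψ (u +ᴹ v) -ᴹ ψ u -ᴹ ψ v
    defect∈i : T.Component (image₀ i) defect
    defect∈i = T.component-resp (image₀ i)
      (solve 3 (λ a b c → (a :- c) :- b := (a :- b) :- c) ≈ᴹ-refl (ψ (u +ᴹ v)) (ψ u) (ψ v))
      (T.component-- (image₀ i)
        (parallel i v (u +ᴹ v) (S.component-resp i (solve 2 (λ u v → u := (u :+ v) :- v)
             ≈ᴹ-refl u v) u∈i))
        (Equivalence.to (image₀-⇔ i u) u∈i))
    defect∈j : T.Component (image₀ j) defect
    defect∈j = T.component-- (image₀ j)
        (parallel j u (u +ᴹ v) (S.component-resp j (solve 2 (λ u v → v := (u :+ v) :- u)
             ≈ᴹ-refl u v) v∈j))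
        (Equivalence.to (image₀-⇔ j v) v∈j)
    defect≈0 : defect ≈ᴹ 0ᴹ
    defect≈0 =
      let e , ψe≈ = ψ-surjective defect
          e∈i = Equivalence.from (image₀-⇔ i e) (T.component-resp (image₀ i) (≈ᴹ-sym ψe≈) defect∈i)
          e∈j = Equivalence.from (image₀-⇔ j e) (T.component-resp (image₀ j) (≈ᴹ-sym ψe≈) defect∈j)
      in ≈ᴹ-trans (≈ᴹ-sym ψe≈) (≈ᴹ-trans (ψ-cong (i#j e∈i e∈j)) ψ-0)

  -- Two vectors of i are separated by adding a vector of j that moves one of
  -- them into k.
  ψ-+-component : ∀ i j k → S.Disjoint i j → S.Disjoint i k → ∀ {u v w} →
                  S.Component i u → S.Component i v → S.Component j w → S.Component k (v +ᴹ w) →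
                  ψ (u +ᴹ v) ≈ᴹ ψ u +ᴹ ψ v
  ψ-+-component i j k i#j i#k {u} {v} {w} u∈ v∈ w∈ v+w∈ = begin
    ψ (u +ᴹ v)                     ≈⟨ solve 2 (λ a b → a := (a :+ b) :- b) ≈ᴹ-refl (ψ (u +ᴹ v)) (ψ w) ⟩
    (ψ (u +ᴹ v) +ᴹ ψ w) -ᴹ ψ w     ≈⟨ +ᴹ-congʳ (ψ-+-disjoint i j i#j (S.component-+ i u∈ v∈) w∈) ⟨
    ψ (u +ᴹ v +ᴹ w) -ᴹ ψ w
      ≈⟨ +ᴹ-congʳ (ψ-cong (solve 3 (λ u v w → u :+ v :+ w := u :+ (v :+ w)) ≈ᴹ-refl u v w)) ⟩
    ψ (u +ᴹ (v +ᴹ w)) -ᴹ ψ w       ≈⟨ +ᴹ-congʳ (ψ-+-disjoint i k i#k u∈ v+w∈) ⟩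
    ψ u +ᴹ ψ (v +ᴹ w) -ᴹ ψ w       ≈⟨ +ᴹ-congʳ (+ᴹ-congˡ (ψ-+-disjoint i j i#j v∈ w∈)) ⟩
    ψ u +ᴹ (ψ v +ᴹ ψ w) -ᴹ ψ w
      ≈⟨ solve 3 (λ a b c → (a :+ (b :+ c)) :- c := a :+ b) ≈ᴹ-refl (ψ u) (ψ v) (ψ w) ⟩
    ψ u +ᴹ ψ v                     ∎
    where open SetoidReasoning ≈ᴹ-setoid

  module _ {m} (m∉L : m ∉ L F f) (m≉0 : ¬ m ≈ 0#) where
    private
      horizontal diagonal : SpreadIndex F f
      horizontal = slope 0# S.0∉L
      diagonal = slope m m∉L

      horizontal∋ : ∀ x → S.Component horizontal (x , 0#)
      horizontal∋ x = x , sym (*-identityʳ x) , sym (zeroʳ x)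

      vertical∋ : ∀ y → S.Component vertical (0# , y)
      vertical∋ y = y , ≈ᴹ-refl

      0≉m : ¬ 0# ≈ m
      0≉m 0≈m = m≉0 (sym 0≈m)

      split : ∀ v → ψ v ≈ᴹ ψ (proj₁ v , 0#) +ᴹ ψ (0# , proj₂ v)
      split (x , y) = ≈ᴹ-trans (ψ-cong (sym (+-identityʳ x) , sym (+-identityˡ y)))
        (ψ-+-disjoint horizontal vertical (S.slope#vertical S.0∉L) (horizontal∋ x) (vertical∋ y))

      horizontal-+ : ∀ x x′ → ψ (x + x′ , 0#) ≈ᴹ ψ (x , 0#) +ᴹ ψ (x′ , 0#)
      horizontal-+ x x′ = ≈ᴹ-trans (ψ-cong (refl , sym (+-identityʳ 0#)))
        (ψ-+-component horizontal vertical diagonal (S.slope#vertical S.0∉L) (S.slope#slope S.0∉L m∉L 0≉m)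
          (horizontal∋ x) (horizontal∋ x′) (vertical∋ (x′ * m))
          (x′ , trans (+-identityʳ x′) (sym (*-identityʳ x′)) , +-identityˡ _))

      vertical-+ : ∀ y y′ → ψ (0# , y + y′) ≈ᴹ ψ (0# , y) +ᴹ ψ (0# , y′)
      vertical-+ y y′ = ≈ᴹ-trans (ψ-cong (sym (+-identityʳ 0#) , refl))
        (ψ-+-component vertical horizontal diagonal
          (S.disjoint-sym {horizontal} {vertical} (S.slope#vertical S.0∉L))
          (S.disjoint-sym {diagonal} {vertical} (S.slope#vertical m∉L))
          (vertical∋ y) (vertical∋ y′) (horizontal∋ z)
          (z , trans (+-identityˡ z) (sym (*-identityʳ z)) , trans (+-identityʳ y′) (sym (x/y*y≈x m≉0))))
        where z = y′ * inverse m m≉0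

    -- Splitting along the axes reduces the claim to two vectors on one axis. There the other axis
    -- and the component of slope m are the two auxiliary components; m must be nonzero for this
    -- third component to differ from the horizontal axis.
    ψ-+ : ∀ u v → ψ (u +ᴹ v) ≈ᴹ ψ u +ᴹ ψ v
    ψ-+ u@(x , y) v@(x′ , y′) = begin
      ψ (u +ᴹ v)                                  ≈⟨ split (u +ᴹ v) ⟩
      ψ (x + x′ , 0#) +ᴹ ψ (0# , y + y′)          ≈⟨ +ᴹ-cong (horizontal-+ x x′) (vertical-+ y y′) ⟩
      (ψ (x , 0#) +ᴹ ψ (x′ , 0#)) +ᴹ (ψ (0# , y) +ᴹ ψ (0# , y′))
        ≈⟨ solve 4 (λ a b c d → (a :+ b) :+ (c :+ d) := (a :+ c) :+ (b :+ d)) ≈ᴹ-refl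
             (ψ (x , 0#)) (ψ (x′ , 0#)) (ψ (0# , y)) (ψ (0# , y′)) ⟩
      (ψ (x , 0#) +ᴹ ψ (0# , y)) +ᴹ (ψ (x′ , 0#) +ᴹ ψ (0# , y′))   ≈⟨ +ᴹ-cong (split u) (split v) ⟨
      ψ u +ᴹ ψ v                                  ∎
      where open SetoidReasoning ≈ᴹ-setoid

    additiveCollineation : AdditiveCollineation F f g
    additiveCollineation = record
      { ψ            = ψ
      ; ψ-cong       = ψ-cong
      ; ψ-+          = ψ-+
      ; ψ-0          = ψ-0
      ; ψ-injective  = ψ-injective
      ; ψ-surjective = ψ-surjective
      ; image        = image₀
      ; image-⇔      = image₀-⇔
      }

-- Semilinearity from preserved rays.

module Semilinear {c ℓ n} {F : FiniteField c ℓ n} {f g : FiniteField.Carrier F → FiniteField.Carrier F}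
                  (Ψ : AdditiveCollineation F f g) where
  open FiniteField F
  open Plane F
  open AdditiveCollineation Ψ
  open FieldProperties F
  open Vector using (solve; _:=_; con; _:+_; _:*_; _:-_)
  open Scalar using ()
    renaming (solve to solveₛ; _:=_ to _⊜_; con to κ; _:+_ to _⊕_; _:*_ to _⊗_; _:-_ to _⊖_; :-_ to ⊝_)

  -- Multiplication by a scalar k is multiplication by ⟪ k ⟫ in the ring F × F.
  ⟪_⟫ : Carrier → Carrierᴹ
  ⟪ k ⟫ = k , k

  *ₗ-combination : ∀ k x y u v → k *ₗ (x *ₗ u +ᴹ y *ₗ v) ≈ᴹ (k * x) *ₗ u +ᴹ (k * y) *ₗ v
  *ₗ-combination k x y u v = ≈ᴹ-trans (*ₗ-distribˡ k (x *ₗ u) (y *ₗ v))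
    (≈ᴹ-sym (+ᴹ-cong (*ₗ-assoc k x u) (*ₗ-assoc k y v)))

  *ₗ-cancel : ∀ {k v} → ¬ v ≈ᴹ 0ᴹ → k *ₗ v ≈ᴹ 0ᴹ → k ≈ 0#
  *ₗ-cancel {k} v≉0 (kx≈0 , ky≈0) with k ≟ 0#
  ... | yes k≈0 = k≈0
  ... | no  k≉0 = contradiction (xy≈0⇒y≈0 k≉0 kx≈0 , xy≈0⇒y≈0 k≉0 ky≈0) v≉0

  independent⇒injective : ∀ u v → (∀ x y → x *ₗ u +ᴹ y *ₗ v ≈ᴹ 0ᴹ → x ≈ 0# × y ≈ 0#) →
    ∀ {x y x′ y′} → x *ₗ u +ᴹ y *ₗ v ≈ᴹ x′ *ₗ u +ᴹ y′ *ₗ v → x ≈ x′ × y ≈ y′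
  independent⇒injective u v independent {x} {y} {x′} {y′} eq =
    let x-x′≈0 , y-y′≈0 = independent (x - x′) (y - y′) (begin
          (x - x′) *ₗ u +ᴹ (y - y′) *ₗ v
            ≈⟨ solve 6 (λ x x′ y y′ u v → (x :- x′) :* u :+ (y :- y′) :* v := (x :* u :+ y :* v) :- (x′ :* u :+ y′ :* v))
                 ≈ᴹ-refl ⟪ x ⟫ ⟪ x′ ⟫ ⟪ y ⟫ ⟪ y′ ⟫ u v ⟩
          (x *ₗ u +ᴹ y *ₗ v) -ᴹ (x′ *ₗ u +ᴹ y′ *ₗ v)   ≈⟨ +ᴹ-congʳ eq ⟩
          (x′ *ₗ u +ᴹ y′ *ₗ v) -ᴹ (x′ *ₗ u +ᴹ y′ *ₗ v)
            ≈⟨ solve 1 (λ v → v :- v := con (ℤ.+ 0)) ≈ᴹ-refl (x′ *ₗ u +ᴹ y′ *ₗ v) ⟩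
          0ᴹ                                           ∎)
    in x-y≈0⇒x≈y x-x′≈0 , x-y≈0⇒x≈y y-y′≈0
    where open SetoidReasoning ≈ᴹ-setoid

  MapsRayOnto : Carrierᴹ → Carrierᴹ → Set _
  MapsRayOnto v w = (∀ k → ∃ λ k′ → ψ (k *ₗ v) ≈ᴹ k′ *ₗ w) × (∀ k′ → ∃ λ k → ψ (k *ₗ v) ≈ᴹ k′ *ₗ w)

  PreservesRay : Carrierᴹ → Set _
  PreservesRay v = MapsRayOnto v (ψ v)

  -- Any nonzero vector may replace the generator of its ray, and its own image then generates the
  -- image ray. This rescaling allows a frame in which the third ray is spanned by the sum of the
  -- first two generators.
  mapsRayOnto⇒preservesRay : ∀ {v w u a} → MapsRayOnto v w → u ≈ᴹ a *ₗ v → ¬ u ≈ᴹ 0ᴹ → PreservesRay u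
  mapsRayOnto⇒preservesRay {v} {w} {u} {a} (forward , backward) u≈av u≉0 with a ≟ 0#
  ... | yes a≈0 = contradiction (≈ᴹ-trans u≈av (≈ᴹ-trans (*ₗ-congʳ a≈0) (*ₗ-zeroˡ v))) u≉0
  ... | no a≉0 with b , ψav≈bw ← forward a = forward′ , backward′
    where
    open SetoidReasoning ≈ᴹ-setoid
    ψu≈bw : ψ u ≈ᴹ b *ₗ w
    ψu≈bw = ≈ᴹ-trans (ψ-cong u≈av) ψav≈bw
    b≉0 : ¬ b ≈ 0#
    b≉0 b≈0 = u≉0 (ψ-injective (begin
      ψ u        ≈⟨ ψu≈bw ⟩
      b *ₗ w     ≈⟨ *ₗ-congʳ b≈0 ⟩
      0# *ₗ w    ≈⟨ *ₗ-zeroˡ w ⟩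
      0ᴹ         ≈⟨ ψ-0 ⟨
      ψ 0ᴹ       ∎))
    forward′ : ∀ k → ∃ λ k′ → ψ (k *ₗ u) ≈ᴹ k′ *ₗ ψ u
    forward′ k with d , eq ← forward (k * a) = d * inverse b b≉0 , (begin
      ψ (k *ₗ u)                           ≈⟨ ψ-cong (*ₗ-congˡ u≈av) ⟩
      ψ (k *ₗ (a *ₗ v))                    ≈⟨ ψ-cong (≈ᴹ-sym (*ₗ-assoc k a v)) ⟩
      ψ ((k * a) *ₗ v)                     ≈⟨ eq ⟩
      d *ₗ w                               ≈⟨ *ₗ-congʳ (x/y*y≈x b≉0) ⟨
      (d * inverse b b≉0 * b) *ₗ w         ≈⟨ *ₗ-assoc (d * inverse b b≉0) b w ⟩
      (d * inverse b b≉0) *ₗ (b *ₗ w)      ≈⟨ *ₗ-congˡ ψu≈bw ⟨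
      (d * inverse b b≉0) *ₗ ψ u           ∎)
    backward′ : ∀ k′ → ∃ λ k → ψ (k *ₗ u) ≈ᴹ k′ *ₗ ψ u
    backward′ k′ with d , eq ← backward (k′ * b) = d * inverse a a≉0 , (begin
      ψ ((d * inverse a a≉0) *ₗ u)         ≈⟨ ψ-cong (*ₗ-congˡ u≈av) ⟩
      ψ ((d * inverse a a≉0) *ₗ (a *ₗ v))  ≈⟨ ψ-cong (≈ᴹ-sym (*ₗ-assoc (d * inverse a a≉0) a v)) ⟩
      ψ ((d * inverse a a≉0 * a) *ₗ v)     ≈⟨ ψ-cong (*ₗ-congʳ (x/y*y≈x a≉0)) ⟩
      ψ (d *ₗ v)                           ≈⟨ eq ⟩
      (k′ * b) *ₗ w                        ≈⟨ *ₗ-assoc k′ b w ⟩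
      k′ *ₗ (b *ₗ w)                       ≈⟨ *ₗ-congˡ ψu≈bw ⟨
      k′ *ₗ ψ u                            ∎)

  module Frame (u₀ u₁ : Carrierᴹ)
    (span : ∀ v → ∃₂ λ x y → v ≈ᴹ x *ₗ u₀ +ᴹ y *ₗ u₁)
    (independent : ∀ x y → x *ₗ u₀ +ᴹ y *ₗ u₁ ≈ᴹ 0ᴹ → x ≈ 0# × y ≈ 0#)
    (ray₀ : PreservesRay u₀) (ray₁ : PreservesRay u₁) (ray₀₁ : PreservesRay (u₀ +ᴹ u₁))
    where

    private
      w₀ = ψ u₀
      w₁ = ψ u₁

    σ : Carrier → Carrier
    σ k = proj₁ (proj₁ ray₀ k)

    ψ-*ₗ-u₀ : ∀ k → ψ (k *ₗ u₀) ≈ᴹ σ k *ₗ w₀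
    ψ-*ₗ-u₀ k = proj₂ (proj₁ ray₀ k)

    independent-injective : ∀ {x y x′ y′} → x *ₗ u₀ +ᴹ y *ₗ u₁ ≈ᴹ x′ *ₗ u₀ +ᴹ y′ *ₗ u₁ → x ≈ x′ × y ≈ y′
    independent-injective = independent⇒injective u₀ u₁ independent

    u₀≉0 : ¬ u₀ ≈ᴹ 0ᴹ
    u₀≉0 u₀≈0 = 1≉0 (proj₁ (independent 1# 0# (≈ᴹ-trans
      (solve 2 (λ a b → con (ℤ.+ 1) :* a :+ con (ℤ.+ 0) :* b := a) ≈ᴹ-refl u₀ u₁) u₀≈0)))

    u₁≉0 : ¬ u₁ ≈ᴹ 0ᴹ
    u₁≉0 u₁≈0 = 1≉0 (proj₂ (independent 0# 1# (≈ᴹ-trans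
      (solve 2 (λ a b → con (ℤ.+ 0) :* a :+ con (ℤ.+ 1) :* b := b) ≈ᴹ-refl u₀ u₁) u₁≈0)))

    ψ≉0 : ∀ {v} → ¬ v ≈ᴹ 0ᴹ → ¬ ψ v ≈ᴹ 0ᴹ
    ψ≉0 v≉0 ψv≈0 = v≉0 (ψ-injective (≈ᴹ-trans ψv≈0 (≈ᴹ-sym ψ-0)))

    w-coefficient≈0 : ∀ {k u x} → k ≈ 0# → ¬ u ≈ᴹ 0ᴹ → ψ (k *ₗ u) ≈ᴹ x *ₗ ψ u → x ≈ 0#
    w-coefficient≈0 {k} {u} {x} k≈0 u≉0 eq = *ₗ-cancel (ψ≉0 u≉0) (begin
      x *ₗ ψ u       ≈⟨ eq ⟨
      ψ (k *ₗ u)     ≈⟨ ψ-cong (*ₗ-congʳ k≈0) ⟩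
      ψ (0# *ₗ u)    ≈⟨ ψ-cong (*ₗ-zeroˡ u) ⟩
      ψ 0ᴹ           ≈⟨ ψ-0 ⟩
      0ᴹ             ∎)
      where open SetoidReasoning ≈ᴹ-setoid

    -- Both summands are images of vectors on the two rays, since these rays are mapped onto the
    -- image rays; injectivity of ψ then carries the independence of u₀ and u₁ over.
    image-independent : ∀ x y → x *ₗ w₀ +ᴹ y *ₗ w₁ ≈ᴹ 0ᴹ → x ≈ 0# × y ≈ 0#
    image-independent x y eq =
      let k , ψku₀≈xw₀ = proj₂ ray₀ x
          l , ψlu₁≈yw₁ = proj₂ ray₁ y
          k≈0 , l≈0 = independent k l (ψ-injective (begin
            ψ (k *ₗ u₀ +ᴹ l *ₗ u₁)        ≈⟨ ψ-+ _ _ ⟩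
            ψ (k *ₗ u₀) +ᴹ ψ (l *ₗ u₁)    ≈⟨ +ᴹ-cong ψku₀≈xw₀ ψlu₁≈yw₁ ⟩
            x *ₗ w₀ +ᴹ y *ₗ w₁            ≈⟨ eq ⟩
            0ᴹ                            ≈⟨ ψ-0 ⟨
            ψ 0ᴹ                          ∎))
      in w-coefficient≈0 k≈0 u₀≉0 ψku₀≈xw₀ , w-coefficient≈0 l≈0 u₁≉0 ψlu₁≈yw₁
      where open SetoidReasoning ≈ᴹ-setoid

    image-injective : ∀ {x y x′ y′} → x *ₗ w₀ +ᴹ y *ₗ w₁ ≈ᴹ x′ *ₗ w₀ +ᴹ y′ *ₗ w₁ → x ≈ x′ × y ≈ y′
    image-injective = independent⇒injective w₀ w₁ image-independent

    -- The ray of u₀ + u₁ forces the multipliers on the rays of u₀ and u₁ to agree.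
    ψ-*ₗ-u₁ : ∀ k → ψ (k *ₗ u₁) ≈ᴹ σ k *ₗ w₁
    ψ-*ₗ-u₁ k =
      let l , ψku₁≈lw₁ = proj₁ ray₁ k
          m , ψk[u₀+u₁]≈m = proj₁ ray₀₁ k
          σk≈m , l≈m = image-injective {σ k} {l} {m} {m} (begin
            σ k *ₗ w₀ +ᴹ l *ₗ w₁         ≈⟨ +ᴹ-cong (ψ-*ₗ-u₀ k) ψku₁≈lw₁ ⟨
            ψ (k *ₗ u₀) +ᴹ ψ (k *ₗ u₁)   ≈⟨ ψ-+ _ _ ⟨
            ψ (k *ₗ u₀ +ᴹ k *ₗ u₁)       ≈⟨ ψ-cong (≈ᴹ-sym (*ₗ-distribˡ k u₀ u₁)) ⟩
            ψ (k *ₗ (u₀ +ᴹ u₁))          ≈⟨ ψk[u₀+u₁]≈m ⟩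
            m *ₗ ψ (u₀ +ᴹ u₁)            ≈⟨ *ₗ-congˡ (ψ-+ u₀ u₁) ⟩
            m *ₗ (w₀ +ᴹ w₁)              ≈⟨ *ₗ-distribˡ m w₀ w₁ ⟩
            m *ₗ w₀ +ᴹ m *ₗ w₁           ∎)
      in ≈ᴹ-trans ψku₁≈lw₁ (*ₗ-congʳ (trans l≈m (sym σk≈m)))
      where open SetoidReasoning ≈ᴹ-setoid

    ψ-coordinates : ∀ x y → ψ (x *ₗ u₀ +ᴹ y *ₗ u₁) ≈ᴹ σ x *ₗ w₀ +ᴹ σ y *ₗ w₁
    ψ-coordinates x y = ≈ᴹ-trans (ψ-+ _ _) (+ᴹ-cong (ψ-*ₗ-u₀ x) (ψ-*ₗ-u₁ y))

    σ-unique : ∀ {k l} → ψ (k *ₗ u₀) ≈ᴹ l *ₗ w₀ → σ k ≈ l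
    σ-unique {k} {l} eq = proj₁ (image-injective {σ k} {0#} {l} {0#} (+ᴹ-congʳ (≈ᴹ-trans (≈ᴹ-sym (ψ-*ₗ-u₀ k)) eq)))

    σ-cong : ∀ {k l} → k ≈ l → σ k ≈ σ l
    σ-cong {k} {l} k≈l = σ-unique (≈ᴹ-trans (ψ-cong (*ₗ-congʳ k≈l)) (ψ-*ₗ-u₀ l))

    σ-+ : ∀ k l → σ (k + l) ≈ σ k + σ l
    σ-+ k l = σ-unique (begin
      ψ ((k + l) *ₗ u₀)              ≈⟨ ψ-cong (*ₗ-distribʳ u₀ k l) ⟩
      ψ (k *ₗ u₀ +ᴹ l *ₗ u₀)         ≈⟨ ψ-+ _ _ ⟩
      ψ (k *ₗ u₀) +ᴹ ψ (l *ₗ u₀)     ≈⟨ +ᴹ-cong (ψ-*ₗ-u₀ k) (ψ-*ₗ-u₀ l) ⟩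
      σ k *ₗ w₀ +ᴹ σ l *ₗ w₀         ≈⟨ ≈ᴹ-sym (*ₗ-distribʳ w₀ (σ k) (σ l)) ⟩
      (σ k + σ l) *ₗ w₀              ∎)
      where open SetoidReasoning ≈ᴹ-setoid

    σ-1 : σ 1# ≈ 1#
    σ-1 = σ-unique (≈ᴹ-trans (ψ-cong (*ₗ-identityˡ u₀))
                             (≈ᴹ-sym (*ₗ-identityˡ w₀)))

    σ-0 : σ 0# ≈ 0#
    σ-0 = w-coefficient≈0 refl u₀≉0 (ψ-*ₗ-u₀ 0#)

    σ-injective : ∀ {k l} → σ k ≈ σ l → k ≈ l
    σ-injective {k} {l} eq = proj₁ (independent-injective {k} {0#} {l} {0#} (+ᴹ-congʳ (ψ-injective
      (≈ᴹ-trans (ψ-*ₗ-u₀ k) (≈ᴹ-trans (*ₗ-congʳ eq) (≈ᴹ-sym (ψ-*ₗ-u₀ l)))))))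

    σ-surjective : ∀ l → ∃ λ k → σ k ≈ l
    σ-surjective l = let k , eq = proj₂ ray₀ l in k , σ-unique eq

    σ-- : ∀ k l → σ (k - l) ≈ σ k - σ l
    σ-- k l = begin
      σ (k - l)                ≈⟨ solveₛ 2 (λ a b → a ⊜ (a ⊕ b) ⊖ b) refl (σ (k - l)) (σ l) ⟩
      σ (k - l) + σ l - σ l    ≈⟨ +-congʳ (σ-+ (k - l) l) ⟨
      σ (k - l + l) - σ l      ≈⟨ +-congʳ (σ-cong (solveₛ 2 (λ k l → k ⊖ l ⊕ l ⊜ k) refl k l)) ⟩
      σ k - σ l                ∎
      where open SetoidReasoning setoid

    Multiplicative : Carrier → Set _
    Multiplicative x = ∀ k → σ (k * x) ≈ σ k * σ x

    -- If k acts on the image ray as l, then comparing the coordinates at w₁ gives l = σ k because σ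
    -- 1 = 1, and the coordinates at w₀ give σ (k x) = l σ x.
    ray⇒multiplicative : ∀ {x} → PreservesRay (x *ₗ u₀ +ᴹ u₁) → Multiplicative x
    ray⇒multiplicative {x} (ray , _) k =
      let l , eq = ray k
          σkx≈lσx , σk≈lσ1 = image-injective {σ (k * x)} {σ k} {l * σ x} {l * σ 1#} (begin
            σ (k * x) *ₗ w₀ +ᴹ σ k *ₗ w₁         ≈⟨ ψ-coordinates (k * x) k ⟨
            ψ ((k * x) *ₗ u₀ +ᴹ k *ₗ u₁)
              ≈⟨ ψ-cong (solve 4 (λ k x u v → k :* x :* u :+ k :* v := k :* (x :* u :+ v))
                   ≈ᴹ-refl ⟪ k ⟫ ⟪ x ⟫ u₀ u₁) ⟩
            ψ (k *ₗ (x *ₗ u₀ +ᴹ u₁))             ≈⟨ eq ⟩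
            l *ₗ ψ (x *ₗ u₀ +ᴹ u₁)
              ≈⟨ *ₗ-congˡ (ψ-cong (+ᴹ-congˡ (≈ᴹ-sym (*ₗ-identityˡ u₁)))) ⟩
            l *ₗ ψ (x *ₗ u₀ +ᴹ 1# *ₗ u₁)         ≈⟨ *ₗ-congˡ (ψ-coordinates x 1#) ⟩
            l *ₗ (σ x *ₗ w₀ +ᴹ σ 1# *ₗ w₁)       ≈⟨ *ₗ-combination l (σ x) (σ 1#) w₀ w₁ ⟩
            (l * σ x) *ₗ w₀ +ᴹ (l * σ 1#) *ₗ w₁  ∎)
      in trans σkx≈lσx (*-congʳ (sym (trans σk≈lσ1 (trans (*-congˡ σ-1) (*-identityʳ l)))))
      where open SetoidReasoning ≈ᴹ-setoid

    multiplicative-- : ∀ {x y} → Multiplicative x → Multiplicative y → Multiplicative (x - y)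
    multiplicative-- {x} {y} mult-x mult-y k = begin
      σ (k * (x - y))
        ≈⟨ σ-cong (solveₛ 3 (λ k x y → k ⊗ (x ⊖ y) ⊜ k ⊗ x ⊖ k ⊗ y) refl k x y) ⟩
      σ (k * x - k * y)            ≈⟨ σ-- (k * x) (k * y) ⟩
      σ (k * x) - σ (k * y)        ≈⟨ +-cong (mult-x k) (-‿cong (mult-y k)) ⟩
      σ k * σ x - σ k * σ y
        ≈⟨ solveₛ 3 (λ k x y → k ⊗ (x ⊖ y) ⊜ k ⊗ x ⊖ k ⊗ y) refl (σ k) (σ x) (σ y) ⟨
      σ k * (σ x - σ y)            ≈⟨ *-congˡ (σ-- x y) ⟨
      σ k * σ (x - y)              ∎
      where open SetoidReasoning setoid

    -- Multiplying by σ y absorbs y into the argument, where z y = x is multiplicative; injectivity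
    -- of σ allows cancelling σ y. With closure under differences this is the subfield property in
    -- the form needed for z = (a′ - a) / (b - b′).
    multiplicative-ratio : ∀ {x y z} → Multiplicative x → Multiplicative y → ¬ y ≈ 0# → z * y ≈ x → Multiplicative z
    multiplicative-ratio {x} {y} {z} mult-x mult-y y≉0 zy≈x k = *-cancelʳ-≉0 σy≉0 (begin
      σ (k * z) * σ y      ≈⟨ mult-y (k * z) ⟨
      σ (k * z * y)        ≈⟨ σ-cong (trans (*-assoc k z y) (*-congˡ zy≈x)) ⟩
      σ (k * x)            ≈⟨ mult-x k ⟩
      σ k * σ x            ≈⟨ *-congˡ (trans (σ-cong (sym zy≈x)) (mult-y z)) ⟩
      σ k * (σ z * σ y)    ≈⟨ *-assoc _ _ _ ⟨
      σ k * σ z * σ y      ∎)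
      where
      open SetoidReasoning setoid
      σy≉0 : ¬ σ y ≈ 0#
      σy≉0 σy≈0 = y≉0 (σ-injective (trans σy≈0 (sym σ-0)))

    -- If z were not multiplicative, then 1 and z would be linearly independent
    -- over the subfield of multiplicative elements, whence |subfield|² ≤ n.
    many-multiplicative⇒all : ∀ {xs} → Unique setoid xs → All Multiplicative xs →
                              n ℕ.< length xs ℕ.* length xs → ∀ z → Multiplicative z
    many-multiplicative⇒all {xs} xs! mults n<xs² z k with σ (k * z) ≟ σ k * σ z
    ... | yes eq = eq
    ... | no neq = contradiction (≡.subst (ℕ._≤ n) length-pairs (unique⇒length≤ pairs-unique)) (ℕ.<⇒≱ n<xs²)
      where
      subfield : Setoid _ _
      subfield = On.setoid {B = ∃ Multiplicative} setoid proj₁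
      ys : List (∃ Multiplicative)
      ys = All.reduce (λ {x} mult → x , mult) mults
      ys-unique : Unique subfield ys
      ys-unique = reduce-unique setoid subfield {Multiplicative} (λ {x} mult → x , mult) (λ _ _ eq → eq) xs! mults
      combine : ∃ Multiplicative → ∃ Multiplicative → Carrier
      combine (a , _) (b , _) = a + z * b
      combine-injective : ∀ {a a′ b b′} → combine a b ≈ combine a′ b′ → proj₁ a ≈ proj₁ a′ × proj₁ b ≈ proj₁ b′
      combine-injective {a , mult-a} {a′ , mult-a′} {b , mult-b} {b′ , mult-b′} eq with b ≟ b′
      ... | yes b≈b′ = x-y≈0⇒x≈y (begin
          a - a′
            ≈⟨ solveₛ 3 (λ a a′ c → a ⊖ a′ ⊜ (a ⊕ c) ⊖ (a′ ⊕ c)) refl a a′ (z * b) ⟩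
          a + z * b - (a′ + z * b)          ≈⟨ +-cong eq (-‿cong (+-congˡ (*-congˡ b≈b′))) ⟩
          a′ + z * b′ - (a′ + z * b′)       ≈⟨ -‿inverseʳ _ ⟩
          0#                                ∎) , b≈b′
        where open SetoidReasoning setoid
      ... | no  b≉b′ = contradiction
        (multiplicative-ratio (multiplicative-- mult-a′ mult-a) (multiplicative-- mult-b mult-b′) (x-y≉0 b≉b′) (begin
          z * (b - b′)
            ≈⟨ solveₛ 4 (λ z a b b′ → z ⊗ (b ⊖ b′) ⊜ (a ⊕ z ⊗ b) ⊖ (a ⊕ z ⊗ b′)) refl z a b b′ ⟩
          a + z * b - (a + z * b′)          ≈⟨ +-congʳ eq ⟩
          a′ + z * b′ - (a + z * b′)
            ≈⟨ solveₛ 3 (λ a a′ c → (a′ ⊕ c) ⊖ (a ⊕ c) ⊜ a′ ⊖ a) refl a a′ (z * b′) ⟩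
          a′ - a                            ∎) k)
        neq
        where open SetoidReasoning setoid
      pairs-unique : Unique setoid (List.cartesianProductWith combine ys ys)
      pairs-unique = Unique.cartesianProductWith⁺ subfield subfield setoid combine
        (λ {a} {a′} {b} {b′} → combine-injective {a} {a′} {b} {b′}) ys-unique ys-unique
      length-pairs : length (List.cartesianProductWith combine ys ys) ≡ length xs ℕ.* length xs
      length-pairs = ≡.trans (length-cartesianProductWith combine ys ys)
        (≡.cong₂ ℕ._*_ (length-reduce _ mults) (length-reduce _ mults))

    multiplicative⇒semilinear : (∀ z → Multiplicative z) → ∀ k v → ψ (k *ₗ v) ≈ᴹ σ k *ₗ ψ v
    multiplicative⇒semilinear mult k v =
      let x , y , v≈ = span v in begin
      ψ (k *ₗ v)                                       ≈⟨ ψ-cong (*ₗ-congˡ v≈) ⟩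
      ψ (k *ₗ (x *ₗ u₀ +ᴹ y *ₗ u₁))                    ≈⟨ ψ-cong (*ₗ-combination k x y u₀ u₁) ⟩
      ψ ((k * x) *ₗ u₀ +ᴹ (k * y) *ₗ u₁)               ≈⟨ ψ-coordinates (k * x) (k * y) ⟩
      σ (k * x) *ₗ w₀ +ᴹ σ (k * y) *ₗ w₁
        ≈⟨ +ᴹ-cong (*ₗ-congʳ (mult x k)) (*ₗ-congʳ (mult y k)) ⟩
      (σ k * σ x) *ₗ w₀ +ᴹ (σ k * σ y) *ₗ w₁
        ≈⟨ ≈ᴹ-sym (*ₗ-combination (σ k) (σ x) (σ y) w₀ w₁) ⟩
      σ k *ₗ (σ x *ₗ w₀ +ᴹ σ y *ₗ w₁)                  ≈⟨ *ₗ-congˡ (ψ-coordinates x y) ⟨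
      σ k *ₗ ψ (x *ₗ u₀ +ᴹ y *ₗ u₁)                    ≈⟨ *ₗ-congˡ (ψ-cong v≈) ⟨
      σ k *ₗ ψ v                                       ∎
      where open SetoidReasoning ≈ᴹ-setoid

-- Explicit isomorphisms: the identity and the exchange of coordinates.

module LinearIsomorphism {c ℓ n} (F : FiniteField c ℓ n)
  (f g : FiniteField.Carrier F → FiniteField.Carrier F)
  (f-homo : IsRingHomomorphism (FiniteField.rawRing F) (FiniteField.rawRing F) f)
  (g-homo : IsRingHomomorphism (FiniteField.rawRing F) (FiniteField.rawRing F) g)
  where
  open FiniteField F
  open FieldProperties F
  open Plane F
  private
    module S = Spread F f f-homo
    module T = Spread F g g-homo

  componentwise⇒mapsLines : (φ : Inverse ≈ᴹ-setoid ≈ᴹ-setoid) (let open Inverse φ using (to; from)) →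
    (∀ u v → to (u +ᴹ v) ≈ᴹ to u +ᴹ to v) →
    (∀ j → ∃ λ j′ → (∀ {v} → S.Component j v → T.Component j′ (to v)) ×
                    (∀ {w} → T.Component j′ w → S.Component j (from w))) →
    MapsLinesToLines (𝒜 F f) (𝒜 F g) to
  componentwise⇒mapsLines φ to-+ components (j , w)
    with j′ , forward , backward ← components j = (j′ , to w) , λ p → mk⇔
      (λ (v , v∈ , p≈v+w) → to v , forward v∈ , ≈ᴹ-trans (to-cong p≈v+w) (to-+ v w))
      (λ (v , v∈ , top≈v+tow) → from v , backward v∈ , (begin
        p                     ≈⟨ strictlyInverseʳ p ⟨
        from (to p)           ≈⟨ from-cong top≈v+tow ⟩
        from (v +ᴹ to w)      ≈⟨ from-cong (+ᴹ-congʳ (strictlyInverseˡ v)) ⟨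
        from (to (from v) +ᴹ to w)  ≈⟨ from-cong (to-+ (from v) w) ⟨
        from (to (from v +ᴹ w))     ≈⟨ strictlyInverseʳ (from v +ᴹ w) ⟩
        from v +ᴹ w           ∎))
    where
    open Inverse φ using (to; from; to-cong; from-cong; strictlyInverseˡ; strictlyInverseʳ)
    open SetoidReasoning ≈ᴹ-setoid

  identity-mapsLines : (∀ x → f x ≈ g x) → MapsLinesToLines (𝒜 F f) (𝒜 F g) (λ v → v)
  identity-mapsLines f≈g = componentwise⇒mapsLines (Identity.inverse ≈ᴹ-setoid) (λ _ _ → ≈ᴹ-refl) components
    where
    components : ∀ j → ∃ λ j′ → (∀ {v} → S.Component j v → T.Component j′ v) ×
                                (∀ {v} → T.Component j′ v → S.Component j v)
    components (slope m m∉) =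
      slope m (λ (x , x≉0 , eq) → m∉ (x , x≉0 , trans eq (*-congʳ (sym (f≈g x))))) , (λ v∈ → v∈) , (λ v∈ → v∈)
    components (multiple h h≉0) = multiple h h≉0
      , (λ (u , (x , eq) , v≈) → u , (x , ≈ᴹ-trans eq (refl , f≈g x)) , v≈)
      , (λ (u , (x , eq) , v≈) → u , (x , ≈ᴹ-trans eq (refl , sym (f≈g x))) , v≈)
    components vertical = vertical , (λ v∈ → v∈) , (λ v∈ → v∈)

  swapping : Inverse ≈ᴹ-setoid ≈ᴹ-setoid
  swapping = record
    { to = swap ; from = swap
    ; to-cong = swap ; from-cong = swap
    ; inverse = swap , swap
    }

  -- The exchange inverts nonzero slopes, interchanges the two axes, and turns (k , f k) into (f k ,
  -- g (f k)), so that h U goes to h U′ with the same h.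
  swap-mapsLines : (∀ x → g (f x) ≈ x) → (∀ x → f (g x) ≈ x) → MapsLinesToLines (𝒜 F f) (𝒜 F g) swap
  swap-mapsLines gf≈id fg≈id = componentwise⇒mapsLines swapping (λ _ _ → ≈ᴹ-refl) components
    where
    open SetoidReasoning setoid
    inverse-slope : ∀ {m} (m≉0 : ¬ m ≈ 0#) → m ∉ L F f → inverse m m≉0 ∉ L F g
    -- From 1 / m = g x / x follows m = x / g x = f (g x) / g x, so g x is the witness.
    inverse-slope {m} m≉0 m∉ (x , x≉0 , m⁻¹≈gx/x) = m∉ (g x , T.f≉0 x≉0 , x≈z/y (T.f≉0 x≉0) (begin
      m * g x                              ≈⟨ *-congˡ (x/y*y≈x x≉0) ⟨
      m * (g x * inverse x x≉0 * x)        ≈⟨ *-congˡ (*-congʳ m⁻¹≈gx/x) ⟨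
      m * (inverse m m≉0 * x)              ≈⟨ *-assoc _ _ _ ⟨
      m * inverse m m≉0 * x                ≈⟨ *-congʳ (inverseʳ m≉0) ⟩
      1# * x                               ≈⟨ *-identityˡ x ⟩
      x                                    ≈⟨ fg≈id x ⟨
      f (g x)                              ∎))
    components : ∀ j → ∃ λ j′ → (∀ {v} → S.Component j v → T.Component j′ (swap v)) ×
                                (∀ {w} → T.Component j′ w → S.Component j (swap w))
    components (slope m m∉) with m ≟ 0#
    ... | yes m≈0 = vertical
        , (λ (k , x≈k , y≈km) → k , trans y≈km (trans (*-congˡ m≈0) (zeroʳ k)) , trans x≈k (*-identityʳ k))
        , (λ (k , x≈0 , y≈k) → k , trans y≈k (sym (*-identityʳ k)) , trans x≈0 (sym (trans (*-congˡ m≈0) (zeroʳ k))))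
    ... | no m≉0 = slope (inverse m m≉0) (inverse-slope m≉0 m∉)
        , (λ (k , x≈k , y≈km) → k * m , trans y≈km (sym (*-identityʳ _)) ,
             trans x≈k (sym (trans (*-assoc _ _ _) (*-congˡ (inverseʳ m≉0)))))
        , (λ (k , x≈k , y≈k/m) → k * inverse m m≉0 , trans y≈k/m (sym (*-identityʳ _)) ,
             trans x≈k (sym (trans (*-assoc _ _ _) (*-congˡ (inverseˡ m≉0)))))
    components (multiple h h≉0) = multiple h h≉0
      , (λ v∈ → let k , x≈hk , y≈hfk = S.∈⇒param (multiple h h≉0) v∈ in
           T.component-resp (multiple h h≉0) (sym y≈hfk , trans (*-congˡ (gf≈id k)) (sym x≈hk))
             (T.param∈ (multiple h h≉0) (f k)))
      , (λ w∈ → let k , x≈hk , y≈hgk = T.∈⇒param (multiple h h≉0) w∈ in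
           S.component-resp (multiple h h≉0) (sym y≈hgk , trans (*-congˡ (fg≈id k)) (sym x≈hk))
             (S.param∈ (multiple h h≉0) (g k)))
    components vertical = slope 0# T.0∉L
      , (λ (k , x≈0 , y≈k) → k , trans y≈k (sym (*-identityʳ k)) , trans x≈0 (sym (zeroʳ k)))
      , (λ (k , x≈k , y≈k0) → k , trans y≈k0 (zeroʳ k) , trans x≈k (*-identityʳ k))

-- Powers of the Frobenius map: additivity, norm and linear independence.

module FrobeniusPowers {c ℓ} (q t : ℕ) (q-primePower : IsPrimePower q) (F : FiniteField c ℓ (q ℕ.^ t)) where
  open FiniteField F hiding (zero)
  open FieldProperties F
  open Frobenius F
  open IntegerCoefficients commutativeRing
  open CommutativeExp commutativeSemiring using (_^_; ^-congˡ; ^-congʳ; ^-homo-*; ^-assocʳ; ^-distrib-*)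
  open SetoidReasoning setoid

  frob : ℕ → Carrier → Carrier
  frob = frobeniusPower F q

  additivePower-q : AdditivePower q
  additivePower-q =
    let p , k , p-prime , _ , q≡p^k = q-primePower
        p×1≈0 = characteristic p (k ℕ.* t) (≡.trans (≡.cong (ℕ._^ t) q≡p^k) (ℕ.^-*-assoc p k t))
    in ≡.subst AdditivePower (≡.sym q≡p^k) (additivePower-^ {p} (additivePower-prime p-prime p×1≈0) k)

  frob-isRingHomomorphism : ∀ s → IsRingHomomorphism rawRing rawRing (frob s)
  frob-isRingHomomorphism s = record
    { isSemiringHomomorphism = record
      { isNearSemiringHomomorphism = record
        { +-isMonoidHomomorphism = record
          { isMagmaHomomorphism = record
            { isRelHomomorphism = record { cong = ^-congˡ (q ℕ.^ s) }
            ; homo = additive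
            }
          ; ε-homo = frob-0
          }
        ; *-homo = λ x y → ^-distrib-* x y (q ℕ.^ s)
        }
      ; 1#-homo = 1^k≈1 (q ℕ.^ s)
      }
    ; -‿homo = λ x → negation-unique (frob s x) (frob s (- x)) (begin
        frob s x + frob s (- x)   ≈⟨ additive x (- x) ⟨
        frob s (x - x)            ≈⟨ ^-congˡ (q ℕ.^ s) (-‿inverseʳ x) ⟩
        frob s 0#                 ≈⟨ frob-0 ⟩
        0#                        ∎)
    }
    where
    open GroupProperties +-group using (identityʳ-unique) renaming (inverseʳ-unique to negation-unique)
    additive : AdditivePower (q ℕ.^ s)
    additive = additivePower-^ {q} additivePower-q s
    frob-0 : frob s 0# ≈ 0#
    frob-0 = identityʳ-unique (frob s 0#) (frob s 0#)
      (trans (sym (additive 0# 0#)) (^-congˡ (q ℕ.^ s) (+-identityʳ 0#)))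
    1^k≈1 : ∀ k → 1# ^ k ≈ 1#
    1^k≈1 zero    = refl
    1^k≈1 (suc k) = trans (*-identityˡ _) (1^k≈1 k)

  frob-∘ : ∀ s s′ x → frob s′ (frob s x) ≈ frob (s ℕ.+ s′) x
  frob-∘ s s′ x = trans (^-assocʳ x (q ℕ.^ s) (q ℕ.^ s′)) (^-congʳ x (≡.sym (ℕ.^-distribˡ-+-* q s s′)))

  frob-t* : ∀ k x → frob (k ℕ.* t) x ≈ x
  frob-t* k x = trans (^-congʳ x (≡.trans (≡.cong (q ℕ.^_) (ℕ.*-comm k t)) (≡.sym (ℕ.^-*-assoc q t k)))) (x^n^k≈x k x)

  frob-% : .{{_ : ℕ.NonZero t}} → ∀ s x → frob s x ≈ frob (s % t) x
  frob-% s x = begin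
    frob s x                          ≈⟨ ^-congʳ x (≡.cong (q ℕ.^_) (m≡m%n+[m/n]*n s t)) ⟩
    frob (s % t ℕ.+ s / t ℕ.* t) x    ≈⟨ frob-∘ (s % t) (s / t ℕ.* t) x ⟨
    frob (s / t ℕ.* t) (frob (s % t) x) ≈⟨ frob-t* (s / t) (frob (s % t) x) ⟩
    frob (s % t) x                    ∎

  θ : ℕ
  θ = geometricSum q t

  -- x ↦ x ^ θ is the norm onto the subfield of order q, which is invariant
  -- under the Frobenius map.
  norm-frob₁ : ∀ x → (x ^ q) ^ θ ≈ x ^ θ
  norm-frob₁ x with x ≟ 0#
  ... | yes x≈0 = ^-congˡ θ (trans (^-congˡ q x≈0) (trans (trans (^-congʳ 0# (≡.sym (ℕ.*-identityʳ q))) f-0) (sym x≈0)))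
    where open IsRingHomomorphism (frob-isRingHomomorphism 1) using () renaming (0#-homo to f-0)
  ... | no  x≉0 = *-cancelʳ-≉0 x≉0 (begin
    (x ^ q) ^ θ * x          ≈⟨ *-cong (^-assocʳ x q θ) (sym (*-identityʳ x)) ⟩
    x ^ (q ℕ.* θ) * x ^ 1    ≈⟨ ^-homo-* x (q ℕ.* θ) 1 ⟨
    x ^ (q ℕ.* θ ℕ.+ 1)      ≈⟨ ^-congʳ x (geometricSum-identity q t) ⟩
    x ^ (θ ℕ.+ q ℕ.^ t)      ≈⟨ ^-homo-* x θ (q ℕ.^ t) ⟩
    x ^ θ * x ^ (q ℕ.^ t)    ≈⟨ *-congˡ (x^n≈x x) ⟩
    x ^ θ * x                ∎)

  norm-frob : ∀ s x → frob s x ^ θ ≈ x ^ θ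
  norm-frob zero    x = ^-congˡ θ (*-identityʳ x)
  norm-frob (suc s) x = begin
    (x ^ (q ℕ.* q ℕ.^ s)) ^ θ    ≈⟨ ^-congˡ θ (^-assocʳ x q (q ℕ.^ s)) ⟨
    frob s (x ^ q) ^ θ           ≈⟨ norm-frob s (x ^ q) ⟩
    (x ^ q) ^ θ                  ≈⟨ norm-frob₁ x ⟩
    x ^ θ                        ∎

  -- Here m x is a Frobenius image of x and has the same norm as x, which is nonzero.
  L⊆norm-1 : ∀ s {m} → m ∈ L F (frob s) → m ^ θ ≈ 1#
  L⊆norm-1 s {m} (x , x≉0 , m≈) = *-cancelʳ-≉0 (x≉0 ∘ x^k≈0⇒x≈0 θ) (begin
    m ^ θ * x ^ θ     ≈⟨ ^-distrib-* m x θ ⟨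
    (m * x) ^ θ       ≈⟨ ^-congˡ θ (trans (*-congʳ m≈) (x/y*y≈x x≉0)) ⟩
    frob s x ^ θ      ≈⟨ norm-frob s x ⟩
    x ^ θ             ≈⟨ *-identityˡ _ ⟨
    1# * x ^ θ        ∎)

  module _ (1<q : 1 ℕ.< q) where
    private
      term : Carrier → ℕ → ℕ → Carrier
      term a e = monomial (q ℕ.^ e) a

      q^-injective : ∀ {d e} → q ℕ.^ d ≡ q ℕ.^ e → d ≡ e
      q^-injective {d} {e} eq with ℕ.<-cmp d e
      ... | tri< d<e _ _ = contradiction eq (ℕ.<⇒≢ (ℕ.^-monoʳ-< q 1<q d<e))
      ... | tri≈ _ d≡e _ = d≡e
      ... | tri> _ _ d>e = contradiction (≡.sym eq) (ℕ.<⇒≢ (ℕ.^-monoʳ-< q 1<q d>e))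

      off : ∀ {d e} a → ¬ d ≡ e → term a d (q ℕ.^ e) ≈ 0#
      off {d} {e} a d≢e = reflexive (monomial-off-diagonal {q ℕ.^ d} a (d≢e ∘ q^-injective))

    -- Four terms suffice: the identities to refute involve frob 0, s, s′ and s + s′.
    frob-independent : ∀ {a₀ a₁ a₂ a₃ e₀ e₁ e₂ e₃} → e₀ ℕ.< t → e₁ ℕ.< t → e₂ ℕ.< t → e₃ ℕ.< t →
      ¬ e₁ ≡ e₀ → ¬ e₂ ≡ e₀ → ¬ e₃ ≡ e₀ →
      (∀ x → a₀ * frob e₀ x + (a₁ * frob e₁ x + (a₂ * frob e₂ x + a₃ * frob e₃ x)) ≈ 0#) → a₀ ≈ 0#
    frob-independent {a₀} {a₁} {a₂} {a₃} {e₀} {e₁} {e₂} {e₃} e₀<t e₁<t e₂<t e₃<t e₁≢e₀ e₂≢e₀ e₃≢e₀ vanishes = begin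
      a₀                  ≡⟨ monomial-diagonal (q ℕ.^ e₀) a₀ ⟨
      term a₀ e₀ i
        ≈⟨ solve 1 (λ a → a := a :+ (con (ℤ.+ 0) :+ (con (ℤ.+ 0) :+ con (ℤ.+ 0)))) refl (term a₀ e₀ i) ⟩
      term a₀ e₀ i + (0# + (0# + 0#))
        ≈⟨ +-congˡ (+-cong (off a₁ e₁≢e₀) (+-cong (off a₂ e₂≢e₀) (off a₃ e₃≢e₀))) ⟨
      P i
        -- All exponents are below t, so P has degree below q^t, while each of the q^t field
        -- elements is a root.
        ≈⟨ enough-roots⇒coefficients≈0 N P elements-unique (All.universal root elements)
                               (ℕ.≤-reflexive (≡.sym (List.length-tabulate {n = N} (Inverse.from finite)))) (q^<N e₀<t) ⟩
      0#                  ∎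
      where
      N = q ℕ.^ t
      i = q ℕ.^ e₀
      P₃ P₂ P₁ P : ℕ → Carrier
      P₃ = term a₃ e₃
      P₂ j = term a₂ e₂ j + P₃ j
      P₁ j = term a₁ e₁ j + P₂ j
      P  j = term a₀ e₀ j + P₁ j
      q^<N : ∀ {e} → e ℕ.< t → q ℕ.^ e ℕ.< N
      q^<N = ℕ.^-monoʳ-< q 1<q
      root : ∀ x → eval N P x ≈ 0#
      root x = begin
        eval N P x  ≈⟨ trans (eval-+ N (term a₀ e₀) P₁ x) (+-congˡ
                        (trans (eval-+ N (term a₁ e₁) P₂ x) (+-congˡ (eval-+ N (term a₂ e₂) P₃ x)))) ⟩
        eval N (term a₀ e₀) x + (eval N (term a₁ e₁) x + (eval N (term a₂ e₂) x + eval N (term a₃ e₃) x))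
          ≈⟨ +-cong (eval-monomial {N} a₀ x (q^<N e₀<t)) (+-cong (eval-monomial {N} a₁ x (q^<N e₁<t))
               (+-cong (eval-monomial {N} a₂ x (q^<N e₂<t)) (eval-monomial {N} a₃ x (q^<N e₃<t)))) ⟩
        a₀ * frob e₀ x + (a₁ * frob e₁ x + (a₂ * frob e₂ x + a₃ * frob e₃ x))   ≈⟨ vanishes x ⟩
        0#          ∎

-- Numerical bounds for the number of straight slopes.

-- Three times the first inequality and twice the second eliminate θ; the summand 2 is the
-- strictness of the second, counted twice.
n+2≤3g : ∀ {n θ g} → n ℕ.≤ θ ℕ.+ (θ ℕ.+ g) → 3 ℕ.* θ ℕ.< n → n ℕ.+ 2 ℕ.≤ 3 ℕ.* g
n+2≤3g {n} {θ} {g} n≤ 3θ<n = ℕ.+-cancelˡ-≤ (2 ℕ.* n) (n ℕ.+ 2) (3 ℕ.* g) (begin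
  2 ℕ.* n ℕ.+ (n ℕ.+ 2)                     ≡⟨ collect n ⟩
  3 ℕ.* n ℕ.+ 2                             ≤⟨ ℕ.+-monoˡ-≤ 2 (ℕ.*-monoʳ-≤ 3 n≤) ⟩
  3 ℕ.* (θ ℕ.+ (θ ℕ.+ g)) ℕ.+ 2             ≡⟨ regroup θ g ⟩
  2 ℕ.* suc (3 ℕ.* θ) ℕ.+ 3 ℕ.* g           ≤⟨ ℕ.+-monoˡ-≤ (3 ℕ.* g) (ℕ.*-monoʳ-≤ 2 3θ<n) ⟩
  2 ℕ.* n ℕ.+ 3 ℕ.* g                       ∎)
  where
  open ℕ.≤-Reasoning
  collect : ∀ n → 2 ℕ.* n ℕ.+ (n ℕ.+ 2) ≡ 3 ℕ.* n ℕ.+ 2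
  collect = solve-∀
  regroup : ∀ θ g → 3 ℕ.* (θ ℕ.+ (θ ℕ.+ g)) ℕ.+ 2 ≡ 2 ℕ.* suc (3 ℕ.* θ) ℕ.+ 3 ℕ.* g
  regroup = solve-∀

-- From 18 ≤ n + 2 ≤ 3 g follows g ≥ 6, and then 3 g ≤ (g - 1)². One slope is subtracted because it
-- serves as the point at infinity.
n<[g-1]² : ∀ {n θ g} → n ℕ.≤ θ ℕ.+ (θ ℕ.+ g) → 3 ℕ.* θ ℕ.< n → 16 ℕ.≤ n →
           ∃ λ r → g ≡ 6 ℕ.+ r × n ℕ.< (5 ℕ.+ r) ℕ.* (5 ℕ.+ r)
n<[g-1]² {n} {θ} {g} n≤ 3θ<n 16≤n with g ℕ.≤? 5
... | yes g≤5 = contradiction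
  (ℕ.≤-trans (ℕ.+-monoˡ-≤ 2 16≤n) (ℕ.≤-trans (n+2≤3g {n} {θ} n≤ 3θ<n) (ℕ.*-monoʳ-≤ 3 g≤5)))
  (ℕ.<⇒≱ (ℕ.m≤m+n 16 2))
... | no g≰5 = r , g≡6+r , (begin-strict
  n                               <⟨ ℕ.m<m+n n (ℕ.s≤s ℕ.z≤n) ⟩
  n ℕ.+ 2                         ≤⟨ n+2≤3g {n} {θ} n≤ 3θ<n ⟩
  3 ℕ.* g                         ≡⟨ ≡.cong (3 ℕ.*_) g≡6+r ⟩
  3 ℕ.* (6 ℕ.+ r)                 ≤⟨ ℕ.m≤m+n (3 ℕ.* (6 ℕ.+ r)) (7 ℕ.+ 7 ℕ.* r ℕ.+ r ℕ.* r) ⟩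
  3 ℕ.* (6 ℕ.+ r) ℕ.+ (7 ℕ.+ 7 ℕ.* r ℕ.+ r ℕ.* r)   ≡⟨ square r ⟩
  (5 ℕ.+ r) ℕ.* (5 ℕ.+ r)         ∎)
  where
  open ℕ.≤-Reasoning
  r = g ℕ.∸ 6
  g≡6+r : g ≡ 6 ℕ.+ r
  g≡6+r = ≡.sym (ℕ.m+[n∸m]≡n (ℕ.≰⇒> g≰5))
  square : ∀ r → 3 ℕ.* (6 ℕ.+ r) ℕ.+ (7 ℕ.+ 7 ℕ.* r ℕ.+ r ℕ.* r) ≡ (5 ℕ.+ r) ℕ.* (5 ℕ.+ r)
  square = solve-∀

record Semilinearity {c ℓ n} {F : FiniteField c ℓ n} {f g : FiniteField.Carrier F → FiniteField.Carrier F}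
                     (Ψ : AdditiveCollineation F f g) : Set (c ⊔ ℓ) where
  open FiniteField F
  open Plane F
  open AdditiveCollineation Ψ
  field
    σ            : Carrier → Carrier
    σ-cong       : ∀ {x y} → x ≈ y → σ x ≈ σ y
    σ-1          : σ 1# ≈ 1#
    σ-*          : ∀ x y → σ (x * y) ≈ σ x * σ y
    σ-surjective : ∀ y → ∃ λ x → σ x ≈ y
    ψ-*ₗ         : ∀ k v → ψ (k *ₗ v) ≈ᴹ σ k *ₗ ψ v

-- Counting straight slopes and forming cross ratios.

module SlopeCounting {c ℓ n} (F : FiniteField c ℓ n) {θ : ℕ} (0<θ : 0 ℕ.< θ) (3θ<n : 3 ℕ.* θ ℕ.< n)
  {f : FiniteField.Carrier F → FiniteField.Carrier F}
  (L⊆roots : ∀ {m} → m ∈ L F f → FieldProperties.RootOfUnity F θ m)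
  where
  open FiniteField F
  open FieldProperties F

  length-elements : length elements ≡ n
  length-elements = List.length-tabulate (Inverse.from finite)

  -- At least two elements are not θ-th roots of unity. Two are required because one of them may be
  -- 0.
  ∃m∉L : ∃ λ m → m ∉ L F f × ¬ m ≈ 0#
  ∃m∉L =
    let roots , others , roots⊆ , others⊆ , roots-norm , others-norm , len = splitAll (All.universal decide elements)
    in pick others others-norm (AllPairs-resp-⊆ others⊆ elements-unique)
         (2≤others {roots} {others} (roots-of-unity-bound 0<θ (AllPairs-resp-⊆ roots⊆ elements-unique) roots-norm) len)
    where
    decide : ∀ m → RootOfUnity θ m ⊎ ¬ RootOfUnity θ m
    decide m = Dec.toSum (rootOfUnity? θ m)
    open ℕ.≤-Reasoning
    2≤others : ∀ {roots others : List Carrier} → length roots ℕ.≤ θ →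
               length elements ≡ length roots ℕ.+ length others → 2 ℕ.≤ length others
    2≤others {roots} {others} roots≤θ len = ℕ.+-cancelˡ-≤ θ 2 (length others) (begin
      θ ℕ.+ 2                         ≤⟨ ℕ.+-monoʳ-≤ θ (ℕ.+-mono-≤ 0<θ 0<θ) ⟩
      θ ℕ.+ (θ ℕ.+ θ)                 ≤⟨ ℕ.+-monoʳ-≤ θ (ℕ.+-monoʳ-≤ θ (ℕ.m≤m+n θ 0)) ⟩
      3 ℕ.* θ                         ≤⟨ ℕ.<⇒≤ 3θ<n ⟩
      n                               ≡⟨ length-elements ⟨
      length elements                 ≡⟨ len ⟩
      length roots ℕ.+ length others  ≤⟨ ℕ.+-monoˡ-≤ (length others) roots≤θ ⟩
      θ ℕ.+ length others             ∎)
    pick : ∀ ms → All (λ m → ¬ RootOfUnity θ m) ms → Unique setoid ms → 2 ℕ.≤ length ms → ∃ λ m → m ∉ L F f × ¬ m ≈ 0#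
    pick (a ∷ b ∷ _) (¬a ∷ ¬b ∷ _) ((a≉b ∷ _) ∷ _) _ with a ≟ 0#
    ... | no a≉0  = a , ¬a ∘ L⊆roots , a≉0
    ... | yes a≈0 = b , ¬b ∘ L⊆roots , λ b≈0 → a≉b (trans a≈0 (sym b≈0))
    pick (_ ∷ []) _ _ (ℕ.s≤s ())

module Recognition {c ℓ n} (F : FiniteField c ℓ n)
  {θ : ℕ} (0<θ : 0 ℕ.< θ) (3θ<n : 3 ℕ.* θ ℕ.< n) (16≤n : 16 ℕ.≤ n)
  {f g : FiniteField.Carrier F → FiniteField.Carrier F}
  (f-homo : IsRingHomomorphism (FiniteField.rawRing F) (FiniteField.rawRing F) f)
  (g-homo : IsRingHomomorphism (FiniteField.rawRing F) (FiniteField.rawRing F) g)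
  (L-f⊆roots : ∀ {m} → m ∈ L F f → FieldProperties.RootOfUnity F θ m)
  (L-g⊆roots : ∀ {m} → m ∈ L F g → FieldProperties.RootOfUnity F θ m)
  (Ψ : AdditiveCollineation F f g)
  where
  open FiniteField F
  open FieldProperties F
  open Plane F
  open AdditiveCollineation Ψ
  open Semilinear Ψ
  open SlopeCounting F 0<θ 3θ<n L-f⊆roots using (length-elements)
  open Vector using (solve; _:=_; con; _:+_; _:*_; _:-_)
  open Scalar using ()
    renaming (solve to solveₛ; _:=_ to _⊜_; con to κ; _:+_ to _⊕_; _:*_ to _⊗_; _:-_ to _⊖_; :-_ to ⊝_)
  private
    module S = Spread F f f-homo
    module T = Spread F g g-homo

  Straight Bent : Carrier → Set _
  Straight m = ∃ λ w → MapsRayOnto (1# , m) w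
  Bent m = ∃ λ m∉ → ∃₂ λ h h≉0 → ∀ v → S.Component (slope m m∉) v ⇔ T.Component (multiple h h≉0) (ψ v)

  straight : ∀ {m} (m∉ : m ∉ L F f) j → (∀ v → S.Component (slope m m∉) v ⇔ T.Component j (ψ v)) →
             ∀ w → (∀ {v} → T.Component j v → ∃ λ k → v ≈ᴹ k *ₗ w) → (∀ k → T.Component j (k *ₗ w)) → Straight m
  straight {m} m∉ j maps w ⊆ray ray⊆ = w , (λ k → ⊆ray (Equivalence.to (maps (k *ₗ (1# , m))) (k , ≈ᴹ-refl))) , backward
    where
    backward : ∀ k′ → ∃ λ k → ψ (k *ₗ (1# , m)) ≈ᴹ k′ *ₗ w
    backward k′ with v , ψv≈ ← ψ-surjective (k′ *ₗ w)
      with k , v≈ ← Equivalence.from (maps v) (T.component-resp j (≈ᴹ-sym ψv≈) (ray⊆ k′)) =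
      k , ≈ᴹ-trans (ψ-cong (≈ᴹ-sym v≈)) ψv≈

  classify : ∀ m → RootOfUnity θ m ⊎ (Bent m ⊎ Straight m)
  classify m with rootOfUnity? θ m
  ... | yes p = inj₁ p
  ... | no ¬p = inj₂ (kind (image (slope m m∉)) (image-⇔ (slope m m∉)))
    where
    m∉ : m ∉ L F f
    m∉ = ¬p ∘ L-f⊆roots
    kind : ∀ j → (∀ v → S.Component (slope m m∉) v ⇔ T.Component j (ψ v)) → Bent m ⊎ Straight m
    kind (multiple h h≉0)    maps = inj₁ (m∉ , h , h≉0 , maps)
    kind j@(slope m′ _) maps = inj₂ (straight m∉ j maps (1# , m′) (λ v∈ → v∈) (λ k → k , ≈ᴹ-refl))
    kind vertical            maps = inj₂ (straight m∉ vertical maps (0# , 1#)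
      (λ (k , x≈0 , y≈k) → k , trans x≈0 (sym (zeroʳ k)) , trans y≈k (sym (*-identityʳ k)))
      (λ k → k , zeroʳ k , *-identityʳ k))

  -- The multiple h U is determined by the ratio g h / h, which lies in L g.
  bent-ratio : ∀ {m} → Bent m → Carrier
  bent-ratio (_ , h , h≉0 , _) = g h * inverse h h≉0

  -- Equal ratios mean equal multiples of U′, so the image of (1 , m) also lies in the image of the
  -- ray of slope m′; pulling back puts (1 , m) on that ray.
  bent-ratio-injective : ∀ {m m′} (bent : Bent m) (bent′ : Bent m′) → bent-ratio bent ≈ bent-ratio bent′ → m ≈ m′
  bent-ratio-injective {m} {m′} (m∉ , h , h≉0 , maps) (m′∉ , h′ , h′≉0 , maps′) eq =
    let k , 1≈k , m≈km′ = Equivalence.from (maps′ (1# , m)) (T.multiple-same h≉0 h′≉0 same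
          (Equivalence.to (maps (1# , m)) (1# , sym (*-identityʳ 1#) , sym (*-identityˡ m))))
    in trans m≈km′ (trans (*-congʳ (trans (sym (*-identityʳ k)) (sym 1≈k))) (*-identityˡ m′))
    where
    open SetoidReasoning setoid
    same : g h * h′ ≈ g h′ * h
    same = begin
      g h * h′                              ≈⟨ *-congʳ (x/y*y≈x h≉0) ⟨
      g h * inverse h h≉0 * h * h′          ≈⟨ *-congʳ (*-congʳ eq) ⟩
      g h′ * inverse h′ h′≉0 * h * h′
        ≈⟨ solveₛ 3 (λ a b c → a ⊗ b ⊗ c ⊜ a ⊗ c ⊗ b) refl (g h′ * inverse h′ h′≉0) h h′ ⟩
      g h′ * inverse h′ h′≉0 * h′ * h       ≈⟨ *-congʳ (x/y*y≈x h′≉0) ⟩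
      g h′ * h                              ∎

  -- Both exceptional classes are bounded by the number of θ-th roots of unity: the first directly,
  -- the bent slopes through the injection `bent-ratio` into `L` of g.
  straight-slopes : ∃ λ ms → Unique setoid ms × All Straight ms × n ℕ.≤ θ ℕ.+ (θ ℕ.+ length ms)
  straight-slopes
    with roots , others , roots⊆ , others⊆ , roots-norm , others-kind , len ← splitAll (All.universal classify elements)
    with bents , straights , bents⊆ , straights⊆ , bents-bent , all-straight , len′ ← splitAll others-kind =
    straights , AllPairs-resp-⊆ straights⊆ others! , all-straight , (begin
      n                                                            ≡⟨ length-elements ⟨
      length elements                                              ≡⟨ len ⟩
      length roots ℕ.+ length others                               ≡⟨ ≡.cong (length roots ℕ.+_) len′ ⟩
      length roots ℕ.+ (length bents ℕ.+ length straights)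
        ≤⟨ ℕ.+-mono-≤ roots≤θ (ℕ.+-monoˡ-≤ (length straights) bents≤θ) ⟩
      θ ℕ.+ (θ ℕ.+ length straights)                               ∎)
    where
    open ℕ.≤-Reasoning
    others! : Unique setoid others
    others! = AllPairs-resp-⊆ others⊆ elements-unique
    roots≤θ : length roots ℕ.≤ θ
    roots≤θ = roots-of-unity-bound 0<θ (AllPairs-resp-⊆ roots⊆ elements-unique) roots-norm
    bents≤θ : length bents ℕ.≤ θ
    bents≤θ = ≡.subst (ℕ._≤ θ) (length-reduce bent-ratio bents-bent)
      (roots-of-unity-bound 0<θ
        (reduce-unique setoid setoid bent-ratio bent-ratio-injective (AllPairs-resp-⊆ bents⊆ others!) bents-bent)
        (All-reduce bent-ratio (λ (_ , h , h≉0 , _) → L-g⊆roots (h , h≉0 , refl)) bents-bent))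

  -- In terms of μ = 1 / (m - m₀), the slope m is spanned by μ (1 , m₀) + (0 , 1).
  module Projectivity (m₀ : Carrier) (straight₀ : Straight m₀) where
    e₀ e₁ : Carrierᴹ
    e₀ = 1# , m₀
    e₁ = 0# , 1#

    Finite : Carrier → Set _
    Finite m = Straight m × ¬ m₀ ≈ m

    μ : ∀ {m} → Finite m → Carrier
    μ {m} (_ , m₀≉m) = inverse (m - m₀) (x-y≉0 (m₀≉m ∘ sym))

    μ-slope : ∀ {m} (fin : Finite m) → μ fin *ₗ e₀ +ᴹ e₁ ≈ᴹ μ fin *ₗ (1# , m)
    μ-slope {m} fin@(_ , m₀≉m) = +-identityʳ _ , (begin
      μ fin * m₀ + 1#                    ≈⟨ +-congˡ (inverseˡ (x-y≉0 (m₀≉m ∘ sym))) ⟨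
      μ fin * m₀ + μ fin * (m - m₀)
        ≈⟨ solveₛ 3 (λ μ m m₀ → μ ⊗ m₀ ⊕ μ ⊗ (m ⊖ m₀) ⊜ μ ⊗ m) refl (μ fin) m m₀ ⟩
      μ fin * m                          ∎)
      where open SetoidReasoning setoid

    μ-injective : ∀ {m m′} (fin : Finite m) (fin′ : Finite m′) → μ fin ≈ μ fin′ → m ≈ m′
    μ-injective {m} {m′} fin@(_ , m₀≉m) fin′@(_ , m₀≉m′) eq = begin
      m              ≈⟨ solveₛ 2 (λ m m₀ → m ⊜ (m ⊖ m₀) ⊕ m₀) refl m m₀ ⟩
      m - m₀ + m₀    ≈⟨ +-congʳ (*-cancelˡ-≉0 (inverse≉0 (x-y≉0 (m₀≉m ∘ sym))) (begin
        μ fin * (m - m₀)     ≈⟨ inverseˡ (x-y≉0 (m₀≉m ∘ sym)) ⟩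
        1#                   ≈⟨ inverseˡ (x-y≉0 (m₀≉m′ ∘ sym)) ⟨
        μ fin′ * (m′ - m₀)   ≈⟨ *-congʳ eq ⟨
        μ fin * (m′ - m₀)    ∎)) ⟩
      m′ - m₀ + m₀   ≈⟨ solveₛ 2 (λ m m₀ → m ⊜ (m ⊖ m₀) ⊕ m₀) refl m′ m₀ ⟨
      m′             ∎
      where open SetoidReasoning setoid

    module _ {m₁ m₂} (fin₁ : Finite m₁) (fin₂ : Finite m₂) (m₁≉m₂ : ¬ m₁ ≈ m₂) where
      private
        μ₁ = μ fin₁
        μ₂ = μ fin₂
        -- The factor δ makes u₀ + u₁ equal to μ₂ e₀ + e₁, so the third ray of the frame is that of
        -- the slope m₂.
        δ  = μ₂ - μ₁
        u₀ = δ *ₗ e₀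
        u₁ = μ₁ *ₗ e₀ +ᴹ e₁

      δ≉0 : ¬ δ ≈ 0#
      δ≉0 = x-y≉0 (λ μ₂≈μ₁ → m₁≉m₂ (sym (μ-injective fin₂ fin₁ μ₂≈μ₁)))

      span : ∀ v → ∃₂ λ x y → v ≈ᴹ x *ₗ u₀ +ᴹ y *ₗ u₁
      span (a , b) = x , y , first , second
        where
        open SetoidReasoning setoid
        -- Since (a , b) = a e₀ + (b - a m₀) e₁ and only u₁ involves e₁, this is the coefficient of
        -- u₁; the equation x δ + y μ₁ = a then determines x.
        y = b - a * m₀
        x = (a - y * μ₁) * inverse δ δ≉0
        xδ≈ : x * δ ≈ a - y * μ₁
        xδ≈ = x/y*y≈x δ≉0
        first : a ≈ x * (δ * 1#) + y * (μ₁ * 1# + 0#)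
        first = begin
          a                                       ≈⟨ solveₛ 2 (λ a c → a ⊜ a ⊖ c ⊕ c) refl a (y * μ₁) ⟩
          a - y * μ₁ + y * μ₁                     ≈⟨ +-congʳ xδ≈ ⟨
          x * δ + y * μ₁
            ≈⟨ solveₛ 4 (λ x d y μ → x ⊗ d ⊕ y ⊗ μ ⊜ x ⊗ (d ⊗ κ (ℤ.+ 1)) ⊕ y ⊗ (μ ⊗ κ (ℤ.+ 1) ⊕ κ (ℤ.+ 0)))
                 refl x δ y μ₁ ⟩
          x * (δ * 1#) + y * (μ₁ * 1# + 0#)       ∎
        second : b ≈ x * (δ * m₀) + y * (μ₁ * m₀ + 1#)
        second = begin
          b
            ≈⟨ solveₛ 4 (λ a b m c → b ⊜ (a ⊖ c) ⊗ m ⊕ (c ⊗ m ⊕ (b ⊖ a ⊗ m))) refl a b m₀ (y * μ₁) ⟩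
          (a - y * μ₁) * m₀ + (y * μ₁ * m₀ + y)   ≈⟨ +-congʳ (*-congʳ xδ≈) ⟨
          x * δ * m₀ + (y * μ₁ * m₀ + y)
            ≈⟨ solveₛ 5 (λ x d y μ m → x ⊗ d ⊗ m ⊕ (y ⊗ μ ⊗ m ⊕ y) ⊜ x ⊗ (d ⊗ m) ⊕ y ⊗ (μ ⊗ m ⊕ κ (ℤ.+ 1)))
                 refl x δ y μ₁ m₀ ⟩
          x * (δ * m₀) + y * (μ₁ * m₀ + 1#)       ∎

      independent : ∀ x y → x *ₗ u₀ +ᴹ y *ₗ u₁ ≈ᴹ 0ᴹ → x ≈ 0# × y ≈ 0#
      independent x y (eq₁ , eq₂) = x≈0 , y≈0
        where
        open SetoidReasoning setoid
        y≈0 : y ≈ 0#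
        y≈0 = begin
          y
            ≈⟨ solveₛ 5 (λ x d y μ m → y ⊜ (x ⊗ (d ⊗ m) ⊕ y ⊗ (μ ⊗ m ⊕ κ (ℤ.+ 1)))
                   ⊖ (x ⊗ (d ⊗ κ (ℤ.+ 1)) ⊕ y ⊗ (μ ⊗ κ (ℤ.+ 1) ⊕ κ (ℤ.+ 0))) ⊗ m) refl x δ y μ₁ m₀ ⟩
          (x * (δ * m₀) + y * (μ₁ * m₀ + 1#)) - (x * (δ * 1#) + y * (μ₁ * 1# + 0#)) * m₀
            ≈⟨ +-cong eq₂ (-‿cong (*-congʳ eq₁)) ⟩
          0# - 0# * m₀  ≈⟨ solveₛ 1 (λ m → κ (ℤ.+ 0) ⊖ κ (ℤ.+ 0) ⊗ m ⊜ κ (ℤ.+ 0)) refl m₀ ⟩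
          0#         ∎
        x≈0 : x ≈ 0#
        x≈0 = xy≈0⇒y≈0 δ≉0 (begin
          δ * x
            ≈⟨ solveₛ 4 (λ x d y μ → d ⊗ x ⊜ (x ⊗ (d ⊗ κ (ℤ.+ 1)) ⊕ y ⊗ (μ ⊗ κ (ℤ.+ 1) ⊕ κ (ℤ.+ 0))) ⊖ y ⊗ μ)
                 refl x δ y μ₁ ⟩
          (x * (δ * 1#) + y * (μ₁ * 1# + 0#)) - y * μ₁   ≈⟨ +-cong eq₁ (-‿cong (*-congʳ y≈0)) ⟩
          0# - 0# * μ₁  ≈⟨ solveₛ 1 (λ m → κ (ℤ.+ 0) ⊖ κ (ℤ.+ 0) ⊗ m ⊜ κ (ℤ.+ 0)) refl μ₁ ⟩
          0#         ∎)

      finite-ray : ∀ {m u} (fin : Finite m) → u ≈ᴹ μ fin *ₗ e₀ +ᴹ e₁ → PreservesRay u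
      finite-ray {m} fin@((w , maps) , m₀≉m) u≈ = mapsRayOnto⇒preservesRay {a = μ fin} maps u≈μ[1,m]
        (λ (u₁≈0 , _) → inverse≉0 (x-y≉0 (m₀≉m ∘ sym)) (trans (sym (*-identityʳ _)) (trans (sym (proj₁ u≈μ[1,m])) u₁≈0)))
        where
        u≈μ[1,m] = ≈ᴹ-trans u≈ (μ-slope fin)

      ray₀ : PreservesRay u₀
      ray₀ = mapsRayOnto⇒preservesRay {a = δ} (proj₂ straight₀) ≈ᴹ-refl
        (λ (δ1≈0 , _) → δ≉0 (trans (sym (*-identityʳ δ)) δ1≈0))

      open Frame u₀ u₁ span independent ray₀ (finite-ray fin₁ ≈ᴹ-refl)
        (finite-ray fin₂ (solve 4 (λ a b u v → (b :- a) :* u :+ (a :* u :+ v) := b :* u :+ v)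
             ≈ᴹ-refl ⟪ μ₁ ⟫ ⟪ μ₂ ⟫ e₀ e₁))

      -- The coordinate of m on the projective line in which m₀, m₁ and m₂ become infinity, 0 and 1.
      -- It is the x for which x u₀ + u₁ spans the ray of slope m.
      cross-ratio : ∀ {m} → Finite m → Carrier
      cross-ratio fin = (μ fin - μ₁) * inverse δ δ≉0

      cross-ratio-multiplicative : ∀ {m} (fin : Finite m) → Multiplicative (cross-ratio fin)
      cross-ratio-multiplicative fin = ray⇒multiplicative (finite-ray fin (begin
        cross-ratio fin *ₗ (δ *ₗ e₀) +ᴹ u₁      ≈⟨ +ᴹ-congʳ (≈ᴹ-sym (*ₗ-assoc (cross-ratio fin) δ e₀)) ⟩
        (cross-ratio fin * δ) *ₗ e₀ +ᴹ u₁       ≈⟨ +ᴹ-congʳ (*ₗ-congʳ (x/y*y≈x δ≉0)) ⟩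
        (μ fin - μ₁) *ₗ e₀ +ᴹ u₁
          ≈⟨ solve 4 (λ a b u v → (b :- a) :* u :+ (a :* u :+ v) := b :* u :+ v)
               ≈ᴹ-refl ⟪ μ₁ ⟫ ⟪ μ fin ⟫ e₀ e₁ ⟩
        μ fin *ₗ e₀ +ᴹ e₁                       ∎))
        where open SetoidReasoning ≈ᴹ-setoid

      cross-ratio-injective : ∀ {m m′} (fin : Finite m) (fin′ : Finite m′) → cross-ratio fin ≈ cross-ratio fin′ → m ≈ m′
      cross-ratio-injective fin fin′ eq = μ-injective fin fin′ (begin
        μ fin                  ≈⟨ solveₛ 2 (λ a b → a ⊜ a ⊖ b ⊕ b) refl (μ fin) μ₁ ⟩
        μ fin - μ₁ + μ₁        ≈⟨ +-congʳ (*-cancelʳ-≉0 (inverse≉0 δ≉0) eq) ⟩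
        μ fin′ - μ₁ + μ₁       ≈⟨ solveₛ 2 (λ a b → a ⊜ a ⊖ b ⊕ b) refl (μ fin′) μ₁ ⟨
        μ fin′                 ∎)
        where open SetoidReasoning setoid

      many-finite⇒semilinear : ∀ {ms} → Unique setoid ms → All Finite ms →
                               n ℕ.< length ms ℕ.* length ms → Semilinearity Ψ
      many-finite⇒semilinear {ms} ms! fins n<r² = record
        { σ = σ ; σ-cong = σ-cong ; σ-1 = σ-1 ; σ-* = λ x y → mult y x ; σ-surjective = σ-surjective
        ; ψ-*ₗ = multiplicative⇒semilinear mult
        }
        where
        mult : ∀ z → Multiplicative z
        mult = many-multiplicative⇒all
          (reduce-unique setoid setoid cross-ratio cross-ratio-injective ms! fins)
          (All-reduce cross-ratio cross-ratio-multiplicative fins)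
          (≡.subst (λ r → n ℕ.< r ℕ.* r) (≡.sym (length-reduce cross-ratio fins)) n<r²)

  ψ-semilinear : Semilinearity Ψ
  ψ-semilinear with ms , ms! , straights , n≤ ← straight-slopes
    with r , len , n<r² ← n<[g-1]² {θ = θ} n≤ 3θ<n 16≤n = conclude ms ms! straights len
    where
    conclude : ∀ ms → Unique setoid ms → All Straight ms → length ms ≡ 6 ℕ.+ r → Semilinearity Ψ
    -- Only m₀ leaves the count: m₁ and m₂ have cross ratios 0 and 1 and still contribute
    -- multiplicative elements.
    conclude (m₀ ∷ ms@(m₁ ∷ m₂ ∷ _)) (m₀≉ms ∷ ms!@((m₁≉m₂ ∷ _) ∷ _)) (straight₀ ∷ straights) len
      with fins@(fin₁ ∷ fin₂ ∷ _) ← All.zip (straights , m₀≉ms) =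
      Projectivity.many-finite⇒semilinear m₀ straight₀ fin₁ fin₂ m₁≉m₂ ms! fins
        (≡.subst (λ r → n ℕ.< r ℕ.* r) (≡.sym (ℕ.suc-injective len)) n<r²)

-- Semilinear maps and the image of U.

module FrobeniusPlanes {c ℓ} (q t s s′ : ℕ) .{{_ : ℕ.NonZero t}} (q-primePower : IsPrimePower q) (1<q : 1 ℕ.< q)
  (F : FiniteField c ℓ (q ℕ.^ t))
  (Ψ : AdditiveCollineation F (frobeniusPower F q s) (frobeniusPower F q s′)) (semilinearity : Semilinearity Ψ)
  (s%t≢0 : ¬ s % t ≡ 0)
  where
  open FiniteField F hiding (zero)
  open FrobeniusPowers q t q-primePower F
  open FieldProperties F
  open Plane F
  open Scalar using ()
    renaming (solve to solveₛ; _:=_ to _⊜_; con to κ; _:+_ to _⊕_; _:*_ to _⊗_; _:-_ to _⊖_; :-_ to ⊝_)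
  open AdditiveCollineation Ψ
  open Semilinearity semilinearity
  open CommutativeExp commutativeSemiring using (_^_)
  open IsRingHomomorphism (frob-isRingHomomorphism s) using () renaming (1#-homo to f-1)
  open IsRingHomomorphism (frob-isRingHomomorphism s′) using ()
    renaming (⟦⟧-cong to g-cong; +-homo to g-+; *-homo to g-*)
  private
    f g : Carrier → Carrier
    f = frob s
    g = frob s′
    module S = Spread F f (frob-isRingHomomorphism s)
    module T = Spread F g (frob-isRingHomomorphism s′)

    Graph : SpreadIndex F f
    Graph = multiple 1# 1≉0

    graph∋ : ∀ x → S.Component Graph (x , f x)
    graph∋ x = (x , f x) , (x , ≈ᴹ-refl) , sym (*-identityˡ x) , sym (*-identityˡ (f x))

  0<t : 0 ℕ.< t
  0<t = ℕ.>-nonZero⁻¹ t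

  -- With the exponent reduced modulo t, f and the identity are different monomials of degree below
  -- q^t; the remaining two terms are filled with coefficient 0.
  f-nonidentity : ¬ (∀ x → f x ≈ x)
  f-nonidentity f≈id = 1≉0 (frob-independent 1<q {1#} { - 1#} {0#} {0#} (m%n<n s t) 0<t 0<t 0<t
    (s%t≢0 ∘ ≡.sym) (s%t≢0 ∘ ≡.sym) (s%t≢0 ∘ ≡.sym) λ x → begin
      1# * frob (s % t) x + (- 1# * frob 0 x + (0# * frob 0 x + 0# * frob 0 x))
        ≈⟨ +-cong (*-congˡ (trans (sym (frob-% s x)) (f≈id x)))
             (+-cong (*-congˡ (*-identityʳ x)) (+-cong (*-congˡ (*-identityʳ x)) (*-congˡ (*-identityʳ x)))) ⟩
      1# * x + (- 1# * x + (0# * x + 0# * x))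
        ≈⟨ solveₛ 1 (λ x → κ (ℤ.+ 1) ⊗ x ⊕ (⊝ κ (ℤ.+ 1) ⊗ x ⊕
             (κ (ℤ.+ 0) ⊗ x ⊕ κ (ℤ.+ 0) ⊗ x)) ⊜ κ (ℤ.+ 0)) refl x ⟩
      0# ∎)
    where open SetoidReasoning setoid

  -- For semilinear ψ every vector of the image ray is already the image of a multiple of (1 , f 1)
  -- = (1 , 1). By injectivity each (x , f x) would be such a multiple, making f the identity.
  graph-image-not-ray : ∀ w → ¬ (∀ x → ∃ λ k → ψ (x , f x) ≈ᴹ k *ₗ w)
  graph-image-not-ray w ray = f-nonidentity fixed
    where
    k₁ = proj₁ (ray 1#)
    ψ11≈ = proj₂ (ray 1#)
    k₁≉0 : ¬ k₁ ≈ 0#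
    k₁≉0 k₁≈0 = 1≉0 (proj₁ (ψ-injective (begin
      ψ (1# , f 1#)   ≈⟨ ψ11≈ ⟩
      k₁ *ₗ w         ≈⟨ *ₗ-congʳ k₁≈0 ⟩
      0# *ₗ w         ≈⟨ zeroˡ _ , zeroˡ _ ⟩
      0ᴹ              ≈⟨ ψ-0 ⟨
      ψ 0ᴹ            ∎)))
      where open SetoidReasoning ≈ᴹ-setoid
    fixed : ∀ x → f x ≈ x
    fixed x =
      let k , ψx≈ = ray x
          l , σl≈k/k₁ = σ-surjective (k * inverse k₁ k₁≉0)
          l1≈x , lf1≈fx = ψ-injective {l *ₗ (1# , f 1#)} {x , f x} (begin
            ψ (l *ₗ (1# , f 1#))                  ≈⟨ ψ-*ₗ l (1# , f 1#) ⟩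
            σ l *ₗ ψ (1# , f 1#)                  ≈⟨ *ₗ-cong σl≈k/k₁ ψ11≈ ⟩
            (k * inverse k₁ k₁≉0) *ₗ (k₁ *ₗ w)    ≈⟨ sym (*-assoc _ _ _) , sym (*-assoc _ _ _) ⟩
            (k * inverse k₁ k₁≉0 * k₁) *ₗ w       ≈⟨ *ₗ-congʳ (x/y*y≈x k₁≉0) ⟩
            k *ₗ w                                ≈⟨ ψx≈ ⟨
            ψ (x , f x)                           ∎)
      in trans (sym lf1≈fx) (trans (*-congˡ f-1) l1≈x)
      where open SetoidReasoning ≈ᴹ-setoid

  -- Hence σ commutes with f. Taking σ x as the variable therefore removes σ from the condition on
  -- the image of U and leaves a polynomial identity.
  σ-^ : ∀ x k → σ (x ^ k) ≈ σ x ^ k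
  σ-^ x zero    = σ-1
  σ-^ x (suc k) = trans (σ-* x (x ^ k)) (*-congˡ (σ-^ x k))

  private
    a₁ b₁ a₂ b₂ : Carrier
    a₁ = proj₁ (ψ (1# , 0#))
    b₁ = proj₁ (ψ (0# , 1#))
    a₂ = proj₂ (ψ (1# , 0#))
    b₂ = proj₂ (ψ (0# , 1#))

  ψ-matrix : ∀ x y → ψ (x , y) ≈ᴹ (σ x * a₁ + σ y * b₁ , σ x * a₂ + σ y * b₂)
  ψ-matrix x y = begin
    ψ (x , y)                                        ≈⟨ ψ-cong (
      solveₛ 2 (λ x y → x ⊜ x ⊗ κ (ℤ.+ 1) ⊕ y ⊗ κ (ℤ.+ 0)) refl x y ,
      solveₛ 2 (λ x y → y ⊜ x ⊗ κ (ℤ.+ 0) ⊕ y ⊗ κ (ℤ.+ 1)) refl x y) ⟩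
    ψ (x *ₗ (1# , 0#) +ᴹ y *ₗ (0# , 1#))             ≈⟨ ψ-+ _ _ ⟩
    ψ (x *ₗ (1# , 0#)) +ᴹ ψ (y *ₗ (0# , 1#))         ≈⟨ +ᴹ-cong (ψ-*ₗ x _) (ψ-*ₗ y _) ⟩
    σ x *ₗ ψ (1# , 0#) +ᴹ σ y *ₗ ψ (0# , 1#)         ∎
    where open SetoidReasoning ≈ᴹ-setoid

  -- Applying g to the first coordinate of h (z , g z) and comparing with the second.
  graph-image-identity : ∀ {h} → (∀ x → ∃ λ z → ψ (x , f x) ≈ᴹ h *ₗ (z , g z)) →
    ∀ X → (g h * a₂) * X + ((g h * b₂) * f X + (- (h * g a₁) * g X + - (h * g b₁) * g (f X))) ≈ 0#
  graph-image-identity {h} graph X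
    with x , σx≈X ← σ-surjective X
    with z , first , second ← graph x = begin
    (g h * a₂) * X + ((g h * b₂) * f X + (- (h * g a₁) * g X + - (h * g b₁) * g (f X)))
      ≈⟨ expand (g h) a₂ X b₂ (f X) h (g a₁) (g X) (g b₁) (g (f X)) ⟩
    g h * (X * a₂ + f X * b₂) - h * (g X * g a₁ + g (f X) * g b₁)
      ≈⟨ +-cong (*-congˡ (trans (coordinate a₂ b₂) (trans (sym (proj₂ (ψ-matrix x (f x)))) second)))
           (-‿cong (*-congˡ (trans (sym (+-cong (g-* X a₁) (g-* (f X) b₁))) (trans (sym (g-+ (X * a₁) (f X * b₁)))
             (trans (g-cong (trans (coordinate a₁ b₁) (trans (sym (proj₁ (ψ-matrix x (f x)))) first))) (g-* h z)))))) ⟩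
    g h * (h * g z) - h * (g h * g z)
      ≈⟨ solveₛ 3 (λ a b c → a ⊗ (b ⊗ c) ⊖ b ⊗ (a ⊗ c) ⊜ κ (ℤ.+ 0)) refl (g h) h (g z) ⟩
    0# ∎
    where
    open SetoidReasoning setoid
    σfx≈fX : σ (f x) ≈ f X
    σfx≈fX = trans (σ-^ x (q ℕ.^ s)) (f-cong σx≈X)
      where open IsRingHomomorphism (frob-isRingHomomorphism s) using () renaming (⟦⟧-cong to f-cong)
    coordinate : ∀ a b → X * a + f X * b ≈ σ x * a + σ (f x) * b
    coordinate a b = sym (+-cong (*-congʳ σx≈X) (*-congʳ σfx≈fX))
    expand : ∀ gh a₂ X b₂ fX h ga₁ gX gb₁ gfX →
      (gh * a₂) * X + ((gh * b₂) * fX + (- (h * ga₁) * gX + - (h * gb₁) * gfX))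
      ≈ gh * (X * a₂ + fX * b₂) - h * (gX * ga₁ + gfX * gb₁)
    expand = solveₛ 10 (λ gh a₂ X b₂ fX h ga₁ gX gb₁ gfX →
      (gh ⊗ a₂) ⊗ X ⊕ ((gh ⊗ b₂) ⊗ fX ⊕ (⊝ (h ⊗ ga₁) ⊗ gX ⊕ ⊝ (h ⊗ gb₁) ⊗ gfX))
      ⊜ gh ⊗ (X ⊗ a₂ ⊕ fX ⊗ b₂) ⊖ h ⊗ (gX ⊗ ga₁ ⊕ gfX ⊗ gb₁)) refl

  module _ (s′%t≢0 : ¬ s′ % t ≡ 0) ([s+s′]%t≢0 : ¬ (s ℕ.+ s′) % t ≡ 0)
           (s′%t≢s%t : ¬ s′ % t ≡ s % t) ([s+s′]%t≢s%t : ¬ (s ℕ.+ s′) % t ≡ s % t) where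

    -- The coefficients at the exponents 0 and s are the entries of the second row of the matrix of
    -- ψ times g h. If both vanish, so does every second coordinate of ψ, and (0 , 1) has no
    -- preimage.
    graph-image-not-multiple : ∀ {h} → ¬ h ≈ 0# → ¬ (∀ x → ∃ λ z → ψ (x , f x) ≈ᴹ h *ₗ (z , g z))
    graph-image-not-multiple {h} h≉0 graph =
      let v , ψv≈ = ψ-surjective (0# , 1#) in
      1≉0 (begin
        1#                                               ≈⟨ proj₂ ψv≈ ⟨
        proj₂ (ψ v)                                      ≈⟨ proj₂ (ψ-matrix (proj₁ v) (proj₂ v)) ⟩
        σ (proj₁ v) * a₂ + σ (proj₂ v) * b₂              ≈⟨ +-cong (*-congˡ a₂≈0) (*-congˡ b₂≈0) ⟩
        σ (proj₁ v) * 0# + σ (proj₂ v) * 0#              ≈⟨ +-cong (zeroʳ _) (zeroʳ _) ⟩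
        0# + 0#                                          ≈⟨ +-identityˡ 0# ⟩
        0#                                               ∎)
      where
      open SetoidReasoning setoid
      α β γ δ : Carrier
      α  = g h * a₂
      β  = g h * b₂
      γ = - (h * g a₁)
      δ  = - (h * g b₁)
      -- Independence holds for exponents below t, so the identity is first rewritten with residues.
      reduced : ∀ X → α * frob 0 X + (β * frob (s % t) X + (γ * frob (s′ % t) X + δ * frob ((s ℕ.+ s′) % t) X)) ≈ 0#
      reduced X = begin
        α * frob 0 X + (β * frob (s % t) X + (γ * frob (s′ % t) X + δ * frob ((s ℕ.+ s′) % t) X))
          ≈⟨ +-cong (*-congˡ (*-identityʳ X)) (+-cong (*-congˡ (sym (frob-% s X))) (+-cong (*-congˡ (sym (frob-% s′ X)))
               (*-congˡ (trans (sym (frob-% (s ℕ.+ s′) X)) (sym (frob-∘ s s′ X)))))) ⟩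
        α * X + (β * f X + (γ * g X + δ * g (f X)))
          ≈⟨ graph-image-identity graph X ⟩
        0# ∎
      a₂≈0 : a₂ ≈ 0#
      a₂≈0 = xy≈0⇒y≈0 (T.f≉0 h≉0) (frob-independent 1<q {α} {β} {γ} {δ} 0<t (m%n<n s t) (m%n<n s′ t) (m%n<n (s ℕ.+ s′) t)
        s%t≢0 s′%t≢0 [s+s′]%t≢0 reduced)
      b₂≈0 : b₂ ≈ 0#
      b₂≈0 = xy≈0⇒y≈0 (T.f≉0 h≉0) (frob-independent 1<q {β} {α} {γ} {δ} (m%n<n s t) 0<t (m%n<n s′ t) (m%n<n (s ℕ.+ s′) t)
        (s%t≢0 ∘ ≡.sym) s′%t≢s%t [s+s′]%t≢s%t λ X → trans
          (solveₛ 3 (λ b a c → b ⊕ (a ⊕ c) ⊜ a ⊕ (b ⊕ c)) refl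
            (β * frob (s % t) X) (α * frob 0 X) (γ * frob (s′ % t) X + δ * frob ((s ℕ.+ s′) % t) X))
          (reduced X))

    no-semilinear-collineation : ⊥
    no-semilinear-collineation = impossible (image Graph) (λ x → Equivalence.to (image-⇔ Graph (x , f x)) (graph∋ x))
      where
      impossible : ∀ j → (∀ x → T.Component j (ψ (x , f x))) → ⊥
      impossible (slope m _) ray = graph-image-not-ray (1# , m) ray
      impossible (multiple h h≉0) graph = graph-image-not-multiple h≉0 (T.∈⇒param (multiple h h≉0) ∘ graph)
      impossible vertical ray = graph-image-not-ray (0# , 1#) λ x →
        let y , first , second = ray x in y , trans first (sym (zeroʳ y)) , trans second (sym (*-identityʳ y))

-- Congruences, numerical hypotheses and the theorem.

open import Data.Integer.Base using (+_; -_)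
open import Data.Nat.Base using (_^_)

module _ {t} .{{_ : ℕ.NonZero t}} where

  %≡%⇒∣∸ : ∀ m n → m % t ≡ n % t → t ℕ.∣ n ℕ.∸ m
  %≡%⇒∣∸ m n eq = ℕ.divides (n / t ℕ.∸ m / t) (begin
    n ℕ.∸ m
      ≡⟨ ≡.cong₂ ℕ._∸_ (m≡m%n+[m/n]*n n t) (m≡m%n+[m/n]*n m t) ⟩
    (n % t ℕ.+ n / t ℕ.* t) ℕ.∸ (m % t ℕ.+ m / t ℕ.* t)
      ≡⟨ ≡.cong (λ r → (n % t ℕ.+ n / t ℕ.* t) ℕ.∸ (r ℕ.+ m / t ℕ.* t)) eq ⟩
    (n % t ℕ.+ n / t ℕ.* t) ℕ.∸ (n % t ℕ.+ m / t ℕ.* t)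
      ≡⟨ ℕ.[m+n]∸[m+o]≡n∸o (n % t) (n / t ℕ.* t) (m / t ℕ.* t) ⟩
    n / t ℕ.* t ℕ.∸ m / t ℕ.* t                               ≡⟨ ℕ.*-distribʳ-∸ t (n / t) (m / t) ⟨
    (n / t ℕ.∸ m / t) ℕ.* t                                   ∎)
    where open ≡.≡-Reasoning

  ∣∸⇒%≡% : ∀ {m n} → m ℕ.≤ n → t ℕ.∣ n ℕ.∸ m → m % t ≡ n % t
  ∣∸⇒%≡% {m} {n} m≤n (ℕ.divides k n∸m≡kt) = begin
    m % t                     ≡⟨ [m+kn]%n≡m%n m k t ⟨
    (m ℕ.+ k ℕ.* t) % t       ≡⟨ ≡.cong (λ d → (m ℕ.+ d) % t) n∸m≡kt ⟨
    (m ℕ.+ (n ℕ.∸ m)) % t     ≡⟨ ≡.cong (_% t) (ℕ.m+[n∸m]≡n m≤n) ⟩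
    n % t                     ∎
    where open ≡.≡-Reasoning

  -- Divisibility of integers concerns the absolute value of the difference, which is a truncated
  -- difference once the larger of the two numbers is known.
  ≡[mod]⇔%≡% : ∀ m n → (+ m) ≡ (+ n) [mod t ] ⇔ (m % t ≡ n % t)
  ≡[mod]⇔%≡% m n rewrite ℤ.m-n≡m⊖n m n with ℕ.≤-total m n
  ... | inj₁ m≤n rewrite ℤ.∣⊖∣-≤ m≤n = mk⇔ (∣∸⇒%≡% m≤n) (%≡%⇒∣∸ m n)
  ... | inj₂ n≤m rewrite ℤ.∣m⊖n∣≡∣n⊖m∣ m n | ℤ.∣⊖∣-≤ n≤m = mk⇔ (≡.sym ∘ ∣∸⇒%≡% n≤m) (%≡%⇒∣∸ n m ∘ ≡.sym)

  ≡-[mod]⇔∣+ : ∀ m n → (+ m) ≡ (- (+ n)) [mod t ] ⇔ (t ℕ.∣ m ℕ.+ n)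
  ≡-[mod]⇔∣+ m n rewrite ℤ.neg-involutive (+ n) = mk⇔ (λ t∣ → t∣) (λ t∣ → t∣)

coprime⇒%≢0 : ∀ {s t} .{{_ : ℕ.NonZero t}} → 1 < t → gcd s t ≡ 1 → ¬ s % t ≡ 0
coprime⇒%≢0 {s} {t} 1<t gcd≡1 s%t≡0 =
  ℕ.>⇒≢ 1<t (ℕ.∣1⇒≡1 (≡.subst (t ℕ.∣_) gcd≡1 (ℕ.gcd-greatest (ℕ.m%n≡0⇒n∣m s t s%t≡0) ℕ.∣-refl)))

0<geometricSum : ∀ q t .{{_ : ℕ.NonZero t}} → 0 < geometricSum q t
0<geometricSum q (suc t) = ℕ.z<s

-- The bound 4 ≤ q enters here: 4 θ + 1 ≤ q θ + 1 = θ + q^t, and one θ cancels.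
3*geometricSum<q^t : ∀ {q} → 3 < q → ∀ t → 3 ℕ.* geometricSum q t < q ^ t
3*geometricSum<q^t {q} 3<q t = ℕ.+-cancelˡ-≤ θ _ _ (begin
  θ ℕ.+ suc (3 ℕ.* θ)     ≡⟨ rearrange θ ⟩
  4 ℕ.* θ ℕ.+ 1           ≤⟨ ℕ.+-monoˡ-≤ 1 (ℕ.*-monoˡ-≤ θ 3<q) ⟩
  q ℕ.* θ ℕ.+ 1           ≡⟨ geometricSum-identity q t ⟩
  θ ℕ.+ q ^ t             ∎)
  where
  open ℕ.≤-Reasoning
  θ = geometricSum q t
  rearrange : ∀ θ → θ ℕ.+ suc (3 ℕ.* θ) ≡ 4 ℕ.* θ ℕ.+ 1
  rearrange = solve-∀

16≤q^t : ∀ {q t} → 3 < q → 1 < t → 16 ℕ.≤ q ^ t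
16≤q^t {q} {t} 3<q 1<t = ℕ.≤-trans (ℕ.^-monoˡ-≤ 2 3<q) (ℕ.^-monoʳ-≤ q {{ℕ.>-nonZero (ℕ.<-trans ℕ.z<s 3<q)}} 1<t)

theorem4p7 : ∀ {c ℓ} (q t s s′ : ℕ) →
    IsPrimePower q → 3 < q → 1 < t →
    0 < s → 0 < s′ → gcd s t ≡ 1 → gcd s′ t ≡ 1 →
    (F : FiniteField c ℓ (q ^ t)) →
    Isomorphic (𝒜 F (frobeniusPower F q s)) (𝒜 F (frobeniusPower F q s′)) ⇔
    (((+ s) ≡ (+ s′) [mod t ]) ⊎ ((+ s) ≡ (- (+ s′)) [mod t ]))
theorem4p7 q t s s′ q-primePower 3<q 1<t 0<s 0<s′ gcd-s gcd-s′ F = mk⇔ necessary sufficient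
  where
  instance
    t-nonZero : ℕ.NonZero t
    t-nonZero = ℕ.>-nonZero (ℕ.<-trans ℕ.z<s 1<t)

  open FrobeniusPowers q t q-primePower F
  open FiniteField F using (Carrier; _≈_; trans; sym; reflexive; *-identityʳ)
  open Plane F using (≈ᴹ-setoid)
  f g : Carrier → Carrier
  f = frob s
  g = frob s′

  3θ<n : 3 ℕ.* θ < q ^ t
  3θ<n = 3*geometricSum<q^t 3<q t

  necessary : Isomorphic (𝒜 F f) (𝒜 F g) → (((+ s) ≡ (+ s′) [mod t ]) ⊎ ((+ s) ≡ (- (+ s′)) [mod t ]))
  necessary (φ , φ-lines , _) with s % t ℕ.≟ s′ % t | t ℕ.∣? s ℕ.+ s′
  ... | yes s≡s′ | _         = inj₁ (Equivalence.from (≡[mod]⇔%≡% s s′) s≡s′)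
  ... | _        | yes t∣s+s′ = inj₂ (Equivalence.from (≡-[mod]⇔∣+ s s′) t∣s+s′)
  ... | no s≢s′  | no t∤s+s′ = ⊥-elim (FrobeniusPlanes.no-semilinear-collineation q t s s′ q-primePower
    (ℕ.<-trans (ℕ.s≤s (ℕ.s≤s ℕ.z≤n)) 3<q) F Ψ
    (Recognition.ψ-semilinear F {θ} (0<geometricSum q t) 3θ<n (16≤q^t 3<q 1<t)
      (frob-isRingHomomorphism s) (frob-isRingHomomorphism s′)
      (L⊆norm-1 s) (L⊆norm-1 s′) Ψ)
    (coprime⇒%≢0 {s} 1<t gcd-s) (coprime⇒%≢0 {s′} 1<t gcd-s′)
    (t∤s+s′ ∘ ℕ.m%n≡0⇒n∣m (s ℕ.+ s′) t) (s≢s′ ∘ ≡.sym)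
    -- If s + s′ and s had the same residue, then t would divide their difference s′.
    (λ eq → coprime⇒%≢0 {s′} 1<t gcd-s′ (ℕ.n∣m⇒m%n≡0 s′ t
      (≡.subst (t ℕ.∣_) (ℕ.m+n∸m≡n s s′) (%≡%⇒∣∸ s (s ℕ.+ s′) (≡.sym eq))))))
    where
    Ψ : AdditiveCollineation F f g
    Ψ = let m , m∉L , m≉0 = SlopeCounting.∃m∉L F {θ} (0<geometricSum q t) 3θ<n {f} (L⊆norm-1 s)
        in Collineation.additiveCollineation F f g
             (frob-isRingHomomorphism s) (frob-isRingHomomorphism s′) φ φ-lines m∉L m≉0

  sufficient : ((+ s) ≡ (+ s′) [mod t ]) ⊎ ((+ s) ≡ (- (+ s′)) [mod t ]) → Isomorphic (𝒜 F f) (𝒜 F g)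
  sufficient (inj₁ s≡s′) = Identity.inverse ≈ᴹ-setoid , S→T.identity-mapsLines f≈g , T→S.identity-mapsLines (sym ∘ f≈g)
    where
    module S→T = LinearIsomorphism F f g (frob-isRingHomomorphism s) (frob-isRingHomomorphism s′)
    module T→S = LinearIsomorphism F g f (frob-isRingHomomorphism s′) (frob-isRingHomomorphism s)
    f≈g : ∀ x → f x ≈ g x
    f≈g x = trans (frob-% s x) (trans
      (reflexive (≡.cong (λ e → frob e x) (Equivalence.to (≡[mod]⇔%≡% s s′) s≡s′))) (sym (frob-% s′ x)))
  sufficient (inj₂ s≡-s′) = S→T.swapping , S→T.swap-mapsLines gf≈id fg≈id , T→S.swap-mapsLines fg≈id gf≈id
    where
    module S→T = LinearIsomorphism F f g (frob-isRingHomomorphism s) (frob-isRingHomomorphism s′)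
    module T→S = LinearIsomorphism F g f (frob-isRingHomomorphism s′) (frob-isRingHomomorphism s)
    t∣s+s′ : t ℕ.∣ s ℕ.+ s′
    t∣s+s′ = Equivalence.to (≡-[mod]⇔∣+ s s′) s≡-s′
    frob≈id : ∀ {e} x → t ℕ.∣ e → frob e x ≈ x
    frob≈id {e} x t∣e = trans (frob-% e x) (trans
      (reflexive (≡.cong (λ e → frob e x) (ℕ.n∣m⇒m%n≡0 e t t∣e))) (*-identityʳ x))
    gf≈id : ∀ x → g (f x) ≈ x
    gf≈id x = trans (frob-∘ s s′ x) (frob≈id x t∣s+s′)
    fg≈id : ∀ x → f (g x) ≈ x
    fg≈id x = trans (frob-∘ s′ s x) (frob≈id x (≡.subst (t ℕ.∣_) (ℕ.+-comm s s′) t∣s+s′))
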